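{- Let $G$ be a bicyclic graph of order $n\geqslant 6$ with $G\notin\{B(n,0),B(n,1),B_n^{(1)},B_n^{3,3}\}$. \begin{itemize} \item[(i)] If $n=6$, then $W(G)<W(B_6^{(1)})<W(B(6,1))=W(B_6^{3,3})<W(B(6,0))$. \item[(ii)] If $n=8$ and $G\ncong B(8,2)$, then $W(G)<W(B(8,2))=W(B_8^{(1)})<W(B(8,1))<W(B_8^{3,3})<W(B(8,0))$. \item[(iii)] If $n\geqslant 7$ and $n\neq 8$, then $W(G)<W(B_n^{(1)})<W(B(n,1))<W(B_n^{3,3})<W(B(n,0))$. \end{itemize}
   Context: All graphs are finite, simple, undirected. A connected graph $G$ is bicyclic if $|E_G|=|V_G|+1$. The Wiener index is $W(G)=\sum_{\{u,v\}\subseteq V_G} d_G(u,v)$. $P_m$ is the path on $m$ vertices, $C_p$ the cycle on $p$ vertices, $K_4^-$ the graph obtained from $K_4$ by deleting one edge (it has two vertices of degree 3 and two of degree 2). $B_n^{(1)}$ is the $n$-vertex graph obtained by identifying an end-vertex of $P_{n-3}$ with a degree-3 vertex of $K_4^-$. For $0\leqslant s\leqslant\lfloor (n-4)/2\rfloor$, $B(n,s)$ is the $n$-vertex graph obtained from $K_4^-$ by attaching a path on $n-s-4$ new vertices to one degree-2 vertex and a path on $s$ new vertices to the other degree-2 vertex (each attached by an edge from the degree-2 vertex to an end-vertex of the path; a path on $0$ vertices means nothing is attached). $B_n^{p,q}$ is the $n$-vertex graph obtained by joining a vertex of $C_p$ and a vertex of a disjoint $C_q$ by a path of length $n-p-q+1$.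 -}

module Defs where

open import Data.Nat using (ℕ; zero; suc; _+_; _∸_; _<ᵇ_; _≡ᵇ_; _≤ᵇ_)
open import Data.Bool using (Bool; true; false; _∧_; _∨_; if_then_else_; T)
open import Data.Fin using (Fin; toℕ; _≟_)
import Data.Fin as F
open import Data.Fin.Permutation using (Permutation′; _⟨$⟩ʳ_)
open import Data.Product using (Σ; _×_)
open import Relation.Binary.PropositionalEquality using (_≡_)
open import Relation.Nullary using (¬_)
open import Relation.Nullary.Decidable using (⌊_⌋)

Graph : ℕ → Set
Graph n = Fin n → Fin n → Bool

IsSimple : ∀ {n} → Graph n → Set
IsSimple {n} G = (∀ (u v : Fin n) → G u v ≡ G v u) × (∀ (u : Fin n) → G u u ≡ false)

sumFin : ∀ {n} → (Fin n → ℕ) → ℕ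
sumFin {zero} f = 0
sumFin {suc n} f = f F.zero + sumFin (λ i → f (F.suc i))

anyFin : ∀ {n} → (Fin n → Bool) → Bool
anyFin {zero} f = false
anyFin {suc n} f = f F.zero ∨ anyFin (λ i → f (F.suc i))

data Walk {n} (G : Graph n) : Fin n → Fin n → Set where
  stay : ∀ {u} → Walk G u u
  step : ∀ {u w v} → T (G u w) → Walk G w v → Walk G u v

Connected : ∀ {n} → Graph n → Set
Connected {n} G = ∀ (u v : Fin n) → Walk G u v

edgeCount : ∀ {n} → Graph n → ℕ
edgeCount G = sumFin (λ u → sumFin (λ v → if (toℕ u <ᵇ toℕ v) ∧ G u v then 1 else 0))

Bicyclic : ∀ {n} → Graph n → Set
Bicyclic {n} G = IsSimple G × Connected G × (edgeCount G ≡ n + 1)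

reachIn : ∀ {n} → Graph n → ℕ → Fin n → Fin n → Bool
reachIn G zero u v = ⌊ u ≟ v ⌋
reachIn G (suc k) u v = reachIn G k u v ∨ anyFin (λ w → G u w ∧ reachIn G k w v)

-- least k < b with p k, or b if none
leastBelow : ℕ → (ℕ → Bool) → ℕ
leastBelow b p = go b 0
  where
  go : ℕ → ℕ → ℕ
  go zero k = k
  go (suc f) k = if p k then k else go f (suc k)

-- distance: least length of a walk (= shortest path length); in a connected
-- n-vertex graph it is < n, so the search bound n is never reached.
dist : ∀ {n} → Graph n → Fin n → Fin n → ℕ
dist {n} G u v = leastBelow n (λ k → reachIn G k u v)

W : ∀ {n} → Graph n → ℕ
W G = sumFin (λ u → sumFin (λ v → if toℕ u <ᵇ toℕ v then dist G u v else 0))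

_≅_ : ∀ {n} → Graph n → Graph n → Set
_≅_ {n} G H = Σ (Permutation′ n) (λ π → ∀ (u v : Fin n) → G u v ≡ H (π ⟨$⟩ʳ u) (π ⟨$⟩ʳ v))

fromEdges : (n : ℕ) → (ℕ → ℕ → Bool) → Graph n
fromEdges n E u v = E (toℕ u) (toℕ v) ∨ E (toℕ v) (toℕ u)

-- K4^- on labels 0,1,2,3: 0,1 have degree 3; 2,3 have degree 2
K4⁻E : ℕ → ℕ → Bool
K4⁻E a b = ((a ≡ᵇ 0) ∧ ((b ≡ᵇ 1) ∨ (b ≡ᵇ 2) ∨ (b ≡ᵇ 3)))
         ∨ ((a ≡ᵇ 1) ∧ ((b ≡ᵇ 2) ∨ (b ≡ᵇ 3)))

-- B_n^(1): path 0 - 4 - 5 - ... - (n-1) hanging at degree-3 vertex 0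
B1 : (n : ℕ) → Graph n
B1 n = fromEdges n (λ a b →
     K4⁻E a b
   ∨ ((a ≡ᵇ 0) ∧ (b ≡ᵇ 4) ∧ (4 <ᵇ n))
   ∨ ((4 ≤ᵇ a) ∧ (b ≡ᵇ suc a) ∧ (b <ᵇ n)))

-- B(n,s): path 2 - 4 - ... - (n-s-1) (n-s-4 new vertices) at degree-2 vertex 2,
-- path 3 - (n-s) - ... - (n-1) (s new vertices) at degree-2 vertex 3
B : (n s : ℕ) → Graph n
B n s = fromEdges n (λ a b →
     K4⁻E a b
   ∨ ((a ≡ᵇ 2) ∧ (b ≡ᵇ 4) ∧ (4 <ᵇ n ∸ s))
   ∨ ((4 ≤ᵇ a) ∧ (b ≡ᵇ suc a) ∧ (b <ᵇ n ∸ s))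
   ∨ ((a ≡ᵇ 3) ∧ (b ≡ᵇ n ∸ s) ∧ (1 ≤ᵇ s))
   ∨ ((n ∸ s ≤ᵇ a) ∧ (b ≡ᵇ suc a) ∧ (b <ᵇ n)))

-- B_n^{3,3}: triangles {0,1,2} and {3,4,5}, joined from 0 to 3 by the path
-- 0 - 6 - 7 - ... - (n-1) - 3 of length n-5 (the edge 0-3 when n = 6)
B33 : (n : ℕ) → Graph n
B33 n = fromEdges n (λ a b →
     ((a ≡ᵇ 0) ∧ ((b ≡ᵇ 1) ∨ (b ≡ᵇ 2)))
   ∨ ((a ≡ᵇ 1) ∧ (b ≡ᵇ 2))
   ∨ ((a ≡ᵇ 3) ∧ ((b ≡ᵇ 4) ∨ (b ≡ᵇ 5)))
   ∨ ((a ≡ᵇ 4) ∧ (b ≡ᵇ 5))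
   ∨ ((n ≡ᵇ 6) ∧ (a ≡ᵇ 0) ∧ (b ≡ᵇ 3))
   ∨ ((7 ≤ᵇ n) ∧ (a ≡ᵇ 0) ∧ (b ≡ᵇ 6))
   ∨ ((6 ≤ᵇ a) ∧ (b ≡ᵇ suc a) ∧ (b <ᵇ n))
   ∨ ((7 ≤ᵇ n) ∧ (a ≡ᵇ 3) ∧ (b ≡ᵇ n ∸ 1)))

{-# OPTIONS --safe #-}

-- Put f G = W(Pₙ) − W G. The claim is f G ≥ 3n − 8 outside the listed graphs, where f (B1 n) = 3n − 9.
-- If v is not a cut vertex, then f G ≥ f (G − v) + δ, where δ = n(n−1)/2 − Σ d(v,·) is at least what the vertices
-- off a longest geodesic from v contribute. Deleting farthest vertices gives f ≥ 0, f ≥ n − 2 and f ≥ 2n − 5 for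
-- connected graphs with at least n − 1, n and n + 1 edges. Now let G be bicyclic. If two vertices are at distance
-- n − 2, then G is a path with one doubled vertex, that is B(n,s). Otherwise a pendant vertex has δ ≥ 4, unless G is
-- B1 n, and induction applies. Without pendant vertices, a non-cut vertex of degree 2 has δ ≥ 2n − 5, unless it lies
-- in a triangle attached at one vertex (or n = 6), and two such triangles leave only B33 n.
module Submission where

-- A path of length j + j′ with vertex j doubled has f = n - 2 + j·j′. This gives 2n - 5 for B(n,0),
-- 3n - 10 for B(n,1), and 15 = 3·8 - 9 for j = j′ = 3: hence the tie of B(8,2) with B1 and the
-- separate case n = 8. B33 has f = 2n - 4, which meets 3n - 10 at n = 6. The obstacle is that f ≥
-- 3n - 8 is not hereditary: deleting a vertex may produce one of the excluded graphs. The
-- inductions therefore run on weaker bounds that have no exceptions: 2n - 5 in general, 2n - 4 for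
-- diameter at most n - 3 and n ≥ 5 (attained by B33), and 3n - 9 if there is moreover a pendant
-- vertex (attained by B1). The last unit is gained only in the final deletion, where equality is
-- traced back to a named graph. Named graphs are recognised by distance tables: adjacency is
-- distance 1, so two graphs on n vertices with the same table are isomorphic, and the same table
-- yields the Wiener index. Inequalities on f are written additively, W + c ≤ pathWiener + b for f ≥
-- c - b, to keep truncated subtraction out.

open import Defs
open import Data.Bool using (Bool; true; false; if_then_else_; T; _∧_; _∨_)
open import Data.Bool.Properties using (T-∧; T-∨; T-≡; T?; ∨-comm)
open import Data.Empty using (⊥; ⊥-elim)
open import Data.Fin using (Fin; toℕ; punchIn; punchOut) renaming (zero to fzero; suc to fsuc; _≟_ to _≟F_)
open import Data.Fin.Permutation using (permutation)
open import Data.Fin.Properties using (any?; all?; punchInᵢ≢i; punchIn-punchOut; punchIn-injective; toℕ-injective; ¬∀⟶∃¬)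
open import Data.List using (_∷_; [])
open import Data.Nat
open import Data.Nat.Properties
open import Data.Nat.Tactic.RingSolver using (solve)
open import Data.Product
open import Data.Sum using (_⊎_; inj₁; inj₂; [_,_]′)
open import Data.Unit using (tt)
open import Function using (_∘_; case_of_; id; Equivalence)
open import Relation.Binary.Definitions using (tri<; tri≈; tri>)
open import Relation.Binary.PropositionalEquality
open import Relation.Nullary
open import Relation.Nullary.Decidable using (⌊_⌋; _×-dec_; ¬?; decidable-stable)

-- Sums over enumerations

-- The slack c turns a linear consequence of a₁ ≤ b₁ into a semiring identity, within reach of the ring solver.
lin : ∀ {a b a₁ b₁} c → a₁ ≤ b₁ → a + b₁ + c ≡ b + a₁ → a ≤ b
lin {a} {b} {a₁} {b₁} c h eq =
  +-cancelʳ-≤ b₁ a b (≤-trans (m≤m+n _ c) (≤-trans (≤-reflexive eq) (+-monoʳ-≤ b h)))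

infixr 4 _⊹_
_⊹_ : ∀ {a b c d} → a ≤ b → c ≤ d → a + c ≤ b + d
_⊹_ = +-mono-≤

≡≤ : ∀ {a b : ℕ} → a ≡ b → a ≤ b
≡≤ = ≤-reflexive

≡≥ : ∀ {a b : ℕ} → a ≡ b → b ≤ a
≡≥ = ≤-reflexive ∘ sym

interchange : ∀ a b c d → (a + b) + (c + d) ≡ (a + c) + (b + d)
interchange a b c d = solve (a ∷ b ∷ c ∷ d ∷ [])

sumFin-cong : ∀ {n} {f g : Fin n → ℕ} → (∀ u → f u ≡ g u) → sumFin f ≡ sumFin g
sumFin-cong {zero} h = refl
sumFin-cong {suc n} h = cong₂ _+_ (h fzero) (sumFin-cong (h ∘ fsuc))

sumFin-mono : ∀ {n} {f g : Fin n → ℕ} → (∀ u → f u ≤ g u) → sumFin f ≤ sumFin g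
sumFin-mono {zero} h = z≤n
sumFin-mono {suc n} h = h fzero ⊹ sumFin-mono (h ∘ fsuc)

sumFin-+ : ∀ {n} (f g : Fin n → ℕ) → sumFin (λ u → f u + g u) ≡ sumFin f + sumFin g
sumFin-+ {zero} f g = refl
sumFin-+ {suc n} f g =
  trans (cong (f fzero + g fzero +_) (sumFin-+ (f ∘ fsuc) (g ∘ fsuc)))
        (interchange (f fzero) (g fzero) (sumFin (f ∘ fsuc)) (sumFin (g ∘ fsuc)))

sumFin-const : ∀ n c → sumFin {n} (λ _ → c) ≡ n * c
sumFin-const zero c = refl
sumFin-const (suc n) c = cong (c +_) (sumFin-const n c)

sumFin-zero : ∀ {n} {f : Fin n → ℕ} → (∀ u → f u ≡ 0) → sumFin f ≡ 0
sumFin-zero {n} h = trans (sumFin-cong h) (trans (sumFin-const n 0) (*-zeroʳ n))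

sumFin-swap : ∀ {m n} (F : Fin m → Fin n → ℕ) →
  sumFin (λ u → sumFin (λ v → F u v)) ≡ sumFin (λ v → sumFin (λ u → F u v))
sumFin-swap {zero} {n} F = sym (sumFin-zero {n} (λ _ → refl))
sumFin-swap {suc m} F =
  trans (cong (sumFin (F fzero) +_) (sumFin-swap (F ∘ fsuc)))
        (sym (sumFin-+ (F fzero) (λ v → sumFin (λ u → F (fsuc u) v))))

sumFin-punchIn : ∀ {m} (v : Fin (suc m)) (f : Fin (suc m) → ℕ) →
  sumFin f ≡ f v + sumFin (f ∘ punchIn v)
sumFin-punchIn fzero f = refl
sumFin-punchIn {suc m} (fsuc v) f =
  trans (cong (f fzero +_) (sumFin-punchIn v (f ∘ fsuc)))
        (swap-front (f fzero) (f (fsuc v)) (sumFin (f ∘ fsuc ∘ punchIn v)))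
  where
  swap-front : ∀ a b c → a + (b + c) ≡ b + (a + c)
  swap-front a b c = solve (a ∷ b ∷ c ∷ [])

erase : ∀ {n} → Fin n → (Fin n → ℕ) → Fin n → ℕ
erase v f u = if ⌊ u ≟F v ⌋ then 0 else f u

erase-self : ∀ {n} (v : Fin n) f → erase v f v ≡ 0
erase-self v f with v ≟F v
... | yes _ = refl
... | no v≢v = ⊥-elim (v≢v refl)

erase-other : ∀ {n} {v u : Fin n} f → u ≢ v → erase v f u ≡ f u
erase-other {v = v} {u} f u≢v with u ≟F v
... | yes u≡v = ⊥-elim (u≢v u≡v)
... | no _ = refl

erase-≤ : ∀ {n} (v : Fin n) f u → erase v f u ≤ f u
erase-≤ v f u with u ≟F v
... | yes _ = z≤n
... | no _ = ≤-refl

sumFin-erase : ∀ {n} (v : Fin n) f → sumFin f ≡ f v + sumFin (erase v f)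
sumFin-erase {suc n} v f = trans (sumFin-punchIn v f) (cong (f v +_) (sym (begin
  sumFin (erase v f)                                     ≡⟨ sumFin-punchIn v (erase v f) ⟩
  erase v f v + sumFin (erase v f ∘ punchIn v)           ≡⟨ cong (_+ sumFin (erase v f ∘ punchIn v)) (erase-self v f) ⟩
  sumFin (erase v f ∘ punchIn v)                         ≡⟨ sumFin-cong (λ u → erase-other f (punchInᵢ≢i v u)) ⟩
  sumFin (f ∘ punchIn v)                                 ∎)))
  where open ≡-Reasoning

sumTo : ℕ → (ℕ → ℕ) → ℕ
sumTo zero f = 0
sumTo (suc k) f = sumTo k f + f k

sumTo-cong : ∀ k {f g : ℕ → ℕ} → (∀ i → i < k → f i ≡ g i) → sumTo k f ≡ sumTo k g
sumTo-cong zero h = refl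
sumTo-cong (suc k) h = cong₂ _+_ (sumTo-cong k (λ i i<k → h i (m<n⇒m<1+n i<k))) (h k ≤-refl)

sumTo-mono : ∀ k {f g : ℕ → ℕ} → (∀ i → i < k → f i ≤ g i) → sumTo k f ≤ sumTo k g
sumTo-mono zero h = z≤n
sumTo-mono (suc k) h = sumTo-mono k (λ i i<k → h i (m<n⇒m<1+n i<k)) ⊹ h k ≤-refl

sumTo-+ : ∀ k (f g : ℕ → ℕ) → sumTo k (λ i → f i + g i) ≡ sumTo k f + sumTo k g
sumTo-+ zero f g = refl
sumTo-+ (suc k) f g = trans (cong (_+ (f k + g k)) (sumTo-+ k f g)) (interchange (sumTo k f) (sumTo k g) (f k) (g k))

sumTo-const : ∀ k c → sumTo k (λ _ → c) ≡ k * c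
sumTo-const zero c = refl
sumTo-const (suc k) c = trans (cong (_+ c) (sumTo-const k c)) (+-comm (k * c) c)

-- A list of k distinct vertices is a total function with its length kept beside it; values from k
-- on are junk. A further vertex is then appended by `_⟨_⟩▹_` without moving between `Fin` types.
InjectiveBelow : ∀ {A : Set} → ℕ → (ℕ → A) → Set
InjectiveBelow k e = ∀ i j → i < k → j < k → e i ≡ e j → i ≡ j

InjectiveBelow-pred : ∀ {A : Set} {k} {e : ℕ → A} → InjectiveBelow (suc k) e → InjectiveBelow k e
InjectiveBelow-pred inj i j i<k j<k = inj i j (m<n⇒m<1+n i<k) (m<n⇒m<1+n j<k)

infixl 5 _⟨_⟩▹_
_⟨_⟩▹_ : ∀ {A : Set} → (ℕ → A) → ℕ → A → ℕ → A
(e ⟨ k ⟩▹ x) i with i <? k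
... | yes _ = e i
... | no _ = x

▹-old : ∀ {A : Set} (e : ℕ → A) {k i} x → i < k → (e ⟨ k ⟩▹ x) i ≡ e i
▹-old e {k} {i} x i<k with i <? k
... | yes _ = refl
... | no i≮k = ⊥-elim (i≮k i<k)

▹-new : ∀ {A : Set} (e : ℕ → A) k x → (e ⟨ k ⟩▹ x) k ≡ x
▹-new e k x with k <? k
... | yes k<k = ⊥-elim (<-irrefl refl k<k)
... | no _ = refl

▹-injective : ∀ {A : Set} {e : ℕ → A} {k x} → InjectiveBelow k e → (∀ i → i < k → e i ≢ x) →
  InjectiveBelow (suc k) (e ⟨ k ⟩▹ x)
▹-injective {e = e} {k} {x} inj fresh i j i<sk j<sk eq with i <? k | j <? k
... | yes i<k | yes j<k = inj i j i<k j<k eq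
... | yes i<k | no  _   = ⊥-elim (fresh i i<k eq)
... | no  _   | yes j<k = ⊥-elim (fresh j j<k (sym eq))
... | no i≮k  | no j≮k  = trans (≤-antisym (s≤s⁻¹ i<sk) (≮⇒≥ i≮k)) (sym (≤-antisym (s≤s⁻¹ j<sk) (≮⇒≥ j≮k)))

sumTo-▹ : ∀ {A : Set} (g : A → ℕ) (e : ℕ → A) k x → sumTo (suc k) (g ∘ (e ⟨ k ⟩▹ x)) ≡ sumTo k (g ∘ e) + g x
sumTo-▹ g e k x = cong₂ _+_ (sumTo-cong k (λ i i<k → cong g (▹-old e x i<k))) (cong g (▹-new e k x))

-- The value at the last vertex is split off by `erase`; by injectivity the earlier terms do not see
-- the change, so the induction continues with the erased function.
sumTo≤sumFin : ∀ {n} k (e : ℕ → Fin n) → InjectiveBelow k e → ∀ g → sumTo k (g ∘ e) ≤ sumFin g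
sumTo≤sumFin zero e inj g = z≤n
sumTo≤sumFin (suc k) e inj g = begin
  sumTo k (g ∘ e) + g (e k)                ≡⟨ cong (_+ g (e k)) (sumTo-cong k (λ i i<k → sym (erase-other g (λ eq →
      <-irrefl (inj i k (m<n⇒m<1+n i<k) ≤-refl eq) i<k)))) ⟩
  sumTo k (erase (e k) g ∘ e) + g (e k)    ≤⟨ +-monoˡ-≤ (g (e k)) (sumTo≤sumFin k e (InjectiveBelow-pred inj) (erase (e k) g)) ⟩
  sumFin (erase (e k) g) + g (e k)         ≡⟨ +-comm _ (g (e k)) ⟩
  g (e k) + sumFin (erase (e k) g)         ≡⟨ sym (sumFin-erase (e k) g) ⟩
  sumFin g                                 ∎
  where open ≤-Reasoning

injectiveBelow⇒≤ : ∀ {n} k (e : ℕ → Fin n) → InjectiveBelow k e → k ≤ n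
injectiveBelow⇒≤ {n} k e inj = begin
  k                    ≡⟨ sym (trans (sumTo-const k 1) (*-identityʳ k)) ⟩
  sumTo k (λ _ → 1)    ≤⟨ sumTo≤sumFin k e inj (λ _ → 1) ⟩
  sumFin {n} (λ _ → 1) ≡⟨ trans (sumFin-const n 1) (*-identityʳ n) ⟩
  n                    ∎
  where open ≤-Reasoning

Hits : ∀ {n} → ℕ → (ℕ → Fin n) → Fin n → Set
Hits k e u = Σ ℕ λ i → i < k × e i ≡ u

hits? : ∀ {n} k (e : ℕ → Fin n) u → Hits k e u ⊎ (∀ i → i < k → e i ≢ u)
hits? zero e u = inj₂ λ _ ()
hits? (suc k) e u with e k ≟F u | hits? k e u
... | yes eq | _ = inj₁ (k , ≤-refl , eq)
... | no _ | inj₁ (i , i<k , eq) = inj₁ (i , m<n⇒m<1+n i<k , eq)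
... | no ek≢u | inj₂ miss = inj₂ λ i i<sk → case m≤n⇒m<n∨m≡n (s≤s⁻¹ i<sk) of λ
  { (inj₁ i<k) → miss i i<k ; (inj₂ refl) → ek≢u }

sumFin≤sumTo : ∀ {n} k (e : ℕ → Fin n) g → (∀ u → Hits k e u ⊎ g u ≡ 0) → sumFin g ≤ sumTo k (g ∘ e)
sumFin≤sumTo zero e g h = ≡≤ (sumFin-zero λ u → case h u of λ { (inj₁ (_ , () , _)) ; (inj₂ eq) → eq })
sumFin≤sumTo (suc k) e g h = begin
  sumFin g                              ≡⟨ sumFin-erase (e k) g ⟩
  g (e k) + sumFin (erase (e k) g)      ≤⟨ +-monoʳ-≤ (g (e k)) (sumFin≤sumTo k e (erase (e k) g) hit) ⟩
  g (e k) + sumTo k (erase (e k) g ∘ e) ≤⟨ +-monoʳ-≤ (g (e k)) (sumTo-mono k (λ i _ → erase-≤ (e k) g (e i))) ⟩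
  g (e k) + sumTo k (g ∘ e)             ≡⟨ +-comm (g (e k)) _ ⟩
  sumTo k (g ∘ e) + g (e k)             ∎
  where
  open ≤-Reasoning
  hit : ∀ u → Hits k e u ⊎ erase (e k) g u ≡ 0
  hit u with u ≟F e k
  ... | yes _ = inj₂ refl
  ... | no u≢ek with h u
  ...   | inj₂ eq = inj₂ eq
  ...   | inj₁ (i , i<sk , eq) with m≤n⇒m<n∨m≡n (s≤s⁻¹ i<sk)
  ...     | inj₁ i<k = inj₁ (i , i<k , eq)
  ...     | inj₂ refl = ⊥-elim (u≢ek (sym eq))

allHit⇒≤ : ∀ {n} k (e : ℕ → Fin n) → (∀ u → Hits k e u) → n ≤ k
allHit⇒≤ {n} k e h = begin
  n                     ≡⟨ sym (trans (sumFin-const n 1) (*-identityʳ n)) ⟩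
  sumFin {n} (λ _ → 1)  ≤⟨ sumFin≤sumTo k e (λ _ → 1) (inj₁ ∘ h) ⟩
  sumTo k (λ _ → 1)     ≡⟨ trans (sumTo-const k 1) (*-identityʳ k) ⟩
  k                     ∎
  where open ≤-Reasoning

-- Pigeonhole. Being hit is decidable, so the failure of a cover yields an actual vertex; the
-- vertices off a geodesic are obtained this way.
fresh : ∀ {n} k (e : ℕ → Fin n) → k < n → Σ (Fin n) λ x → ∀ i → i < k → e i ≢ x
fresh {n} k e k<n with ¬∀⟶∃¬ n (Hits k e) dec (λ all → <⇒≱ k<n (allHit⇒≤ k e all))
  where
  dec : ∀ u → Dec (Hits k e u)
  dec u with hits? k e u
  ... | inj₁ h = yes h
  ... | inj₂ miss = no λ (i , i<k , eq) → miss i i<k eq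
... | x , ¬hit = x , λ i i<k eq → ¬hit (i , i<k , eq)

surjectiveBelow : ∀ {n} (e : ℕ → Fin n) → InjectiveBelow n e → ∀ u → Hits n e u
surjectiveBelow {n} e inj u with hits? n e u
... | inj₁ h = h
... | inj₂ miss = ⊥-elim (<-irrefl refl (injectiveBelow⇒≤ (suc n) (e ⟨ n ⟩▹ u) (▹-injective inj miss)))

sumTo≡sumFin : ∀ {n} (e : ℕ → Fin n) → InjectiveBelow n e → ∀ g → sumTo n (g ∘ e) ≡ sumFin g
sumTo≡sumFin {n} e inj g =
  ≤-antisym (sumTo≤sumFin n e inj g) (sumFin≤sumTo n e g (inj₁ ∘ surjectiveBelow e inj))

-- Sums over unordered pairs

upperSum : ∀ {n} → (Fin n → Fin n → ℕ) → ℕ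
upperSum F = sumFin (λ u → sumFin (λ v → if toℕ u <ᵇ toℕ v then F u v else 0))

-- `upperSum` follows the labels, as `W` and `edgeCount` do; this sum follows positions in an
-- enumeration, so that a graph can be summed in the order its structure suggests.
pairSum : ℕ → (ℕ → ℕ → ℕ) → ℕ
pairSum n F = sumTo n (λ k → sumTo k (λ i → F i k))

pairSum-cong : ∀ n {F G : ℕ → ℕ → ℕ} → (∀ i k → i < k → k < n → F i k ≡ G i k) → pairSum n F ≡ pairSum n G
pairSum-cong n h = sumTo-cong n λ k k<n → sumTo-cong k λ i i<k → h i k i<k k<n

pairSum-mono : ∀ n {F G : ℕ → ℕ → ℕ} → (∀ i k → i < k → k < n → F i k ≤ G i k) → pairSum n F ≤ pairSum n G
pairSum-mono n h = sumTo-mono n λ k k<n → sumTo-mono k λ i i<k → h i k i<k k<n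

Symmetric₀ : ∀ {A : Set} → (A → A → ℕ) → Set
Symmetric₀ {A} F = (∀ u v → F u v ≡ F v u) × (∀ u → F u u ≡ 0)

2upperSum : ∀ {n} (F : Fin n → Fin n → ℕ) → Symmetric₀ F → 2 * upperSum F ≡ sumFin (λ u → sumFin (F u))
2upperSum {n} F (sy , dg) = sym (begin
  sumFin (λ u → sumFin (F u))
    ≡⟨ sumFin-cong (λ u → trans (sumFin-cong (split u)) (sumFin-+ (A u) (Aᵗ u))) ⟩
  sumFin (λ u → sumFin (A u) + sumFin (Aᵗ u))
    ≡⟨ sumFin-+ (λ u → sumFin (A u)) (λ u → sumFin (Aᵗ u)) ⟩
  upperSum F + sumFin (λ u → sumFin (Aᵗ u))
    ≡⟨ cong (upperSum F +_) (trans (sumFin-swap Aᵗ) (sym (+-identityʳ (upperSum F)))) ⟩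
  2 * upperSum F ∎)
  where
  open ≡-Reasoning
  A Aᵗ : Fin n → Fin n → ℕ
  A u v = if toℕ u <ᵇ toℕ v then F u v else 0
  Aᵗ u v = A v u
  <ᵇ-true : ∀ {a b} → a < b → (a <ᵇ b) ≡ true
  <ᵇ-true a<b = Equivalence.to T-≡ (<⇒<ᵇ a<b)
  <ᵇ-false : ∀ {a b} → ¬ a < b → (a <ᵇ b) ≡ false
  <ᵇ-false {a} {b} a≮b with a <ᵇ b in eq
  ... | true = ⊥-elim (a≮b (<ᵇ⇒< a b (subst T (sym eq) tt)))
  ... | false = refl
  split : ∀ u v → F u v ≡ A u v + Aᵗ u v
  split u v with <-cmp (toℕ u) (toℕ v)
  ... | tri< lt _ gt rewrite <ᵇ-true lt | <ᵇ-false gt = sym (+-identityʳ _)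
  ... | tri> lt _ gt rewrite <ᵇ-true gt | <ᵇ-false lt = sy u v
  ... | tri≈ lt eq gt rewrite <ᵇ-false lt | <ᵇ-false gt | toℕ-injective eq = dg v

2pairSum : ∀ n (F : ℕ → ℕ → ℕ) → Symmetric₀ F → 2 * pairSum n F ≡ sumTo n (λ k → sumTo n (λ i → F i k))
2pairSum zero F s = refl
2pairSum (suc n) F s@(sy , dg) = sym (begin
  sumTo n (λ k → sumTo n (λ i → F i k) + F n k) + (R + F n n)
    ≡⟨ cong₂ (λ x y → x + (R + y)) (sumTo-+ n (λ k → sumTo n (λ i → F i k)) (F n)) (dg n) ⟩
  (sumTo n (λ k → sumTo n (λ i → F i k)) + sumTo n (F n)) + (R + 0)
    ≡⟨ cong₂ (λ x y → (x + y) + (R + 0)) (sym (2pairSum n F s)) (sumTo-cong n (λ i _ → sy n i)) ⟩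
  (2 * P + R) + (R + 0)
    ≡⟨ double P R ⟩
  2 * (P + R) ∎)
  where
  open ≡-Reasoning
  R P : ℕ
  R = sumTo n (λ i → F i n)
  P = pairSum n F
  double : ∀ a b → (2 * a + b) + (b + 0) ≡ 2 * (a + b)
  double a b = solve (a ∷ b ∷ [])

-- Doubling both sides gives full double sums, in which the order of the vertices no longer matters.
upperSum≡pairSum : ∀ {n} (e : ℕ → Fin n) → InjectiveBelow n e → ∀ F → Symmetric₀ F →
  upperSum F ≡ pairSum n (λ i k → F (e i) (e k))
upperSum≡pairSum {n} e inj F s@(sy , dg) = *-cancelˡ-≡ _ _ 2 (begin
  2 * upperSum F                                    ≡⟨ 2upperSum F s ⟩
  sumFin (λ u → sumFin (F u))                       ≡⟨ sumFin-cong (λ u → sumFin-cong (sy u)) ⟩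
  sumFin (λ u → sumFin (λ v → F v u))               ≡⟨ sym (sumTo≡sumFin e inj (λ u → sumFin (λ v → F v u))) ⟩
  sumTo n (λ k → sumFin (λ v → F v (e k)))          ≡⟨ sumTo-cong n (λ k _ → sym (sumTo≡sumFin e inj (λ v → F v (e k)))) ⟩
  sumTo n (λ k → sumTo n (λ i → F (e i) (e k)))     ≡⟨ sym (2pairSum n (λ i k → F (e i) (e k)) ((λ i k → sy (e i) (e k)) ,
      (λ i → dg (e i)))) ⟩
  2 * pairSum n (λ i k → F (e i) (e k))             ∎)
  where open ≡-Reasoning

upperSum-punchIn : ∀ {m} (v : Fin (suc m)) F → Symmetric₀ F →
  upperSum F ≡ upperSum (λ i j → F (punchIn v i) (punchIn v j)) + sumFin (F v)
upperSum-punchIn {m} v F s@(sy , dg) = *-cancelˡ-≡ _ _ 2 (begin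
  2 * upperSum F
    ≡⟨ 2upperSum F s ⟩
  sumFin (λ u → sumFin (F u))
    ≡⟨ sumFin-punchIn v (λ u → sumFin (F u)) ⟩
  D + sumFin (λ i → sumFin (F (p i)))
    ≡⟨ cong (D +_) (trans (sumFin-cong (λ i → sumFin-punchIn v (F (p i)))) (sumFin-+ (λ i → F (p i) v) (λ i →
        sumFin (F (p i) ∘ p)))) ⟩
  D + (sumFin (λ i → F (p i) v) + sumFin (λ i → sumFin (F (p i) ∘ p)))
    ≡⟨ cong₂ (λ x y → D + (x + y)) column (sym (2upperSum (λ i j → F (p i) (p j)) ((λ i j → sy (p i) (p j)) , (λ i →
        dg (p i))))) ⟩
  D + (D + 2 * S)
    ≡⟨ double D S ⟩
  2 * (S + D) ∎)
  where
  open ≡-Reasoning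
  p : Fin m → Fin (suc m)
  p = punchIn v
  D S : ℕ
  D = sumFin (F v)
  S = upperSum (λ i j → F (p i) (p j))
  column : sumFin (λ i → F (p i) v) ≡ D
  column = trans (sumFin-cong (λ i → sy (p i) v))
    (sym (trans (sumFin-punchIn v (F v)) (cong (_+ sumFin (F v ∘ p)) (dg v))))
  double : ∀ d s → d + (d + 2 * s) ≡ 2 * (s + d)
  double d s = solve (d ∷ s ∷ [])

-- Distances and vertex deletion

Search : (ℕ → Bool) → (ℕ → ℕ → ℕ) → Set
Search p g = (∀ k → g 0 k ≡ k) × (∀ f k → g (suc f) k ≡ (if p k then k else g f (suc k)))

-- The search loop inside leastBelow is local to Defs; unification recovers it from a use of leastBelow
-- whose literal arguments have been abstracted.
mutual
  loop : ℕ → (ℕ → Bool) → ℕ → ℕ → ℕ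
  loop c p = _

  leastBelow-loop : ∀ b (p : ℕ → Bool) → leastBelow (suc b) p ≡ (if p 0 then 0 else loop (suc b) p b 1)
  leastBelow-loop b p with suc b | 1
  ... | c | k = refl

leastBelow-search : ∀ b (p : ℕ → Bool) → Σ (ℕ → ℕ → ℕ) λ g → Search p g × leastBelow (suc b) p ≡ (if p 0 then 0 else g b 1)
leastBelow-search b p = loop (suc b) p , ((λ k → refl) , λ f k → refl) , leastBelow-loop b p

module _ {p : ℕ → Bool} {g : ℕ → ℕ → ℕ} (s : Search p g) where

  search-≤ : ∀ f j k → j ≤ k → T (p k) → g f j ≤ k
  search-≤ zero j k j≤k pk rewrite proj₁ s j = j≤k
  search-≤ (suc f) j k j≤k pk rewrite proj₂ s f j with p j in eq
  ... | true = j≤k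
  ... | false with m≤n⇒m<n∨m≡n j≤k
  ...   | inj₁ j<k = search-≤ f (suc j) k j<k pk
  ...   | inj₂ refl = ⊥-elim (subst T eq pk)

  search-finds : ∀ f j k → j ≤ k → k < j + f → T (p k) → T (p (g f j))
  search-finds zero j k j≤k k<j pk = ⊥-elim (<⇒≱ (subst (k <_) (+-identityʳ j) k<j) j≤k)
  search-finds (suc f) j k j≤k k<j+f pk rewrite proj₂ s f j with p j in eq
  ... | true = subst T (sym eq) tt
  ... | false with m≤n⇒m<n∨m≡n j≤k
  ...   | inj₁ j<k = search-finds f (suc j) k j<k (subst (k <_) (+-suc j f) k<j+f) pk
  ...   | inj₂ refl = ⊥-elim (subst T eq pk)

leastBelow-≤ : ∀ b (p : ℕ → Bool) k → T (p k) → leastBelow b p ≤ k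
leastBelow-≤ zero p k pk = z≤n
leastBelow-≤ (suc b) p k pk with leastBelow-search b p
... | g , s , eq rewrite eq with p 0 in eq₀ | k
...   | true | _ = z≤n
...   | false | zero = ⊥-elim (subst T eq₀ pk)
...   | false | suc k′ = search-≤ {p} {g} s b 1 (suc k′) (s≤s z≤n) pk

leastBelow-finds : ∀ b (p : ℕ → Bool) k → k < b → T (p k) → T (p (leastBelow b p))
leastBelow-finds (suc b) p k k<b pk with leastBelow-search b p
... | g , s , eq rewrite eq with p 0 in eq₀ | k
...   | true | _ = subst T (sym eq₀) tt
...   | false | zero = ⊥-elim (subst T eq₀ pk)
...   | false | suc k′ = search-finds {p} {g} s b 1 (suc k′) (s≤s z≤n) k<b pk

anyFin-intro : ∀ {n} (f : Fin n → Bool) w → T (f w) → T (anyFin f)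
anyFin-intro f fzero h = Equivalence.from T-∨ (inj₁ h)
anyFin-intro f (fsuc w) h = Equivalence.from T-∨ (inj₂ (anyFin-intro (f ∘ fsuc) w h))

anyFin-elim : ∀ {n} (f : Fin n → Bool) → T (anyFin f) → Σ (Fin n) λ w → T (f w)
anyFin-elim {suc n} f h with Equivalence.to (T-∨ {f fzero}) h
... | inj₁ h₀ = fzero , h₀
... | inj₂ h₊ = let w , hw = anyFin-elim (f ∘ fsuc) h₊ in fsuc w , hw

⌊≟⌋-refl : ∀ {n} (u : Fin n) → T ⌊ u ≟F u ⌋
⌊≟⌋-refl u with u ≟F u
... | yes _ = tt
... | no u≢u = u≢u refl

⌊≟⌋⇒≡ : ∀ {n} {u v : Fin n} → T ⌊ u ≟F v ⌋ → u ≡ v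
⌊≟⌋⇒≡ {u = u} {v} h with u ≟F v
... | yes eq = eq

module _ {n} (G : Graph n) where

  Reach : ℕ → Fin n → Fin n → Set
  Reach k u v = T (reachIn G k u v)

  reach-step : ∀ {k u w v} → T (G u w) → Reach k w v → Reach (suc k) u v
  reach-step {k} {u} {w} {v} e r = Equivalence.from T-∨ (inj₂ (anyFin-intro (λ w → G u w ∧ reachIn G k w v) w
      (Equivalence.from T-∧ (e , r))))

  reach-inv : ∀ {k u v} → Reach (suc k) u v → Reach k u v ⊎ Σ (Fin n) λ w → T (G u w) × Reach k w v
  reach-inv {k} {u} {v} r with Equivalence.to (T-∨ {reachIn G k u v}) r
  ... | inj₁ r′ = inj₁ r′
  ... | inj₂ a = let w , h = anyFin-elim (λ w → G u w ∧ reachIn G k w v) a in inj₂ (w , Equivalence.to T-∧ h)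

  walk⇒reach : ∀ {u v} → Walk G u v → Σ ℕ λ k → Reach k u v
  walk⇒reach {u} stay = 0 , ⌊≟⌋-refl u
  walk⇒reach (step e w) = let k , r = walk⇒reach w in suc k , reach-step {k} e r

  module _ (v : Fin n) where

    Exact : ℕ → Fin n → Set
    Exact k u = Reach k u v × (∀ j → Reach j u v → k ≤ j)

    exact-pred : ∀ {k u} → Exact (suc k) u → Σ (Fin n) λ w → Exact k w
    exact-pred {k} (r , least) with reach-inv {k} r
    ... | inj₁ r′ = ⊥-elim (<-irrefl refl (least k r′))
    ... | inj₂ (w , e , r′) = w , r′ , λ j rj → s≤s⁻¹ (least (suc j) (reach-step {j} e rj))

    exact-levels : ∀ k {u} → Exact k u → Σ (ℕ → Fin n) λ e → ∀ i → i ≤ k → Exact i (e i)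
    exact-levels zero {u} ex = (λ _ → u) , λ { .zero z≤n → ex }
    exact-levels (suc k) {u} ex = let w , ex′ = exact-pred ex; e , lev = exact-levels k ex′ in
      e ⟨ suc k ⟩▹ u , λ i i≤sk → case m≤n⇒m<n∨m≡n i≤sk of λ
        { (inj₁ i<sk) → subst (Exact i) (sym (▹-old e u i<sk)) (lev i (s≤s⁻¹ i<sk))
        ; (inj₂ refl) → subst (Exact (suc k)) (sym (▹-new e (suc k) u)) ex }

    -- The predecessors of u lie at every smaller level and are pairwise different, so k + 1
    -- vertices fit into the graph. This is why the search bound in `dist` is never reached.
    exact-< : ∀ {k u} → Exact k u → k < n
    exact-< {k} ex with exact-levels k ex
    ... | e , lev = injectiveBelow⇒≤ (suc k) e λ i j i<sk j<sk eq →
      let ri , li = lev i (s≤s⁻¹ i<sk); rj , lj = lev j (s≤s⁻¹ j<sk) in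
      ≤-antisym (li j (subst (λ x → Reach j x v) (sym eq) rj)) (lj i (subst (λ x → Reach i x v) eq ri))

record ConnectedGraph (n : ℕ) : Set where
  constructor connectedGraph
  field
    adj : Graph n
    simple : IsSimple adj
    connected : Connected adj

open ConnectedGraph public

module _ {n} (Γ : ConnectedGraph n) where

  Edge : Fin n → Fin n → Set
  Edge u v = T (adj Γ u v)

  edge? : ∀ u v → Dec (Edge u v)
  edge? u v = T? (adj Γ u v)

  edge-sym : ∀ {u v} → Edge u v → Edge v u
  edge-sym {u} {v} = subst T (proj₁ (simple Γ) u v)

  edge⇒≢ : ∀ {u v} → Edge u v → u ≢ v
  edge⇒≢ {u} e refl = subst T (proj₂ (simple Γ) u) e

  opaque
    d : Fin n → Fin n → ℕ
    d = dist (adj Γ)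

  opaque
    unfolding d

    W≡upperSum : W (adj Γ) ≡ upperSum d
    W≡upperSum = refl

    d-≤ : ∀ {u v} k → Reach (adj Γ) k u v → d u v ≤ k
    d-≤ {u} {v} k = leastBelow-≤ n (λ k → reachIn (adj Γ) k u v) k

    d-reach : ∀ u v → Reach (adj Γ) (d u v) u v
    d-reach u v with walk⇒reach (adj Γ) (connected Γ u v)
    ... | L , r = leastBelow-finds n p m (exact-< (adj Γ) v ex) (proj₁ ex)
      where
      p : ℕ → Bool
      p k = reachIn (adj Γ) k u v
      m : ℕ
      m = leastBelow (suc L) p
      ex : Exact (adj Γ) v m u
      ex = leastBelow-finds (suc L) p L ≤-refl r , leastBelow-≤ (suc L) p

  d-refl : ∀ u → d u u ≡ 0
  d-refl u = n≤0⇒n≡0 (d-≤ 0 (⌊≟⌋-refl u))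

  d≡0⇒≡ : ∀ {u v} → d u v ≡ 0 → u ≡ v
  d≡0⇒≡ {u} {v} eq = ⌊≟⌋⇒≡ (subst (λ k → Reach (adj Γ) k u v) eq (d-reach u v))

  d-step : ∀ {u w} v → Edge u w → d u v ≤ suc (d w v)
  d-step {u} {w} v e = d-≤ (suc (d w v)) (reach-step (adj Γ) {d w v} e (d-reach w v))

  d-next : ∀ {u v k} → d u v ≡ suc k → Σ (Fin n) λ w → Edge u w × d w v ≡ k
  d-next {u} {v} {k} eq with reach-inv (adj Γ) {k} (subst (λ k → Reach (adj Γ) k u v) eq (d-reach u v))
  ... | inj₁ r = ⊥-elim (<-irrefl eq (s≤s (d-≤ k r)))
  ... | inj₂ (w , e , r) = w , e , ≤-antisym (d-≤ k r) (s≤s⁻¹ (subst (_≤ suc (d w v)) eq (d-step v e)))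

  -- Induction along a shortest path. This is the source of lower bounds on distances: the triangle
  -- inequality, the effect of deletions and all exact distance tables use a suitable φ.
  lipschitz : ∀ (φ : Fin n → ℕ) → (∀ {u w} → Edge u w → φ u ≤ suc (φ w)) → ∀ u v → φ u ≤ d u v + φ v
  lipschitz φ lip u v = go (d u v) u refl
    where
    go : ∀ k u → d u v ≡ k → φ u ≤ k + φ v
    go zero u eq = ≡≤ (cong φ (d≡0⇒≡ eq))
    go (suc k) u eq = let w , e , eq′ = d-next eq in ≤-trans (lip e) (s≤s (go k w eq′))

  d-triangle : ∀ u w v → d u v ≤ d u w + d w v
  d-triangle u w v = lipschitz (λ x → d x v) (d-step v) u w

  d-edge≤1 : ∀ {u v} → Edge u v → d u v ≤ 1
  d-edge≤1 {u} {v} e = ≤-trans (d-step v e) (≡≤ (cong suc (d-refl v)))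

  d-sym : ∀ u v → d u v ≡ d v u
  d-sym u v = ≤-antisym (le u v) (le v u)
    where
    le : ∀ u v → d u v ≤ d v u
    le u v = ≤-trans (lipschitz (λ x → d u x) lip v u) (≡≤ (trans (cong (d v u +_) (d-refl u)) (+-identityʳ _)))
      where
      lip : ∀ {x y} → Edge x y → d u x ≤ suc (d u y)
      lip {x} {y} e = ≤-trans (d-triangle u y x) (≤-trans (+-monoʳ-≤ (d u y) (d-edge≤1 (edge-sym e))) (≡≤ (+-comm (d u y) 1)))

  d-lip : ∀ r {u w} → Edge u w → d r u ≤ suc (d r w)
  d-lip r {u} {w} e = subst₂ (λ a b → a ≤ suc b) (d-sym u r) (d-sym w r) (d-step r e)

  d-pos : ∀ {u v} → u ≢ v → 1 ≤ d u v
  d-pos {u} {v} u≢v with d u v in eq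
  ... | zero = ⊥-elim (u≢v (d≡0⇒≡ eq))
  ... | suc _ = s≤s z≤n

  d-edge : ∀ {u v} → Edge u v → d u v ≡ 1
  d-edge e = ≤-antisym (d-edge≤1 e) (d-pos (edge⇒≢ e))

  d≡1⇒edge : ∀ {u v} → d u v ≡ 1 → Edge u v
  d≡1⇒edge {u} eq = let w , e , eq′ = d-next eq in subst (Edge u) (d≡0⇒≡ eq′) e

  d-nonadj : ∀ {u v} → u ≢ v → ¬ Edge u v → 2 ≤ d u v
  d-nonadj {u} {v} u≢v ne with d u v in eq | d-pos u≢v
  ... | suc zero | _ = ⊥-elim (ne (d≡1⇒edge eq))
  ... | suc (suc _) | _ = s≤s (s≤s z≤n)

  d-symmetric₀ : Symmetric₀ d
  d-symmetric₀ = d-sym , d-refl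

  record Geodesic (u v : Fin n) (D : ℕ) : Set where
    field
      path : ℕ → Fin n
      start : path 0 ≡ u
      end : path D ≡ v
      edge : ∀ i → i < D → Edge (path i) (path (suc i))
      level : ∀ i → i ≤ D → d u (path i) ≡ i

  opaque
    geodesic : ∀ u v → Geodesic u v (d u v)
    geodesic u v = record
      { path = p ; start = refl ; end = d≡0⇒≡ (trans (toEnd D ≤-refl) (n∸n≡0 D)) ; edge = edge′
      ; level = λ i i≤D → ≤-antisym (upper i i≤D) (lower i i≤D) }
      where
      D : ℕ
      D = d u v
      -- The choice depends on x alone, so it can be iterated into a path; at v itself the vertex x
      -- is a dummy value.
      successor : ∀ x k → d x v ≡ k → Σ (Fin n) λ y → ∀ j → d x v ≡ suc j → Edge x y × d y v ≡ j
      successor x zero eq = x , λ j eq′ → case trans (sym eq) eq′ of λ ()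
      successor x (suc k) eq = let y , e , h = d-next eq in
        y , λ j eq′ → e , trans h (suc-injective (trans (sym eq) eq′))
      next : Fin n → Fin n
      next x = proj₁ (successor x (d x v) refl)
      next-spec : ∀ {x k} → d x v ≡ suc k → Edge x (next x) × d (next x) v ≡ k
      next-spec {x} {k} = proj₂ (successor x (d x v) refl) k
      p : ℕ → Fin n
      p zero = u
      p (suc i) = next (p i)
      toEnd : ∀ i → i ≤ D → d (p i) v ≡ D ∸ i
      toEnd zero _ = refl
      toEnd (suc i) i<D = proj₂ (next-spec (trans (toEnd i (<⇒≤ i<D)) (+-∸-assoc 1 i<D)))
      edge′ : ∀ i → i < D → Edge (p i) (p (suc i))
      edge′ i i<D with D ∸ i in eq | toEnd i (<⇒≤ i<D)
      ... | zero | _ = ⊥-elim (<⇒≱ i<D (m∸n≡0⇒m≤n eq))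
      ... | suc k | h = proj₁ (next-spec h)
      upper : ∀ i → i ≤ D → d u (p i) ≤ i
      upper zero _ = ≡≤ (d-refl u)
      upper (suc i) i<D = ≤-trans (d-lip u (edge-sym (edge′ i i<D))) (s≤s (upper i (<⇒≤ i<D)))
      -- From `p i` only D ∸ i steps remain, so a smaller level would bring u and v closer than D.
      lower : ∀ i → i ≤ D → i ≤ d u (p i)
      lower i i≤D = +-cancelʳ-≤ (D ∸ i) i (d u (p i)) (begin
        i + (D ∸ i)               ≡⟨ m+[n∸m]≡n i≤D ⟩
        D                         ≤⟨ d-triangle u (p i) v ⟩
        d u (p i) + d (p i) v     ≡⟨ cong (d u (p i) +_) (toEnd i i≤D) ⟩
        d u (p i) + (D ∸ i)       ∎)
        where open ≤-Reasoning

argmax : ∀ {m} (f : Fin (suc m) → ℕ) → Σ (Fin (suc m)) λ z → ∀ w → f w ≤ f z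
argmax {zero} f = fzero , λ { fzero → ≤-refl }
argmax {suc m} f with argmax (f ∘ fsuc)
... | z , h with ≤-total (f fzero) (f (fsuc z))
...   | inj₁ le = fsuc z , λ { fzero → le ; (fsuc w) → h w }
...   | inj₂ ge = fzero , λ { fzero → ≤-refl ; (fsuc w) → ≤-trans (h w) ge }

ind : Bool → ℕ
ind b = if b then 1 else 0

ind-T : ∀ {b} → T b → ind b ≡ 1
ind-T {true} _ = refl

ind-¬T : ∀ {b} → ¬ T b → ind b ≡ 0
ind-¬T {true} h = ⊥-elim (h tt)
ind-¬T {false} _ = refl

1≤ind⇒T : ∀ {b} → 1 ≤ ind b → T b
1≤ind⇒T {true} _ = tt

ind≤1 : ∀ b → ind b ≤ 1
ind≤1 true = ≤-refl
ind≤1 false = z≤n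

module _ {n} (Γ : ConnectedGraph n) where

  opaque
    Wiener : ℕ
    Wiener = W (adj Γ)

    Wiener≡W : Wiener ≡ W (adj Γ)
    Wiener≡W = refl

    edges : ℕ
    edges = edgeCount (adj Γ)

    edges≡edgeCount : edges ≡ edgeCount (adj Γ)
    edges≡edgeCount = refl

    trans-sum : Fin n → ℕ
    trans-sum u = sumFin (d Γ u)

    trans-sum≡ : ∀ u → trans-sum u ≡ sumFin (d Γ u)
    trans-sum≡ u = refl

    deg : Fin n → ℕ
    deg u = sumFin (λ v → ind (adj Γ u v))

    deg≡ : ∀ u → deg u ≡ sumFin (λ v → ind (adj Γ u v))
    deg≡ u = refl

  ind-symmetric₀ : Symmetric₀ (λ u v → ind (adj Γ u v))
  ind-symmetric₀ = (λ u v → cong ind (proj₁ (simple Γ) u v)) , (λ u → cong ind (proj₂ (simple Γ) u))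

  edges≡upperSum : edges ≡ upperSum (λ u v → ind (adj Γ u v))
  edges≡upperSum = trans edges≡edgeCount (sumFin-cong λ u → sumFin-cong λ v → if-∧ (toℕ u <ᵇ toℕ v) (adj Γ u v))
    where
    if-∧ : ∀ a b → (if a ∧ b then 1 else 0) ≡ (if a then ind b else 0)
    if-∧ true b = refl
    if-∧ false b = refl

  handshake : sumFin deg ≡ 2 * edges
  handshake = trans (sumFin-cong deg≡) (trans (sym (2upperSum _ ind-symmetric₀)) (cong (2 *_) (sym edges≡upperSum)))

  Wiener≡pairSum : ∀ (e : ℕ → Fin n) → InjectiveBelow n e → Wiener ≡ pairSum n (λ i k → d Γ (e i) (e k))
  Wiener≡pairSum e inj = trans Wiener≡W (trans (W≡upperSum Γ) (upperSum≡pairSum e inj (d Γ) (d-symmetric₀ Γ)))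

  edges≡pairSum : ∀ (e : ℕ → Fin n) → InjectiveBelow n e →
    edges ≡ pairSum n (λ i k → ind (adj Γ (e i) (e k)))
  edges≡pairSum e inj = trans edges≡upperSum (upperSum≡pairSum e inj _ ind-symmetric₀)

module _ {m} (Γ : ConnectedGraph (suc m)) (v : Fin (suc m)) where

  deleted : Graph m
  deleted i j = adj Γ (punchIn v i) (punchIn v j)

  delete : Connected deleted → ConnectedGraph m
  delete c = connectedGraph deleted ((λ i j → proj₁ (simple Γ) _ _) , (λ i → proj₂ (simple Γ) _)) c

  -- The old distance to a fixed vertex still changes by at most one along each surviving edge, so
  -- it bounds the new distance from below.
  d-delete : ∀ c i j → d Γ (punchIn v i) (punchIn v j) ≤ d (delete c) i j
  d-delete c i j = ≤-trans (lipschitz (delete c) (λ x → d Γ (punchIn v x) (punchIn v j)) (d-step Γ _) i j)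
    (≡≤ (trans (cong (d (delete c) i j +_) (d-refl Γ _)) (+-identityʳ _)))

  Wiener-delete : ∀ c → Wiener Γ ≤ Wiener (delete c) + trans-sum Γ v
  Wiener-delete c = begin
    Wiener Γ
      ≡⟨ trans (Wiener≡W Γ) (trans (W≡upperSum Γ) (upperSum-punchIn v (d Γ) (d-symmetric₀ Γ))) ⟩
    upperSum (λ i j → d Γ (punchIn v i) (punchIn v j)) + sumFin (d Γ v)
      ≤⟨ +-monoˡ-≤ _ (sumFin-mono λ i → sumFin-mono λ j → if-mono (toℕ i <ᵇ toℕ j) (d-delete c i j)) ⟩
    upperSum (d (delete c)) + sumFin (d Γ v)
      ≡⟨ cong₂ _+_ (sym (trans (Wiener≡W (delete c)) (W≡upperSum (delete c)))) (sym (trans-sum≡ Γ v)) ⟩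
    Wiener (delete c) + trans-sum Γ v ∎
    where
    open ≤-Reasoning
    if-mono : ∀ b {x y} → x ≤ y → (if b then x else 0) ≤ (if b then y else 0)
    if-mono true h = h
    if-mono false h = z≤n

  edges-delete : ∀ c → edges Γ ≡ edges (delete c) + deg Γ v
  edges-delete c = trans (edges≡upperSum Γ) (trans (upperSum-punchIn v _ (ind-symmetric₀ Γ))
    (cong₂ _+_ (sym (edges≡upperSum (delete c))) (sym (deg≡ Γ v))))

  deg-delete : ∀ c i → deg Γ (punchIn v i) ≡ ind (adj Γ (punchIn v i) v) + deg (delete c) i
  deg-delete c i = trans (deg≡ Γ _) (trans (sumFin-punchIn v (λ u → ind (adj Γ (punchIn v i) u)))
    (cong (ind (adj Γ (punchIn v i) v) +_) (sym (deg≡ (delete c) i))))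

  -- A certificate rather than the usual definition: moving to the supplied neighbours leads every
  -- vertex to r without meeting v. Only distances of Γ occur, so nothing about the deleted graph
  -- has to be known beforehand.
  Noncut : Set
  Noncut = Σ (Fin (suc m)) λ r → r ≢ v ×
    (∀ x → x ≢ v → x ≢ r → Σ (Fin (suc m)) λ y → y ≢ v × Edge Γ x y × d Γ y r < d Γ x r)

  noncut⇒connected : Noncut → Connected deleted
  noncut⇒connected (r , r≢v , descend) i j = append (toRoot _ i ≤-refl) (reverse (toRoot _ j ≤-refl))
    where
    ρ : Fin m
    ρ = punchOut (λ eq → r≢v (sym eq))
    in-out : ∀ {y} (y≢v : y ≢ v) → punchIn v (punchOut (λ eq → y≢v (sym eq))) ≡ y
    in-out y≢v = punchIn-punchOut _
    append : ∀ {a b c} → Walk deleted a b → Walk deleted b c → Walk deleted a c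
    append stay w = w
    append (step e w′) w = step e (append w′ w)
    reverse : ∀ {a b} → Walk deleted a b → Walk deleted b a
    reverse stay = stay
    reverse {a} (step {w = c} e w) = append (reverse w) (step (edge-sym Γ {punchIn v a} {punchIn v c} e) stay)
    toRoot : ∀ k i → d Γ (punchIn v i) r ≤ k → Walk deleted i ρ
    toRoot k i le with punchIn v i ≟F r
    ... | yes eq = subst (Walk deleted i) (punchIn-injective v i ρ (trans eq (sym (in-out r≢v)))) stay
    ... | no i≢r with descend (punchIn v i) (punchInᵢ≢i v i) i≢r | k
    ...   | y , y≢v , e , lt | zero = ⊥-elim (<⇒≱ lt (≤-trans le z≤n))
    ...   | y , y≢v , e , lt | suc k′ = step {w = punchOut (λ eq → y≢v (sym eq))}
            (subst (Edge Γ (punchIn v i)) (sym (in-out y≢v)) e)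
            (toRoot k′ _ (subst (λ z → d Γ z r ≤ k′) (sym (in-out y≢v)) (s≤s⁻¹ (≤-trans lt le))))

-- Geodesics and transmissions

tri : ℕ → ℕ
tri zero = 0
tri (suc k) = suc k + tri k

-- The Wiener index of the path on n vertices: a new end vertex has transmission `tri n`.
pathWiener : ℕ → ℕ
pathWiener zero = 0
pathWiener (suc n) = pathWiener n + tri n

2tri : ∀ e → 2 * tri e ≡ suc e * e
2tri zero = refl
2tri (suc e) = trans (split e (tri e)) (trans (cong (2 * suc e +_) (2tri e)) (join e))
  where
  split : ∀ e t → 2 * (suc e + t) ≡ 2 * suc e + 2 * t
  split e t = solve (e ∷ t ∷ [])
  join : ∀ e → 2 * suc e + suc e * e ≡ suc (suc e) * suc e
  join e = solve (e ∷ [])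

tri-+ : ∀ e k → tri (e + k) ≡ tri e + k * e + tri k
tri-+ zero k = cong (_+ tri k) (sym (*-zeroʳ k))
tri-+ (suc e) k = trans (cong (suc (e + k) +_) (tri-+ e k)) (regroup e k (tri e) (tri k))
  where
  regroup : ∀ e k t s → suc (e + k) + (t + k * e + s) ≡ suc e + t + k * suc e + s
  regroup e k t s = solve (e ∷ k ∷ t ∷ s ∷ [])

tri≥ : ∀ k → k ≤ tri k
tri≥ zero = z≤n
tri≥ (suc k) = m≤m+n (suc k) (tri k)

tri≥2k : ∀ k → 2 * (3 + k) ≤ tri (3 + k)
tri≥2k k = lin (2 * k) (tri≥ k) (arith k (tri k))
  where
  arith : ∀ k t → 2 * (3 + k) + t + 2 * k ≡ (3 + k + (2 + k + (1 + k + t))) + k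
  arith k t = solve (k ∷ t ∷ [])

sumTo-suc : ∀ k f → sumTo (suc k) f ≡ f 0 + sumTo k (f ∘ suc)
sumTo-suc zero f = sym (+-identityʳ (f 0))
sumTo-suc (suc k) f = trans (cong (_+ f (suc k)) (sumTo-suc k f)) (+-assoc (f 0) _ _)

sumTo-∸ : ∀ e → sumTo (suc e) (λ i → e ∸ i) ≡ tri e
sumTo-∸ zero = refl
sumTo-∸ (suc e) = trans (sumTo-suc (suc e) (λ i → suc e ∸ i)) (cong (suc e +_) (sumTo-∸ e))

pairSum-▹ : ∀ {A : Set} (F : A → A → ℕ) (q : ℕ → A) k x →
  pairSum (suc k) (λ i j → F ((q ⟨ k ⟩▹ x) i) ((q ⟨ k ⟩▹ x) j)) ≡ pairSum k (λ i j → F (q i) (q j)) + sumTo k (λ i → F (q i) x)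
pairSum-▹ F q k x = cong₂ _+_
  (pairSum-cong k λ i j i<j j<k → cong₂ F (▹-old q x (<-trans i<j j<k)) (▹-old q x j<k))
  (sumTo-cong k λ i i<k → cong₂ F (▹-old q x i<k) (▹-new q k x))

sumTo-zero : ∀ k {f : ℕ → ℕ} → (∀ i → i < k → f i ≡ 0) → sumTo k f ≡ 0
sumTo-zero k h = trans (sumTo-cong k h) (trans (sumTo-const k 0) (*-zeroʳ k))

sumTo-split : ∀ a c f → sumTo (c + a) f ≡ sumTo a f + sumTo c (λ i → f (i + a))
sumTo-split a zero f = sym (+-identityʳ _)
sumTo-split a (suc c) f = trans (cong (_+ f (c + a)) (sumTo-split a c f)) (+-assoc (sumTo a f) _ _)

-- A 0/1 sequence supported on three consecutive places can have sum 3 only if it is 1 on all of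
-- them. It is applied to the neighbours on a geodesic of a vertex at level 1 + l.
window : ∀ K l (b : ℕ → ℕ) → (∀ i → b i ≤ 1) → (∀ i → i < l → b i ≡ 0) → (∀ i → i < K → 2 + l < i → b i ≡ 0) →
  3 ≤ sumTo K b → 2 + l < K × 1 ≤ b l × 1 ≤ b (1 + l) × 1 ≤ b (2 + l)
window K l b b≤1 below above three with l ≤? K
... | no l≰K = ⊥-elim (<⇒≱ (s≤s z≤n) (≤-trans three (≡≤ (sumTo-zero K λ i i<K → below i (<-trans i<K (≰⇒> l≰K))))))
... | yes l≤K with K ∸ l | m∸n+n≡m l≤K
...   | c | refl = go c (≤-trans three (≡≤ (trans (sumTo-split l c b) (cong (_+ sumTo c (λ i → b (i + l)))
    (sumTo-zero l below))))) above
  where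
  small : ∀ c → sumTo c (λ i → b (i + l)) ≤ c
  small c = ≤-trans (sumTo-mono c (λ i _ → b≤1 (i + l))) (≡≤ (trans (sumTo-const c 1) (*-identityʳ c)))
  head₃ : ∀ c → (∀ i → i < 3 + c + l → 2 + l < i → b i ≡ 0) → sumTo (3 + c) (λ i → b (i + l)) ≤ b l + b (1 + l) + b (2 + l)
  head₃ zero h = ≤-refl
  head₃ (suc c) h = ≤-trans (head₃ c (λ i lt → h i (m<n⇒m<1+n lt)) ⊹ ≡≤ (h (3 + c + l) ≤-refl (+-monoˡ-≤ l (m≤m+n 3 c))))
      (≡≤ (+-identityʳ _))
  first : ∀ {x y z} → y ≤ 1 → z ≤ 1 → 3 ≤ x + y + z → 1 ≤ x
  first {x} {y} {z} hy hz h = lin 0 (hy ⊹ hz ⊹ h) (solve (x ∷ y ∷ z ∷ []))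
  go : ∀ c → 3 ≤ sumTo c (λ i → b (i + l)) → (∀ i → i < c + l → 2 + l < i → b i ≡ 0) →
    2 + l < c + l × 1 ≤ b l × 1 ≤ b (1 + l) × 1 ≤ b (2 + l)
  go (suc (suc (suc c))) h ab =
    s≤s (s≤s (s≤s (m≤n+m l c))) , first (b≤1 _) (b≤1 _) h₃
    , first {z = b (2 + l)} (b≤1 l) (b≤1 _) (≤-trans h₃ (≡≤ (cong (_+ b (2 + l)) (+-comm (b l) _))))
    , first {z = b (1 + l)} (b≤1 l) (b≤1 _) (≤-trans h₃ (≡≤ (rot (b l) (b (1 + l)) (b (2 + l)))))
    where
    h₃ = ≤-trans h (head₃ c ab)
    rot : ∀ x y z → x + y + z ≡ z + x + y
    rot x y z = solve (x ∷ y ∷ z ∷ [])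
  go 0 h _ = ⊥-elim (<⇒≱ h (≤-trans (small 0) z≤n))
  go 1 h _ = ⊥-elim (<⇒≱ h (≤-trans (small 1) (s≤s z≤n)))
  go 2 h _ = ⊥-elim (<⇒≱ h (small 2))

module _ {n} (Γ : ConnectedGraph n) where

  back : (ℕ → Fin n) → ℕ → Fin n → ℕ
  back q k x = sumTo k (λ i → ind (adj Γ (q i) x))

  module _ {u v D} (g : Geodesic Γ u v D) where
    open Geodesic g

    path-injective : InjectiveBelow (suc D) path
    path-injective i j i≤D j≤D eq = trans (sym (level i (s≤s⁻¹ i≤D))) (trans (cong (d Γ u) eq) (level j (s≤s⁻¹ j≤D)))

    OffPath : Fin n → Set
    OffPath x = ∀ i → i < suc D → path i ≢ x

    offPath : ∀ {x j} → d Γ u x ≡ j → path j ≢ x → OffPath x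
    offPath {x} lx pj≢x i i≤D eq = pj≢x (subst (λ j → path j ≡ x) (trans (sym (level i (s≤s⁻¹ i≤D)))
        (trans (cong (d Γ u) eq) lx)) eq)

    nbr-level-≤ : ∀ {x i} → i ≤ D → Edge Γ (path i) x → i ≤ suc (d Γ u x)
    nbr-level-≤ {x} {i} i≤D e = subst (_≤ suc (d Γ u x)) (level i i≤D) (d-lip Γ u e)

    nbr-level-≥ : ∀ {x i} → i ≤ D → Edge Γ (path i) x → d Γ u x ≤ suc i
    nbr-level-≥ {x} {i} i≤D e = subst (λ j → d Γ u x ≤ suc j) (level i i≤D) (d-lip Γ u (edge-sym Γ e))

    -- An edge joins levels at most one apart, so a geodesic has no chords.
    path-edges : pairSum (suc D) (λ i k → ind (adj Γ (path i) (path k))) ≡ D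
    path-edges = prefix D ≤-refl
      where
      prefix : ∀ K → K ≤ D → pairSum (suc K) (λ i k → ind (adj Γ (path i) (path k))) ≡ K
      prefix zero _ = refl
      prefix (suc K) K<D = trans (cong₂ _+_ (prefix K (<⇒≤ K<D)) one) (+-comm K 1)
        where
        one : sumTo (suc K) (λ i → ind (adj Γ (path i) (path (suc K)))) ≡ 1
        one = cong₂ _+_ (sumTo-zero K λ i i<K → ind-¬T λ e → <⇒≱ i<K
                (s≤s⁻¹ (subst (_≤ suc i) (level (suc K) K<D) (nbr-level-≥ (≤-trans (<⇒≤ i<K) (<⇒≤ K<D)) e))))
              (ind-T (edge K K<D))

module _ {m} (Γ : ConnectedGraph (suc m)) where

  -- `e` is the eccentricity of v, and `k` counts the vertices off a chosen longest geodesic from v.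
  -- Estimates for δ are expressed through k and through the levels of these extra vertices.
  record Periphery (v : Fin (suc m)) : Set where
    field
      {far} : Fin (suc m)
      e k : ℕ
      geo : Geodesic Γ v far e
      bounded : ∀ u → d Γ v u ≤ e
      size : m ≡ e + k
    open Geodesic geo public

  opaque
    periphery : ∀ v → Periphery v
    periphery v with argmax (d Γ v)
    ... | z , h = record
      { e = d Γ v z ; k = m ∸ d Γ v z ; geo = geodesic Γ v z ; bounded = h
      ; size = sym (m+[n∸m]≡n (s≤s⁻¹ (injectiveBelow⇒≤ _ _ (path-injective Γ (geodesic Γ v z))))) }

  module _ {v} (P : Periphery v) where
    open Periphery P

    -- Distance and shortfall below level e add up to e at every vertex; on the left only the
    -- shortfalls of the listed vertices are kept.
    trans-sum-enum : ∀ K (q : ℕ → Fin (suc m)) → InjectiveBelow K q →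
      trans-sum Γ v + sumTo K (λ i → e ∸ d Γ v (q i)) ≤ suc m * e
    trans-sum-enum K q inj = begin
      trans-sum Γ v + sumTo K (λ i → e ∸ d Γ v (q i))      ≤⟨ ≡≤ (trans-sum≡ Γ v) ⊹ (sumTo≤sumFin K q inj (λ u → e ∸ d Γ v u)) ⟩
      sumFin (d Γ v) + sumFin (λ u → e ∸ d Γ v u)          ≡⟨ sym (sumFin-+ (d Γ v) (λ u → e ∸ d Γ v u)) ⟩
      sumFin (λ u → d Γ v u + (e ∸ d Γ v u))               ≡⟨ sumFin-cong (λ u → m+[n∸m]≡n (bounded u)) ⟩
      sumFin {suc m} (λ u → e)                             ≡⟨ sumFin-const (suc m) e ⟩
      suc m * e                                            ∎
      where open ≤-Reasoning

    path-deficit : sumTo (suc e) (λ i → e ∸ d Γ v (path i)) ≡ tri e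
    path-deficit = trans (sumTo-cong (suc e) λ i i≤e → cong (e ∸_) (level i (s≤s⁻¹ i≤e))) (sumTo-∸ e)

    -- The end of a path on m + 1 vertices has transmission tri m; each of the k vertices off the geodesic lowers
    -- the transmission of v below that value, the more so the nearer it is to v.
    deficit : ∀ {s} → trans-sum Γ v + (tri e + s) ≤ suc m * e → trans-sum Γ v + tri k + s ≤ tri m
    deficit {s} h = arith (trans-sum Γ v) e k size h
      where
      certificate : ∀ D te tk s e k → D + tk + s + (suc (e + k) * e + 2 * te) + 0 ≡ te + k * e + tk +
          ((D + (te + s)) + suc e * e)
      certificate D te tk s e k = solve (D ∷ te ∷ tk ∷ s ∷ e ∷ k ∷ [])
      arith : ∀ D e k {m} → m ≡ e + k → D + (tri e + s) ≤ suc m * e → D + tri k + s ≤ tri m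
      arith D e k refl h = ≤-trans (lin 0 (h ⊹ ≡≥ (2tri e)) (certificate D (tri e) (tri k) s e k)) (≡≥ (tri-+ e k))

    -- On a path seen from its end, the k remaining vertices would occupy levels e + 1 to e + k.
    -- Here they are no farther than e, a loss of at least 1 + 2 + ... + k.
    deficit₀ : trans-sum Γ v + tri k ≤ tri m
    deficit₀ = ≤-trans (≡≥ (+-identityʳ _)) (deficit {0} (≤-trans (≡≤ (cong (trans-sum Γ v +_)
      (trans (+-identityʳ _) (sym path-deficit)))) (trans-sum-enum (suc e) path (path-injective Γ geo))))

    deficit₁ : ∀ {x} → OffPath Γ geo x → trans-sum Γ v + tri k + (e ∸ d Γ v x) ≤ tri m
    deficit₁ {x} off = deficit (≤-trans (≡≤ (cong (trans-sum Γ v +_)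
      (sym (trans (sumTo-▹ (λ u → e ∸ d Γ v u) path (suc e) x) (cong (_+ (e ∸ d Γ v x)) path-deficit)))))
      (trans-sum-enum (2 + e) (path ⟨ suc e ⟩▹ x) (▹-injective (path-injective Γ geo) off)))

    two-injective : ∀ {x y} → OffPath Γ geo x → OffPath Γ geo y → x ≢ y →
      InjectiveBelow (3 + e) (path ⟨ suc e ⟩▹ x ⟨ 2 + e ⟩▹ y)
    two-injective {x} {y} offx offy x≢y = ▹-injective (▹-injective (path-injective Γ geo) offx) fresh-y
      where
      fresh-y : ∀ i → i < 2 + e → (path ⟨ suc e ⟩▹ x) i ≢ y
      fresh-y i i<2+e eq with i <? suc e
      ... | yes i≤e = offy i i≤e eq
      ... | no _ = x≢y eq

    deficit₂ : ∀ {x y} → OffPath Γ geo x → OffPath Γ geo y → x ≢ y →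
      trans-sum Γ v + tri k + ((e ∸ d Γ v x) + (e ∸ d Γ v y)) ≤ tri m
    deficit₂ {x} {y} offx offy x≢y = deficit (≤-trans (≡≤ (cong (trans-sum Γ v +_)
      (sym (trans (sumTo-▹ (λ u → e ∸ d Γ v u) (path ⟨ suc e ⟩▹ x) (2 + e) y)
        (trans (cong (_+ (e ∸ d Γ v y)) (trans (sumTo-▹ (λ u → e ∸ d Γ v u) path (suc e) x) (cong (_+ (e ∸ d Γ v x))
            path-deficit)))
          (+-assoc (tri e) _ _))))))
      (trans-sum-enum (3 + e) _ (two-injective offx offy x≢y)))

    extra⇒1≤k : ∀ {x} → OffPath Γ geo x → 1 ≤ k
    extra⇒1≤k off = +-cancelˡ-≤ e 1 k (≤-trans (≡≤ (+-comm e 1)) (subst (suc e ≤_) size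
      (s≤s⁻¹ (injectiveBelow⇒≤ (2 + e) _ (▹-injective (path-injective Γ geo) off)))))

    extras⇒2≤k : ∀ {x y} → OffPath Γ geo x → OffPath Γ geo y → x ≢ y → 2 ≤ k
    extras⇒2≤k offx offy x≢y = +-cancelˡ-≤ e 2 k (≤-trans (≡≤ (+-comm e 2)) (subst (2 + e ≤_) size
      (s≤s⁻¹ (injectiveBelow⇒≤ (3 + e) _ (two-injective offx offy x≢y)))))

    extra : 1 ≤ k → Σ (Fin (suc m)) (OffPath Γ geo)
    extra 1≤k = fresh (suc e) path (s≤s (subst (suc e ≤_) (sym size) (≤-trans (≡≤ (+-comm 1 e)) (+-monoʳ-≤ e 1≤k))))

    extra′ : ∀ x → 2 ≤ k → Σ (Fin (suc m)) λ y → OffPath Γ geo y × x ≢ y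
    extra′ x 2≤k with fresh (2 + e) (path ⟨ suc e ⟩▹ x) (s≤s (subst (2 + e ≤_) (sym size) (≤-trans (≡≤ (+-comm 2 e))
        (+-monoʳ-≤ e 2≤k))))
    ... | y , f = y , (λ i i≤e eq → f i (m<n⇒m<1+n i≤e) (trans (▹-old path x i≤e) eq))
                , (λ x≡y → f (suc e) ≤-refl (trans (▹-new path (suc e) x) x≡y))

    edges-enum : ∀ K q → K ≡ suc m → InjectiveBelow K q →
      edges Γ ≡ pairSum K (λ i k → ind (adj Γ (q i) (q k)))
    edges-enum K q refl inj = edges≡pairSum Γ q inj

    size-K : ∀ j → k ≡ j → suc (j + e) ≡ suc m
    size-K j eq = cong suc (trans (trans (+-comm j e) (cong (e +_) (sym eq))) (sym size))

    -- For k = 0 the chordless geodesic spans Γ. Graphs with at least n edges therefore have k ≥ 1.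
    path-count : k ≡ 0 → edges Γ ≤ m
    path-count eq = ≤-trans (≡≤ (edges-enum (suc e) path (size-K 0 eq) (path-injective Γ geo)))
      (≡≤ (trans (path-edges Γ geo) (suc-injective (size-K 0 eq))))

    count₁ : ∀ {x} → k ≡ 1 → OffPath Γ geo x → edges Γ ≡ e + back Γ path (suc e) x
    count₁ {x} eq off = begin
      edges Γ  ≡⟨ edges-enum (2 + e) _ (size-K 1 eq) (▹-injective (path-injective Γ geo) off) ⟩
      _                  ≡⟨ pairSum-▹ (λ u w → ind (adj Γ u w)) path (suc e) x ⟩
      _                  ≡⟨ cong (_+ back Γ path (suc e) x) (path-edges Γ geo) ⟩
      e + back Γ path (suc e) x ∎
      where open ≡-Reasoning

    count₂ : ∀ {x y} → k ≡ 2 → OffPath Γ geo x → OffPath Γ geo y → x ≢ y →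
      edges Γ ≡ e + back Γ path (suc e) x + (back Γ path (suc e) y + ind (adj Γ x y))
    count₂ {x} {y} eq offx offy x≢y = begin
      edges Γ  ≡⟨ edges-enum (3 + e) _ (size-K 2 eq) (two-injective offx offy x≢y) ⟩
      _                  ≡⟨ pairSum-▹ (λ u w → ind (adj Γ u w)) (path ⟨ suc e ⟩▹ x) (2 + e) y ⟩
      _                  ≡⟨ cong₂ _+_ (pairSum-▹ (λ u w → ind (adj Γ u w)) path (suc e) x) (sumTo-▹ (λ u →
          ind (adj Γ u y)) path (suc e) x) ⟩
      _                  ≡⟨ cong (λ l → l + back Γ path (suc e) x + (back Γ path (suc e) y + ind (adj Γ x y)))
          (path-edges Γ geo) ⟩
      e + back Γ path (suc e) x + (back Γ path (suc e) y + ind (adj Γ x y)) ∎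
      where open ≡-Reasoning

    enum-surjective : ∀ K (q : ℕ → Fin (suc m)) → K ≡ suc m → InjectiveBelow K q → ∀ u → Hits K q u
    enum-surjective K q refl inj = surjectiveBelow q inj

    ▹-hit : ∀ {A : Set} (q : ℕ → A) k x {u} → (Σ ℕ λ i → i < suc k × (q ⟨ k ⟩▹ x) i ≡ u) → (Σ ℕ λ i → i < k × q i ≡ u) ⊎ u ≡ x
    ▹-hit q k x (i , i<sk , eq) with i <? k
    ... | yes i<k = inj₁ (i , i<k , eq)
    ... | no _ = inj₂ (sym eq)

    OnPath : Fin (suc m) → Set
    OnPath u = Σ ℕ λ i → i ≤ e × path i ≡ u

    vertices₁ : ∀ {x} → k ≡ 1 → OffPath Γ geo x → ∀ u → OnPath u ⊎ u ≡ x
    vertices₁ {x} eq off u with ▹-hit path (suc e) x (enum-surjective (2 + e) _ (size-K 1 eq) (▹-injective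
        (path-injective Γ geo) off) u)
    ... | inj₁ (i , i<se , eq′) = inj₁ (i , s≤s⁻¹ i<se , eq′)
    ... | inj₂ eq′ = inj₂ eq′

    vertices : ∀ {x y} → k ≡ 2 → OffPath Γ geo x → OffPath Γ geo y → x ≢ y → ∀ u → OnPath u ⊎ u ≡ x ⊎ u ≡ y
    vertices {x} {y} eq offx offy x≢y u with ▹-hit _ (2 + e) y (enum-surjective (3 + e) _ (size-K 2 eq)
        (two-injective offx offy x≢y) u)
    ... | inj₂ eq′ = inj₂ (inj₂ eq′)
    ... | inj₁ h with ▹-hit path (suc e) x h
    ...   | inj₁ (i , i<se , eq′) = inj₁ (i , s≤s⁻¹ i<se , eq′)
    ...   | inj₂ eq′ = inj₂ (inj₁ eq′)

-- Bounds by number of edges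

module _ {n} (Γ : ConnectedGraph n) where

  fresh-neighbour : ∀ k (q : ℕ → Fin n) u → k < deg Γ u → Σ (Fin n) λ x → Edge Γ u x × (∀ i → i < k → q i ≢ x)
  fresh-neighbour k q u k<deg with ¬∀⟶∃¬ n (λ x → Edge Γ u x → Hits k q x) dec covered⇒⊥
    where
    dec : ∀ x → Dec (Edge Γ u x → Hits k q x)
    dec x with edge? Γ u x | hits? k q x
    ... | no ¬e | _ = yes (λ e → ⊥-elim (¬e e))
    ... | yes e | inj₁ h = yes (λ _ → h)
    ... | yes e | inj₂ miss = no λ h → let i , i<k , eq = h e in miss i i<k eq
    covered⇒⊥ : ¬ (∀ x → Edge Γ u x → Hits k q x)
    covered⇒⊥ h = <⇒≱ k<deg (≤-trans (≡≤ (deg≡ Γ u)) (≤-trans (sumFin≤sumTo k q _ hit)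
      (≤-trans (sumTo-mono k λ i _ → ind≤1 (adj Γ u (q i))) (≡≤ (trans (sumTo-const k 1) (*-identityʳ k))))))
      where
      hit : ∀ x → Hits k q x ⊎ ind (adj Γ u x) ≡ 0
      hit x with edge? Γ u x
      ... | yes e = inj₁ (h x e)
      ... | no ¬e = inj₂ (ind-¬T ¬e)
  ... | x , ¬impl = x , decidable-stable (edge? Γ u x) (λ ¬e → ¬impl (λ e → ⊥-elim (¬e e)))
                  , λ i i<k eq → ¬impl λ _ → i , i<k , eq

  neighbours≤deg : ∀ k (q : ℕ → Fin n) u → InjectiveBelow k q → (∀ i → i < k → Edge Γ u (q i)) → k ≤ deg Γ u
  neighbours≤deg k q u inj h = ≤-trans (≡≤ (sym (trans (sumTo-cong k λ i i<k → ind-T (h i i<k)) (trans (sumTo-const k 1)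
      (*-identityʳ k)))))
    (≤-trans (sumTo≤sumFin k q inj (λ x → ind (adj Γ u x))) (≡≥ (deg≡ Γ u)))

  pair : Fin n → Fin n → ℕ → Fin n
  pair a b = (λ _ → a) ⟨ 1 ⟩▹ b

  triple : Fin n → Fin n → Fin n → ℕ → Fin n
  triple a b c = pair a b ⟨ 2 ⟩▹ c

  pair-injective : ∀ {a b} → a ≢ b → InjectiveBelow 2 (pair a b)
  pair-injective a≢b = ▹-injective (λ { .0 .0 (s≤s z≤n) (s≤s z≤n) _ → refl }) (λ _ _ → a≢b)

  triple-injective : ∀ {a b c} → a ≢ b → a ≢ c → b ≢ c → InjectiveBelow 3 (triple a b c)
  triple-injective a≢b a≢c b≢c = ▹-injective (pair-injective a≢b)
    λ { 0 _ → a≢c ; 1 _ → b≢c ; (suc (suc _)) (s≤s (s≤s ())) }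

  second-neighbour : ∀ {u} a → 2 ≤ deg Γ u → Σ (Fin n) λ x → Edge Γ u x × a ≢ x
  second-neighbour {u} a h = let x , e , f = fresh-neighbour 1 (λ _ → a) u h in x , e , f 0 (s≤s z≤n)

  third-neighbour : ∀ {u} a b → 3 ≤ deg Γ u → Σ (Fin n) λ x → Edge Γ u x × a ≢ x × b ≢ x
  third-neighbour {u} a b h = let x , e , f = fresh-neighbour 2 (pair a b) u h in x , e , f 0 (s≤s z≤n) , f 1 (s≤s (s≤s z≤n))

  1≤deg : ∀ {u a} → Edge Γ u a → 1 ≤ deg Γ u
  1≤deg {u} {a} e = neighbours≤deg 1 (λ _ → a) u (λ { .0 .0 (s≤s z≤n) (s≤s z≤n) _ → refl }) (λ _ _ → e)

  2≤deg : ∀ {u a b} → a ≢ b → Edge Γ u a → Edge Γ u b → 2 ≤ deg Γ u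
  2≤deg {u} a≢b ea eb = neighbours≤deg 2 _ u (pair-injective a≢b)
    λ { 0 _ → ea ; 1 _ → eb ; (suc (suc _)) (s≤s (s≤s ())) }

  3≤deg : ∀ {u a b c} → a ≢ b → a ≢ c → b ≢ c → Edge Γ u a → Edge Γ u b → Edge Γ u c → 3 ≤ deg Γ u
  3≤deg {u} a≢b a≢c b≢c ea eb ec = neighbours≤deg 3 _ u (triple-injective a≢b a≢c b≢c)
    λ { 0 _ → ea ; 1 _ → eb ; 2 _ → ec ; (suc (suc (suc _))) (s≤s (s≤s (s≤s ()))) }

  deg≤1⇒≡ : ∀ {u a b} → deg Γ u ≤ 1 → Edge Γ u a → Edge Γ u b → a ≡ b
  deg≤1⇒≡ {u} {a} {b} h ea eb with a ≟F b
  ... | yes eq = eq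
  ... | no a≢b = ⊥-elim (<⇒≱ (2≤deg a≢b ea eb) h)

  deg≤2⇒≡ : ∀ {u a b c} → deg Γ u ≤ 2 → a ≢ b → Edge Γ u a → Edge Γ u b → Edge Γ u c → c ≡ a ⊎ c ≡ b
  deg≤2⇒≡ {u} {a} {b} {c} h a≢b ea eb ec with c ≟F a | c ≟F b
  ... | yes eq | _ = inj₁ eq
  ... | _ | yes eq = inj₂ eq
  ... | no c≢a | no c≢b = ⊥-elim (<⇒≱ (3≤deg a≢b (c≢a ∘ sym) (c≢b ∘ sym) ea eb ec) h)

module _ {m} (Γ : ConnectedGraph (suc m)) where

  neighbour-toward : ∀ {x r} → x ≢ r → Σ (Fin (suc m)) λ y → Edge Γ x y × d Γ y r < d Γ x r
  neighbour-toward {x} {r} x≢r with d Γ x r in eq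
  ... | zero = ⊥-elim (x≢r (d≡0⇒≡ Γ eq))
  ... | suc k = let y , e , eq′ = d-next Γ eq in y , e , s≤s (≡≤ eq′)

  -- The next vertex on a shortest path from x to r is nearer to r than x, hence not a farthest one.
  farthest-noncut : ∀ {r v} → r ≢ v → (∀ w → d Γ r w ≤ d Γ r v) → Noncut Γ v
  farthest-noncut {r} {v} r≢v far = r , r≢v , λ x x≢v x≢r →
    let y , e , lt = neighbour-toward x≢r in
    y , (λ { refl → <⇒≱ lt (subst₂ _≤_ (d-sym Γ r x) (d-sym Γ r v) (far x)) }) , e , lt

  -- With the neighbour w as root, only w itself could step to v.
  pendant-noncut : ∀ {v w} → Edge Γ v w → deg Γ v ≤ 1 → Noncut Γ v
  pendant-noncut {v} {w} e₀ one = w , (λ eq → edge⇒≢ Γ e₀ (sym eq)) , λ x x≢v x≢w →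
    let y , e , lt = neighbour-toward x≢w in
    y , (λ { refl → x≢w (deg≤1⇒≡ Γ one (edge-sym Γ e) e₀) }) , e , lt

  module _ {v} (P : Periphery Γ v) where
    open Periphery P

    positive-e : ∀ {x} → v ≢ x → 1 ≤ e
    positive-e {x} v≢x = ≤-trans (d-pos Γ v≢x) (bounded x)

    first-edge : 1 ≤ e → Edge Γ v (path 1)
    first-edge 1≤e = subst (λ x → Edge Γ x (path 1)) start (edge 0 1≤e)

    off-neighbour : ∀ {b} → Edge Γ v b → path 1 ≢ b → OffPath Γ geo b
    off-neighbour e = offPath Γ geo (d-edge Γ e)

    -- One neighbour of v is `path 1`; a second one is off the geodesic at level 1 and falls short
    -- of e by e - 1.
    deg≥2-deficit₊ : 1 ≤ e → 2 ≤ deg Γ v → 1 ≤ k × trans-sum Γ v + tri k + (e ∸ 1) ≤ tri m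
    deg≥2-deficit₊ 1≤e two =
      let b , eb , p₁≢b = second-neighbour Γ (path 1) two
          off = off-neighbour eb p₁≢b in
      extra⇒1≤k Γ P off , subst (λ l → trans-sum Γ v + tri k + (e ∸ l) ≤ tri m) (d-edge Γ eb) (deficit₁ Γ P off)

    deg≥2-deficit : 1 ≤ e → 2 ≤ deg Γ v → trans-sum Γ v + (m ∸ 1) ≤ tri m
    deg≥2-deficit 1≤e two = ≤-trans (+-monoʳ-≤ (trans-sum Γ v) (bound e k size 1≤e))
      (≤-trans (≡≥ (+-assoc (trans-sum Γ v) _ _)) (proj₂ (deg≥2-deficit₊ 1≤e two)))
      where
      bound : ∀ e k {m} → m ≡ e + k → 1 ≤ e → m ∸ 1 ≤ tri k + (e ∸ 1)
      bound (suc e) k refl _ = ≤-trans (≡≤ (+-comm e k)) (+-monoˡ-≤ e (tri≥ k))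

    deg≥3-deficit₊ : 3 ≤ deg Γ v → 2 ≤ k × trans-sum Γ v + tri k + ((e ∸ 1) + (e ∸ 1)) ≤ tri m
    deg≥3-deficit₊ three =
      let b , eb , p₁≢b = second-neighbour Γ (path 1) (<⇒≤ three)
          c , ec , p₁≢c , b≢c = third-neighbour Γ (path 1) b three
          offb = off-neighbour eb p₁≢b; offc = off-neighbour ec p₁≢c in
      extras⇒2≤k Γ P offb offc b≢c
      , subst₂ (λ l l′ → trans-sum Γ v + tri k + ((e ∸ l) + (e ∸ l′)) ≤ tri m) (d-edge Γ eb) (d-edge Γ ec)
          (deficit₂ Γ P offb offc b≢c)

    -- Two extra neighbours give 2(e - 1) and force k ≥ 2, where `tri k` is at least 2k - 1; in all
    -- δ ≥ 2n - 5.
    deg≥3-deficit : 1 ≤ e → 3 ≤ deg Γ v → trans-sum Γ v + 2 * (m ∸ 1) ≤ tri m + 1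
    deg≥3-deficit 1≤e three = let 2≤k , def = deg≥3-deficit₊ three in bound (trans-sum Γ v) e k size 1≤e 2≤k def
      where
      bound : ∀ D e k {m t} → m ≡ e + k → 1 ≤ e → 2 ≤ k → D + tri k + ((e ∸ 1) + (e ∸ 1)) ≤ t → D + 2 * (m ∸ 1) ≤ t + 1
      bound D (suc e) (suc zero) refl _ (s≤s ()) _
      bound D (suc e) (suc (suc k)) refl _ _ h = ≤-trans (+-monoʳ-≤ D small) (≤-trans (≡≤ (regroup D _ _)) (+-monoˡ-≤ 1 h))
        where
        certificate : ∀ s → 2 * (e + (2 + k)) + s ≡ (2 + k + (1 + k + s)) + (e + e) + 1
        certificate s = solve (e ∷ k ∷ s ∷ [])
        small : 2 * (e + (2 + k)) ≤ tri (2 + k) + (e + e) + 1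
        small = ≤-trans (m≤m+n _ (tri k)) (≡≤ (certificate (tri k)))
        regroup : ∀ a b c → a + (b + c + 1) ≡ a + b + c + 1
        regroup a b c = solve (a ∷ b ∷ c ∷ [])

    -- The geodesic has only e = n - 2 edges, so x is the end of at least three more. Their other
    -- ends lie at levels within one of the level of x, hence at three consecutive places: x doubles
    -- `path (1 + j)`, an inner vertex of the geodesic.
    chain-extra : ∀ {x} → k ≡ 1 → 2 + m ≤ edges Γ → OffPath Γ geo x →
      Σ ℕ λ j → d Γ v x ≡ suc j × 2 + j ≤ e × Edge Γ (path j) x × Edge Γ (path (1 + j)) x × Edge Γ (path (2 + j)) x
    chain-extra {x} k≡1 count off = result
      where
      b : ℕ → ℕ
      b i = ind (adj Γ (path i) x)
      three : 3 ≤ sumTo (suc e) b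
      three = +-cancelˡ-≤ e 3 _ (≤-trans (≡≤ (trans (+-comm e 3) (cong (2 +_) (suc-injective (size-K Γ P 1 k≡1)))))
          (≤-trans count (≡≤ (count₁ Γ P k≡1 off))))
      result : Σ ℕ λ j → d Γ v x ≡ suc j × 2 + j ≤ e × Edge Γ (path j) x × Edge Γ (path (1 + j)) x × Edge Γ (path (2 + j)) x
      result with d Γ v x in eq
      ... | zero = ⊥-elim (off 0 (s≤s z≤n) (trans start (d≡0⇒≡ Γ eq)))
      ... | suc j with window (suc e) j b (λ i → ind≤1 _) below above three
        where
        below : ∀ i → i < j → b i ≡ 0
        below i i<j with i ≤? e
        ... | yes i≤e = ind-¬T λ ed → <⇒≱ i<j (s≤s⁻¹ (≤-trans (≡≥ eq) (nbr-level-≥ Γ geo i≤e ed)))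
        ... | no i≰e = ⊥-elim (i≰e (≤-trans (≤-trans (<⇒≤ i<j) (n≤1+n j)) (subst (_≤ e) eq (bounded x))))
        above : ∀ i → i < suc e → 2 + j < i → b i ≡ 0
        above i i≤e lt = ind-¬T λ ed → <⇒≱ lt (≤-trans (nbr-level-≤ Γ geo (s≤s⁻¹ i≤e) ed) (≡≤ (cong suc eq)))
      ...   | lt , b₀ , b₁ , b₂ = j , refl , s≤s⁻¹ lt , 1≤ind⇒T b₀ , 1≤ind⇒T b₁ , 1≤ind⇒T b₂

record Peeled {m} (Γ : ConnectedGraph (suc m)) (v : Fin (suc m)) : Set where
  field
    conn : Connected (deleted Γ v)
  rest : ConnectedGraph m
  rest = delete Γ v conn
  wiener-≤ : Wiener Γ ≤ Wiener rest + trans-sum Γ v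
  wiener-≤ = Wiener-delete Γ v conn
  edges-≡ : edges Γ ≡ edges rest + deg Γ v
  edges-≡ = edges-delete Γ v conn

  -- The bookkeeping of a deletion: f(rest) ≥ x - y and δ ≥ z - y′ yield f Γ ≥ c - b. The last
  -- hypothesis is the numerical inequality that each application settles by a ring identity.
  peel-bound : ∀ x y z y′ c b → Wiener rest + x ≤ pathWiener m + y → trans-sum Γ v + z ≤ tri m + y′ →
    c + (y + y′) ≤ x + z + b → Wiener Γ + c ≤ pathWiener (suc m) + b
  peel-bound x y z y′ c b h₁ h₂ h₃ = +-cancelʳ-≤ (y + y′) (Wiener Γ + c) _ (begin
    Wiener Γ + c + (y + y′)                                  ≡⟨ +-assoc (Wiener Γ) c _ ⟩
    Wiener Γ + (c + (y + y′))                                ≤⟨ wiener-≤ ⊹ h₃ ⟩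
    Wiener rest + trans-sum Γ v + (x + z + b)                ≡⟨ sym (+-assoc (Wiener rest + trans-sum Γ v) (x + z) b) ⟩
    Wiener rest + trans-sum Γ v + (x + z) + b                ≡⟨ cong (_+ b) (interchange (Wiener rest) (trans-sum Γ v) x z) ⟩
    Wiener rest + x + (trans-sum Γ v + z) + b                ≤⟨ +-monoˡ-≤ b (h₁ ⊹ h₂) ⟩
    pathWiener m + y + (tri m + y′) + b                      ≡⟨ cong (_+ b) (interchange (pathWiener m) y (tri m) y′) ⟩
    pathWiener m + tri m + (y + y′) + b                      ≡⟨ swap-right (pathWiener m + tri m) (y + y′) b ⟩
    pathWiener m + tri m + b + (y + y′)                      ∎)
    where
    open ≤-Reasoning
    swap-right : ∀ p y t → (p + y) + t ≡ p + t + y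
    swap-right p y t = solve (p ∷ y ∷ t ∷ [])

  fewer-edges : ∀ c j → j + c ≤ edges Γ → deg Γ v ≤ j → c ≤ edges rest
  fewer-edges c j count le = +-cancelˡ-≤ j c _ (≤-trans count (≤-trans (≡≤ edges-≡)
    (≤-trans (+-monoʳ-≤ (edges rest) le) (≡≤ (+-comm (edges rest) j)))))

peel : ∀ {m} (Γ : ConnectedGraph (suc m)) {v} → Noncut Γ v → Peeled Γ v
peel Γ {v} nc = record { conn = noncut⇒connected Γ v nc }

opaque
  farthest : ∀ {m} (Γ : ConnectedGraph (2 + m)) (r : Fin (2 + m)) →
    Σ (Fin (2 + m)) λ v → r ≢ v × (∀ w → d Γ r w ≤ d Γ r v)
  farthest {m} Γ r with argmax (d Γ r)
  ... | v , far = v , r≢v , far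
    where
    r≢v : r ≢ v
    r≢v eq = <⇒≱ (d-pos Γ (punchInᵢ≢i r fzero ∘ sym)) (≤-trans (far (punchIn r fzero)) (≡≤ (trans (cong (d Γ r) (sym eq))
        (d-refl Γ r))))

wiener≤path : ∀ n (Γ : ConnectedGraph n) → Wiener Γ ≤ pathWiener n
wiener≤path zero Γ = ≡≤ (Wiener≡W Γ)
wiener≤path (suc zero) Γ = ≡≤ (Wiener≡W Γ)
wiener≤path (suc (suc m)) Γ =
  let v , r≢v , far = farthest Γ fzero
      open Peeled (peel Γ (farthest-noncut Γ r≢v far)) in
  ≤-trans wiener-≤ (wiener≤path (suc m) rest ⊹ ≤-trans (m≤m+n _ _) (deficit₀ Γ (periphery Γ v)))

+0 : ∀ {a b} → a ≤ b → a + 0 ≤ b + 0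
+0 = +-monoˡ-≤ 0

+0ʳ : ∀ {a b} → a ≤ b → a ≤ b + 0
+0ʳ h = ≤-trans h (m≤m+n _ 0)

UnicyclicBound : ℕ → Set
UnicyclicBound n = ∀ (Γ : ConnectedGraph n) → n ≤ edges Γ → Wiener Γ + n ≤ pathWiener n + 2

-- A vertex of degree 1 costs one edge, and δ ≥ 1 because Γ is not a path. For a larger degree δ ≥ n
-- - 2 suffices by itself, with f(rest) ≥ 0.
unicyclic-step : ∀ m → UnicyclicBound (suc m) → UnicyclicBound (2 + m)
unicyclic-step m IH Γ count with farthest Γ fzero
... | v , r≢v , far = split (deg Γ v ≤? 1)
  where
  Q = peel Γ (farthest-noncut Γ r≢v far)
  open Peeled Q
  P = periphery Γ v
  open Periphery P
  1≤k : 1 ≤ k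
  1≤k with k in eq
  ... | zero = ⊥-elim (<⇒≱ count (path-count Γ P eq))
  ... | suc _ = s≤s z≤n
  split : Dec (deg Γ v ≤ 1) → Wiener Γ + (2 + m) ≤ pathWiener (2 + m) + 2
  split (yes one) = peel-bound (suc m) 2 1 0 (2 + m) 2
    (IH rest (fewer-edges (suc m) 1 count one))
    (+0ʳ (≤-trans (+-monoʳ-≤ (trans-sum Γ v) (≤-trans 1≤k (tri≥ k))) (deficit₀ Γ P)))
    (≡≤ (cong (_+ 2) (+-comm 1 (suc m))))
  split (no ¬one) = peel-bound 0 0 m 0 (2 + m) 2
    (+0 (wiener≤path (suc m) rest))
    (+0ʳ (deg≥2-deficit Γ P (positive-e Γ P (r≢v ∘ sym)) (≰⇒> ¬one)))
    (≡≤ (trans (+-identityʳ (2 + m)) (+-comm 2 m)))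

unicyclic-bound : ∀ n → UnicyclicBound n
unicyclic-bound zero Γ _ = ≤-trans (+-monoˡ-≤ 0 (≡≤ (Wiener≡W Γ))) z≤n
unicyclic-bound (suc zero) Γ _ = ≤-trans (+-monoˡ-≤ 1 (≡≤ (Wiener≡W Γ))) (s≤s z≤n)
unicyclic-bound (suc (suc m)) = unicyclic-step m (unicyclic-bound (suc m))

BicyclicBound : ℕ → Set
BicyclicBound n = ∀ (Γ : ConnectedGraph n) → suc n ≤ edges Γ → Wiener Γ + 2 * n ≤ pathWiener n + 5

-- By the degree of the deleted vertex, f(rest) + δ is at least (2n - 7) + 2, (n - 3) + (n - 2) or 0
-- + (2n - 5). Every case gives exactly 2n - 5, the value at B(n,0).
bicyclic-step : ∀ m → BicyclicBound (suc m) → BicyclicBound (2 + m)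
bicyclic-step m IH Γ count with farthest Γ fzero
... | v , r≢v , far = split (deg Γ v ≤? 1) (deg Γ v ≤? 2)
  where
  Q = peel Γ (farthest-noncut Γ r≢v far)
  open Peeled Q
  P = periphery Γ v
  open Periphery P
  1≤e : 1 ≤ e
  1≤e = positive-e Γ P (r≢v ∘ sym)
  def≥2 : trans-sum Γ v + 2 ≤ tri (suc m)
  def≥2 with k in eq
  ... | zero = ⊥-elim (<⇒≱ (<⇒≤ count) (path-count Γ P eq))
  ... | suc (suc j) = ≤-trans (+-monoʳ-≤ (trans-sum Γ v) (≤-trans (s≤s (s≤s z≤n)) (tri≥ (2 + j)))) (subst (λ k →
      trans-sum Γ v + tri k ≤ tri (suc m)) eq (deficit₀ Γ P))
  -- For k = 1 the triangular term gives only 1; the second unit comes from the extra vertex, which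
  -- doubles an inner vertex and so is not at level e.
  ... | suc zero with extra Γ P (≡≥ eq)
  ...   | x , off with chain-extra Γ P eq count off
  ...     | j , lx , j<e , _ = ≤-trans (≡≤ (sym (+-assoc (trans-sum Γ v) 1 1))) (≤-trans (+-monoʳ-≤ (trans-sum Γ v + 1) gap)
             (subst (λ k → trans-sum Γ v + tri k + (e ∸ d Γ v x) ≤ tri (suc m)) eq (deficit₁ Γ P off)))
    where
    gap : 1 ≤ e ∸ d Γ v x
    gap = ≤-trans (m<n⇒0<n∸m j<e) (≡≥ (cong (e ∸_) lx))
  split : Dec (deg Γ v ≤ 1) → Dec (deg Γ v ≤ 2) → Wiener Γ + 2 * (2 + m) ≤ pathWiener (2 + m) + 5
  split (yes one) _ = peel-bound (2 * suc m) 5 2 0 (2 * (2 + m)) 5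
    (IH rest (fewer-edges (2 + m) 1 count one))
    (+0ʳ def≥2)
    (≡≤ (cong (_+ 5) (residual m)))
    where
    residual : ∀ m → 2 * (2 + m) ≡ 2 * suc m + 2
    residual m = solve (m ∷ [])
  split (no ¬one) (yes two) = peel-bound (suc m) 2 m 0 (2 * (2 + m)) 5
    (unicyclic-bound (suc m) rest (fewer-edges (suc m) 2 count two))
    (+0ʳ (deg≥2-deficit Γ P 1≤e (≰⇒> ¬one)))
    (≡≤ (residual m))
    where
    residual : ∀ m → 2 * (2 + m) + 2 ≡ suc m + m + 5
    residual m = solve (m ∷ [])
  split (no _) (no ¬two) = peel-bound 0 0 (2 * m) 1 (2 * (2 + m)) 5
    (+0 (wiener≤path (suc m) rest))
    (deg≥3-deficit Γ P 1≤e (≰⇒> ¬two))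
    (≡≤ (residual m))
    where
    residual : ∀ m → 2 * (2 + m) + 1 ≡ 2 * m + 5
    residual m = solve (m ∷ [])

bicyclic-bound : ∀ n → BicyclicBound n
bicyclic-bound zero Γ _ = ≤-trans (+-monoˡ-≤ 0 (≡≤ (Wiener≡W Γ))) z≤n
bicyclic-bound (suc zero) Γ _ = ≤-trans (+-monoˡ-≤ 2 (≡≤ (Wiener≡W Γ))) (s≤s (s≤s z≤n))
bicyclic-bound (suc (suc m)) = bicyclic-step m (bicyclic-bound (suc m))

-- Graphs of diameter at most n − 3

-- peak c j t is the distance ∣ j - t ∣, except that it takes the value c at t = j.
peak : ℕ → ℕ → ℕ → ℕ
peak c zero zero = c
peak c zero (suc t) = suc t
peak c (suc j) zero = suc j
peak c (suc j) (suc t) = peak c j t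

peak-at : ∀ c j → peak c j j ≡ c
peak-at c zero = refl
peak-at c (suc j) = peak-at c j

peak-above : ∀ c j s → peak c j (suc (j + s)) ≡ suc s
peak-above c zero s = refl
peak-above c (suc j) s = peak-above c j s

peak-below : ∀ c t s → peak c (suc (t + s)) t ≡ suc s
peak-below c zero s = refl
peak-below c (suc t) s = peak-below c t s

sumTo-suc-id : ∀ k → sumTo k suc ≡ tri k
sumTo-suc-id zero = refl
sumTo-suc-id (suc k) = trans (cong (_+ suc k) (sumTo-suc-id k)) (+-comm (tri k) (suc k))

sumTo-peak : ∀ c j j′ → sumTo (suc (j + j′)) (peak c j) ≡ tri j + c + tri j′
sumTo-peak c zero j′ = trans (sumTo-suc j′ (peak c 0)) (cong (c +_) (sumTo-suc-id j′))
sumTo-peak c (suc j) j′ = trans (sumTo-suc (suc (j + j′)) (peak c (suc j)))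
  (trans (cong (suc j +_) (sumTo-peak c j j′)) (regroup (suc j) (tri j) c (tri j′)))
  where
  regroup : ∀ a b c d → a + (b + c + d) ≡ a + b + c + d
  regroup a b c d = solve (a ∷ b ∷ c ∷ d ∷ [])

module _ {n} (Γ : ConnectedGraph n) (p : ℕ → Fin n) (D : ℕ) (edge : ∀ i → i < D → Edge Γ (p i) (p (suc i))) where

  path-≤ : ∀ i s → i + s ≤ D → d Γ (p i) (p (i + s)) ≤ s
  path-≤ i zero h = ≡≤ (trans (cong (λ j → d Γ (p i) (p j)) (+-identityʳ i)) (d-refl Γ (p i)))
  path-≤ i (suc s) h rewrite +-suc i s =
    ≤-trans (d-lip Γ (p i) (edge-sym Γ (edge (i + s) h))) (s≤s (path-≤ i s (<⇒≤ h)))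

  path-peak : ∀ i t → i ≤ D → t ≤ D → d Γ (p i) (p t) ≤ peak 0 i t
  path-peak i t i≤D t≤D with compare i t
  ... | equal .i = ≡≤ (trans (d-refl Γ (p i)) (sym (peak-at 0 i)))
  ... | less .i s = ≤-trans (subst (λ l → d Γ (p i) (p l) ≤ suc s) (+-suc i s)
          (path-≤ i (suc s) (≤-trans (≡≤ (+-suc i s)) t≤D))) (≡≥ (peak-above 0 i s))
  ... | greater .t s = ≤-trans (≡≤ (d-sym Γ _ _)) (≤-trans (subst (λ l → d Γ (p t) (p l) ≤ suc s) (+-suc t s)
          (path-≤ t (suc s) (≤-trans (≡≤ (+-suc t s)) i≤D))) (≡≥ (peak-below 0 t s)))

  -- x is adjacent to vertex j of the path and to its neighbours there. The conditions in `before`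
  -- and `after` admit twins of the two ends as well.
  record Twin (j : ℕ) (x : Fin n) : Set where
    field
      j≤D : j ≤ D
      at : Edge Γ (p j) x
      before : ∀ i → suc i ≡ j → Edge Γ (p i) x
      after : suc j ≤ D → Edge Γ (p (suc j)) x

  twin-peak : ∀ {j x} → Twin j x → ∀ t → t ≤ D → d Γ (p t) x ≤ peak 1 j t
  twin-peak {j} {x} tw t t≤D with compare j t
  ... | equal .j = ≤-trans (d-edge≤1 Γ at) (≡≥ (peak-at 1 j))
    where open Twin tw
  ... | less .j s = ≤-trans (d-triangle Γ _ (p (suc j)) x)
          (≤-trans ((≤-trans (≡≤ (d-sym Γ _ _)) (path-≤ (suc j) s t≤D)) ⊹ d-edge≤1 Γ (after (≤-trans (s≤s (m≤m+n j s)) t≤D)))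
            (≡≤ (trans (+-comm s 1) (sym (peak-above 1 j s)))))
    where open Twin tw
  ... | greater .t s = ≤-trans (d-triangle Γ (p t) (p (t + s)) x)
          (≤-trans (path-≤ t s (≤-trans (n≤1+n _) j≤D) ⊹ d-edge≤1 Γ (before (t + s) refl))
            (≡≤ (trans (+-comm s 1) (sym (peak-below 1 t s)))))
    where open Twin tw

-- Diameter at most n − 3.
Short : ∀ {n} → ConnectedGraph n → Set
Short {n} Γ = ∀ u z → 3 + d Γ u z ≤ n

short⇒2≤k : ∀ {m} {Γ : ConnectedGraph (suc m)} {v} → Short Γ → (P : Periphery Γ v) → 2 ≤ Periphery.k P
short⇒2≤k {m} {Γ} {v} short P = +-cancelˡ-≤ e 2 k (begin
  e + 2                  ≡⟨ +-comm e 2 ⟩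
  2 + e                  ≡⟨ cong (2 +_) (sym (level e ≤-refl)) ⟩
  2 + d Γ v (path e)     ≤⟨ s≤s⁻¹ (short v (path e)) ⟩
  m                      ≡⟨ size ⟩
  e + k                  ∎)
  where
  open Periphery P
  open ≤-Reasoning

tri≥suc : ∀ {k} → 2 ≤ k → suc k ≤ tri k
tri≥suc (s≤s (s≤s {n = k} z≤n)) = lin 0 (z≤n {k + tri k}) (certificate k (tri k))
  where
  certificate : ∀ k s → suc (2 + k) + (k + s) + 0 ≡ (2 + k + (1 + k + s)) + 0
  certificate k s = solve (k ∷ s ∷ [])

upperSum-+≤ : ∀ {n} (F G H : Fin n → Fin n → ℕ) → (∀ u v → F u v + G u v ≤ H u v) → upperSum F + upperSum G ≤ upperSum H
upperSum-+≤ {n} F G H h = begin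
  upperSum F + upperSum G                                   ≡⟨ sym (sumFin-+ (λ u → sumFin (cut F u)) (λ u →
      sumFin (cut G u))) ⟩
  sumFin (λ u → sumFin (cut F u) + sumFin (cut G u))        ≡⟨ sumFin-cong (λ u → sym (sumFin-+ (cut F u) (cut G u))) ⟩
  sumFin (λ u → sumFin (λ v → cut F u v + cut G u v))       ≤⟨ sumFin-mono (λ u → sumFin-mono (bound u)) ⟩
  upperSum H                                                ∎
  where
  open ≤-Reasoning
  cut : (Fin n → Fin n → ℕ) → Fin n → Fin n → ℕ
  cut F u v = if toℕ u <ᵇ toℕ v then F u v else 0
  bound : ∀ u v → cut F u v + cut G u v ≤ cut H u v
  bound u v with toℕ u <ᵇ toℕ v
  ... | true = h u v
  ... | false = z≤n

-- All distances are at most 2, and at most 1 on the edges: W is at most 2·10 - 6.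
diameter-2-bound : ∀ (Γ : ConnectedGraph 5) → Short Γ → 6 ≤ edges Γ → Wiener Γ ≤ 14
diameter-2-bound Γ short count = +-cancelʳ-≤ 6 (Wiener Γ) 14 (≤-trans
  (≡≤ (trans (Wiener≡W Γ) (W≡upperSum Γ)) ⊹ ≤-trans count (≡≤ (edges≡upperSum Γ)))
  (upperSum-+≤ (d Γ) (λ u v → ind (adj Γ u v)) (λ _ _ → 2) local))
  where
  local : ∀ u v → d Γ u v + ind (adj Γ u v) ≤ 2
  local u v with edge? Γ u v
  ... | yes e = d-edge≤1 Γ e ⊹ ind≤1 (adj Γ u v)
  ... | no ¬e = ≤-trans (≡≤ (trans (cong (d Γ u v +_) (ind-¬T ¬e)) (+-identityʳ _))) (s≤s⁻¹ (s≤s⁻¹ (s≤s⁻¹ (short u v))))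

module _ {m} (Γ : ConnectedGraph (2 + m)) (short : Short Γ) (count : 3 + m ≤ edges Γ) where

  -- f ≥ 2n - 4, one unit above the general bicyclic bound.
  ShortBound : Set
  ShortBound = Wiener Γ + 2 * (2 + m) ≤ pathWiener (2 + m) + 4

  -- Shortness gives k ≥ 2, so the triangular term is at least k + 1. That is the missing unit for
  -- degrees 1 and 2; for larger degree it appears only when k ≥ 3, where `tri k` is at least 2k.
  short-bound-at : ∀ {r v} → r ≢ v → Noncut Γ v → (P : Periphery Γ v) →
    ShortBound ⊎ (3 ≤ deg Γ v × Periphery.k P ≡ 2)
  short-bound-at {r} {v} r≢v nc P = split (deg Γ v ≤? 1) (deg Γ v ≤? 2) (3 ≤? k)
    where
    open Peeled (peel Γ nc)
    open Periphery P
    1≤e : 1 ≤ e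
    1≤e = positive-e Γ P (r≢v ∘ sym)
    2≤k : 2 ≤ k
    2≤k = short⇒2≤k short P
    D = trans-sum Γ v
    split : Dec (deg Γ v ≤ 1) → Dec (deg Γ v ≤ 2) → Dec (3 ≤ k) → ShortBound ⊎ (3 ≤ deg Γ v × k ≡ 2)
    split (yes one) _ _ = inj₁ (peel-bound (2 * suc m) 5 3 0 (2 * (2 + m)) 4
      (bicyclic-bound (suc m) rest (fewer-edges (2 + m) 1 count one))
      (+0ʳ (≤-trans (+-monoʳ-≤ D (≤-trans (s≤s 2≤k) (tri≥suc 2≤k))) (deficit₀ Γ P)))
      (≡≤ (residual m)))
      where
      residual : ∀ m → 2 * (2 + m) + 5 ≡ 2 * suc m + 3 + 4
      residual m = solve (m ∷ [])
    split (no ¬one) (yes two) _ = inj₁ (peel-bound (suc m) 2 (suc m) 0 (2 * (2 + m)) 4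
      (unicyclic-bound (suc m) rest (fewer-edges (suc m) 2 count two))
      (+0ʳ (≤-trans (+-monoʳ-≤ D (small e k size 1≤e 2≤k)) (≤-trans (≡≥ (+-assoc D _ _)) (proj₂ (deg≥2-deficit₊ Γ P 1≤e
          (≰⇒> ¬one))))))
      (≡≤ (residual m)))
      where
      residual : ∀ m → 2 * (2 + m) + 2 ≡ suc m + suc m + 4
      residual m = solve (m ∷ [])
      small : ∀ e k {m} → suc m ≡ e + k → 1 ≤ e → 2 ≤ k → suc m ≤ tri k + (e ∸ 1)
      small (suc e) k refl _ 2≤k = ≤-trans (s≤s (≡≤ (+-comm e k))) (+-monoˡ-≤ e (tri≥suc 2≤k))
    split _ (no ¬two) (yes 3≤k) = inj₁ (peel-bound 0 0 (2 * m) 0 (2 * (2 + m)) 4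
      (+0 (wiener≤path (suc m) rest))
      (+0ʳ (≤-trans (+-monoʳ-≤ D (small e k size 1≤e 3≤k)) (≤-trans (≡≥ (+-assoc D _ _)) (proj₂ (deg≥3-deficit₊ Γ P
          (≰⇒> ¬two))))))
      (≡≤ (residual m)))
      where
      residual : ∀ m → 2 * (2 + m) + 0 ≡ 2 * m + 4
      residual m = solve (m ∷ [])
      small : ∀ e k {m} → suc m ≡ e + k → 1 ≤ e → 3 ≤ k → 2 * m ≤ tri k + ((e ∸ 1) + (e ∸ 1))
      small _ 1 _ _ (s≤s ())
      small _ 2 _ _ (s≤s (s≤s ()))
      small (suc e) (suc (suc (suc k))) refl _ _ = ≤-trans (≡≤ (split2 e k)) (+-monoˡ-≤ (e + e) (tri≥2k k))
        where
        split2 : ∀ e k → 2 * (e + (3 + k)) ≡ 2 * (3 + k) + (e + e)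
        split2 e k = solve (e ∷ k ∷ [])
    split _ (no ¬two) (no ¬3≤k) = inj₂ (≰⇒> ¬two , ≤-antisym (s≤s⁻¹ (≰⇒> ¬3≤k)) 2≤k)

  -- If the estimate fails both at v and at a vertex z farthest from v, both have degree at least 3
  -- and just two vertices, neighbours of v, lie off the geodesic. One of them must be a further
  -- neighbour of z, so e ≤ 2 and n = 5, where W is bounded directly.
  short-bound : 3 ≤ m → ShortBound
  short-bound 3≤m with farthest Γ fzero
  ... | v , r≢v , far₁ = fromAt (short-bound-at r≢v (farthest-noncut Γ r≢v far₁) P)
    where
    P = periphery Γ v
    open Periphery P
    1≤e : 1 ≤ e
    1≤e = positive-e Γ P (r≢v ∘ sym)
    z = path e
    v≢z : v ≢ z
    v≢z eq = <⇒≱ 1≤e (≡≤ (trans (sym (level e ≤-refl)) (trans (cong (d Γ v) (sym eq)) (d-refl Γ v))))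
    z-far : ∀ w → d Γ v w ≤ d Γ v z
    z-far w = ≤-trans (bounded w) (≡≥ (level e ≤-refl))
    fromAt : ShortBound ⊎ (3 ≤ deg Γ v × k ≡ 2) → ShortBound
    fromAt (inj₁ done) = done
    fromAt (inj₂ (3≤v , k≡2)) with short-bound-at v≢z (farthest-noncut Γ v≢z z-far) (periphery Γ z)
    ... | inj₁ done = done
    ... | inj₂ (3≤z , _) with e ≤? 2
    ...   | yes e≤2 = five e size k≡2 e≤2
      where
      five : ∀ e {k} → suc m ≡ e + k → k ≡ 2 → e ≤ 2 → ShortBound
      five e sz refl e≤2 with ≤-antisym (s≤s⁻¹ (≤-trans (≡≤ (trans sz (+-comm e 2))) (+-monoʳ-≤ 2 e≤2))) 3≤m
      ... | refl = +-monoˡ-≤ 10 (diameter-2-bound Γ short count)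
    ...   | no e≰2 =
      let b , eb , p₁≢b = second-neighbour Γ (path 1) (<⇒≤ 3≤v)
          c , ec , p₁≢c , b≢c = third-neighbour Γ (path 1) b 3≤v
          offb = off-neighbour Γ P eb p₁≢b; offc = off-neighbour Γ P ec p₁≢c
          x , ex , px≢x = second-neighbour Γ (path (e ∸ 1)) (<⇒≤ 3≤z) in
      ⊥-elim (covered x ex px≢x offb (d-edge Γ eb) offc (d-edge Γ ec) b≢c)
      where
      covered : ∀ x → Edge Γ z x → path (e ∸ 1) ≢ x → ∀ {b c} → OffPath Γ geo b → d Γ v b ≡ 1 → OffPath Γ geo c →
          d Γ v c ≡ 1 → b ≢ c → ⊥
      covered x ex px≢x offb lb offc lc b≢c with vertices Γ P k≡2 offb offc b≢c x
      ... | inj₁ (i , i≤e , eq) = deep (trans (cong (d Γ v) (sym eq)) (level i i≤e)) eq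
        where
        deep : d Γ v x ≡ i → path i ≡ x → ⊥
        deep lx eq with m≤n⇒m<n∨m≡n i≤e
        ... | inj₂ refl = edge⇒≢ Γ ex eq
        ... | inj₁ i<e = px≢x (trans (cong path (≤-antisym (pred-mono-≤ (≤-trans (nbr-level-≤ Γ geo ≤-refl ex)
            (≡≤ (cong suc lx)))) (pred-mono-≤ i<e))) eq)
      ... | inj₂ (inj₁ refl) = shallow lb
        where
        shallow : d Γ v x ≡ 1 → ⊥
        shallow lx = e≰2 (≤-trans (nbr-level-≤ Γ geo ≤-refl ex) (≡≤ (cong suc lx)))
      ... | inj₂ (inj₂ refl) = shallow lc
        where
        shallow : d Γ v x ≡ 1 → ⊥
        shallow lx = e≰2 (≤-trans (nbr-level-≤ Γ geo ≤-refl ex) (≡≤ (cong suc lx)))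

-- Pendant vertices

short? : ∀ {n} (Γ : ConnectedGraph n) → Short Γ ⊎ Σ (Fin n) λ u → Σ (Fin n) λ z → n < 3 + d Γ u z
short? {n} Γ with all? (λ u → all? (λ z → 3 + d Γ u z ≤? n))
... | yes s = inj₁ s
... | no ¬s with ¬∀⟶∃¬ n _ (λ u → all? (λ z → 3 + d Γ u z ≤? n)) ¬s
... | u , ¬su with ¬∀⟶∃¬ n _ (λ z → 3 + d Γ u z ≤? n) ¬su
... | z , ¬suz = inj₂ (u , z , ≰⇒> ¬suz)

-- Convexity: for a given sum a + b the left side is largest when a or b is 0, and there equality
-- holds.
convex-tri : ∀ a b → tri (suc a) + tri (suc b) ≤ 1 + tri (suc (a + b))
convex-tri a b = ≤-trans (≤-trans (m≤m+n _ (b * a)) (≡≤ (certificate a b (tri a) (tri b))))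
    (≡≥ (cong (λ t → suc (suc (a + b) + t)) (tri-+ a b)))
  where
  certificate : ∀ a b s t → (suc a + s) + (suc b + t) + b * a ≡ suc (suc (a + b) + (s + b * a + t))
  certificate a b s t = solve (a ∷ b ∷ s ∷ t ∷ [])

module _ {m} (Γ : ConnectedGraph (suc m)) {v} (P : Periphery Γ v) where
  open Periphery P

  chain-extra-twin : ∀ {x} → k ≡ 1 → 2 + m ≤ edges Γ → OffPath Γ geo x →
    Σ ℕ λ j → d Γ v x ≡ suc j × 2 + j ≤ e × Twin Γ path e edge (suc j) x
  chain-extra-twin k≡1 count off =
    let j , lx , j<e , e₀ , e₁ , e₂ = chain-extra Γ P k≡1 count off in
    j , lx , j<e , record { j≤D = <⇒≤ j<e ; at = e₁ ; before = λ { _ refl → e₀ } ; after = λ _ → e₂ }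

  sum-enum : ∀ K (q : ℕ → Fin (suc m)) → K ≡ suc m → InjectiveBelow K q → ∀ g → sumTo K (g ∘ q) ≡ sumFin g
  sum-enum K q refl inj = sumTo≡sumFin q inj

  trans-sum₁ : ∀ {x} → k ≡ 1 → OffPath Γ geo x → ∀ u → trans-sum Γ u ≡ sumTo (suc e) (λ i → d Γ u (path i)) + d Γ u x
  trans-sum₁ {x} k≡1 off u = trans (trans-sum≡ Γ u) (trans
    (sym (sum-enum (2 + e) _ (size-K Γ P 1 k≡1) (▹-injective (path-injective Γ geo) off) (d Γ u)))
    (sumTo-▹ (d Γ u) path (suc e) x))

  module _ {x j} (k≡1 : k ≡ 1) (off : OffPath Γ geo x) (1≤j : 1 ≤ j) (j<e : j < e) (twin : Twin Γ path e edge j x)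
      (3≤e : 3 ≤ e) where

    -- Along the path the distances sum to `tri i + tri (e ∸ i)`, at most 1 + `tri (e ∸ 1)` by
    -- convexity. The twin doubles an inner vertex, hence is at most e - 2 away.
    chain-trans-sum-path : ∀ i → 1 ≤ i → i < e → trans-sum Γ (path i) ≤ tri (e ∸ 1) + (e ∸ 1)
    chain-trans-sum-path i 1≤i i<e = ≤-trans (≡≤ (trans-sum₁ k≡1 off (path i))) (≤-trans
      (sumTo-mono (suc e) (λ t t≤e → path-peak Γ path e edge i t (<⇒≤ i<e) (s≤s⁻¹ t≤e))
        ⊹ twin-peak Γ path e edge twin i (<⇒≤ i<e))
      (arith i j e 1≤i i<e 1≤j j<e 3≤e))
      where
      gap : ∀ c l t → l ≤ suc c → t ≤ suc c → 1 ≤ l → 1 ≤ t → 1 ≤ c → peak 1 l t ≤ c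
      gap c l t hl ht 1≤l 1≤t h with compare l t
      ... | equal .l = ≤-trans (≡≤ (peak-at 1 l)) h
      ... | less .l s = ≤-trans (≡≤ (peak-above 1 l s)) (≤-trans (+-monoˡ-≤ s 1≤l) (s≤s⁻¹ ht))
      ... | greater .t s = ≤-trans (≡≤ (peak-below 1 t s)) (≤-trans (+-monoˡ-≤ s 1≤t) (s≤s⁻¹ hl))
      arith : ∀ i j e → 1 ≤ i → i < e → 1 ≤ j → j < e → 3 ≤ e → sumTo (suc e) (peak 0 i) + peak 1 j i ≤ tri (e ∸ 1) + (e ∸ 1)
      arith (suc a) j e _ i<e 1≤j j<e 3≤e with m≤n⇒∃[o]m+o≡n i<e
      ... | b , refl = ≤-trans (≡≤ split ⊹ gap′) (≤-trans (+-monoˡ-≤ (a + b) (convex-tri a b))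
          (≡≤ (regroup (tri (suc (a + b))) (a + b))))
        where
        split : sumTo (suc (suc (suc (a + b)))) (peak 0 (suc a)) ≡ tri (suc a) + tri (suc b)
        split = trans (cong (λ l → sumTo (suc (suc l)) (peak 0 (suc a))) (sym (+-suc a b)))
          (trans (sumTo-peak 0 (suc a) (suc b)) (cong (_+ tri (suc b)) (+-identityʳ (tri (suc a)))))
        gap′ : peak 1 j (suc a) ≤ a + b
        gap′ = gap (a + b) j (suc a) (s≤s⁻¹ j<e) (s≤s (m≤m+n a b)) 1≤j (s≤s z≤n) (s≤s⁻¹ (s≤s⁻¹ 3≤e))
        regroup : ∀ t c → suc t + c ≡ t + suc c
        regroup t c = sym (+-suc t c)

    chain-trans-sum-extra : trans-sum Γ x ≤ tri (e ∸ 1) + (e ∸ 1)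
    chain-trans-sum-extra = ≤-trans (≡≤ (trans-sum₁ k≡1 off x)) (≤-trans
      (sumTo-mono (suc e) (λ t t≤e → ≤-trans (≡≤ (d-sym Γ x (path t))) (twin-peak Γ path e edge twin t (s≤s⁻¹ t≤e)))
        ⊹ ≡≤ (d-refl Γ x))
      (arith j e 1≤j j<e 3≤e))
      where
      arith : ∀ j e → 1 ≤ j → j < e → 3 ≤ e → sumTo (suc e) (peak 1 j) + 0 ≤ tri (e ∸ 1) + (e ∸ 1)
      arith (suc a) e _ j<e 3≤e with m≤n⇒∃[o]m+o≡n j<e
      ... | b , refl = ≤-trans (≡≤ (trans (+-identityʳ _) split)) (≤-trans (convex (tri (suc a)) (tri (suc b))
          (convex-tri a b)) (+-monoʳ-≤ (tri (suc (a + b))) (s≤s⁻¹ 3≤e)))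
        where
        split : sumTo (suc (suc (suc (a + b)))) (peak 1 (suc a)) ≡ tri (suc a) + 1 + tri (suc b)
        split = trans (cong (λ l → sumTo (suc (suc l)) (peak 1 (suc a))) (sym (+-suc a b))) (sumTo-peak 1 (suc a) (suc b))
        convex : ∀ s t {u} → s + t ≤ 1 + u → s + 1 + t ≤ u + 2
        convex s t {u} h = lin 0 h (solve (s ∷ t ∷ u ∷ []))

  -- With k = 1 the graph is a path with one doubled vertex; the first alternative says that u is an end of that path.
  chain-position : k ≡ 1 → 2 + m ≤ edges Γ → 3 ≤ e → ∀ u →
    (Σ (Fin (suc m)) λ s → e ≤ d Γ u s) ⊎ (2 ≤ deg Γ u × trans-sum Γ u ≤ tri (e ∸ 1) + (e ∸ 1))
  chain-position k≡1 count 3≤e u with extra Γ P (≡≥ k≡1)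
  ... | x , off with chain-extra-twin k≡1 count off | vertices₁ Γ P k≡1 off u
  ...   | j , _ , j<e , tw | inj₂ refl = inj₂ (2≤deg Γ (λ eq → <⇒≢ (n<1+n j) (path-injective Γ geo _ _
      (s≤s (≤-trans (n≤1+n j) (<⇒≤ j<e))) (s≤s (<⇒≤ j<e)) eq))
            (edge-sym Γ (Twin.before tw j refl)) (edge-sym Γ (Twin.at tw))
          , chain-trans-sum-extra k≡1 off (s≤s z≤n) j<e tw 3≤e)
  ...   | j , _ , j<e , tw | inj₁ (zero , _ , refl) = inj₁ (path e , ≡≥ (trans (cong (λ a → d Γ a (path e)) start)
      (level e ≤-refl)))
  ...   | j , _ , j<e , tw | inj₁ (suc i , i<e , refl) with m≤n⇒m<n∨m≡n i<e
  ...     | inj₂ refl = inj₁ (v , ≡≥ (trans (d-sym Γ _ v) (level e ≤-refl)))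
  ...     | inj₁ i+1<e = inj₂ (2≤deg Γ (λ eq → <⇒≢ (m<n⇒m<1+n (n<1+n i)) (path-injective Γ geo _ _
      (s≤s (≤-trans (n≤1+n i) i<e)) (s≤s i+1<e) eq))
            (edge-sym Γ (edge i i<e)) (edge (suc i) i+1<e)
          , chain-trans-sum-path k≡1 off (s≤s z≤n) j<e tw 3≤e (suc i) (s≤s z≤n) i+1<e)

module Pendant {m} (Γ : ConnectedGraph (2 + m)) {v w} (ev : Edge Γ v w) (one : deg Γ v ≤ 1)
  (short : Short Γ) (count : edges Γ ≡ 3 + m) where

  open Peeled (peel Γ (pendant-noncut Γ ev one)) public

  v≢w : v ≢ w
  v≢w = edge⇒≢ Γ ev

  w′ : Fin (suc m)
  w′ = punchOut v≢w

  punchIn-w′ : punchIn v w′ ≡ w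
  punchIn-w′ = punchIn-punchOut v≢w

  deg-v : deg Γ v ≡ 1
  deg-v = ≤-antisym one (1≤deg Γ ev)

  rest-count : edges rest ≡ 2 + m
  rest-count = suc-injective (trans (+-comm 1 (edges rest)) (trans (cong (edges rest +_) (sym deg-v)) (trans (sym edges-≡)
      count)))

  deg-w : deg Γ w ≡ 1 + deg rest w′
  deg-w = trans (cong (deg Γ) (sym punchIn-w′)) (trans (deg-delete Γ v conn w′)
    (cong (_+ deg rest w′) (ind-T (subst (λ x → Edge Γ x v) (sym punchIn-w′) (edge-sym Γ ev)))))

  module _ (s : Fin (suc m)) where

    -- The distance to s in the rest, continued to v with one more than at w. It is 1-Lipschitz
    -- since w is the only neighbour of v, so here deletion does not lengthen distances.
    potential : Fin (2 + m) → ℕ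
    potential u with v ≟F u
    ... | yes _ = suc (d rest w′ s)
    ... | no v≢u = d rest (punchOut v≢u) s

    potential-v : potential v ≡ suc (d rest w′ s)
    potential-v with v ≟F v
    ... | yes _ = refl
    ... | no v≢v = ⊥-elim (v≢v refl)

    potential-s : potential (punchIn v s) ≡ 0
    potential-s with v ≟F punchIn v s
    ... | yes eq = ⊥-elim (punchInᵢ≢i v s (sym eq))
    ... | no v≢s = trans (cong (λ x → d rest x s) (punchIn-injective v _ s (punchIn-punchOut v≢s))) (d-refl rest s)

    only-w : ∀ {y} (v≢y : v ≢ y) → Edge Γ v y → punchOut v≢y ≡ w′
    only-w v≢y e = punchIn-injective v _ w′ (trans (punchIn-punchOut v≢y) (trans (deg≤1⇒≡ Γ one e ev) (sym punchIn-w′)))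

    potential-lipschitz : ∀ {u y} → Edge Γ u y → potential u ≤ suc (potential y)
    potential-lipschitz {u} {y} e with v ≟F u | v ≟F y
    ... | yes refl | yes refl = ⊥-elim (edge⇒≢ Γ e refl)
    ... | yes refl | no v≢y = s≤s (≡≥ (cong (λ x → d rest x s) (only-w v≢y e)))
    ... | no v≢u | yes refl = ≤-trans (≡≤ (cong (λ x → d rest x s) (only-w v≢u (edge-sym Γ e)))) (≤-trans (n≤1+n _) (n≤1+n _))
    ... | no v≢u | no v≢y = d-step rest s (subst₂ (Edge Γ) (sym (punchIn-punchOut v≢u)) (sym (punchIn-punchOut v≢y)) e)

    far-from-pendant : suc (d rest w′ s) ≤ d Γ v (punchIn v s)
    far-from-pendant = ≤-trans (≡≥ potential-v) (≤-trans (lipschitz Γ potential potential-lipschitz v (punchIn v s))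
      (≡≤ (trans (cong (d Γ v (punchIn v s) +_) potential-s) (+-identityʳ _))))

  trans-sum-pendant : trans-sum Γ v ≤ suc m + trans-sum rest w′
  trans-sum-pendant = begin
    trans-sum Γ v                                                ≡⟨ trans (trans-sum≡ Γ v) (sumFin-punchIn v (d Γ v)) ⟩
    d Γ v v + sumFin (λ i → d Γ v (punchIn v i))                 ≤⟨ ≡≤ (d-refl Γ v) ⊹ sumFin-mono via-w ⟩
    sumFin {suc m} (λ i → 1 + d rest w′ i)                       ≡⟨ sumFin-+ {suc m} (λ _ → 1) (d rest w′) ⟩
    sumFin {suc m} (λ _ → 1) + sumFin (d rest w′)                ≡⟨ cong₂ _+_ (trans (sumFin-const (suc m) 1) (*-identityʳ
        (suc m))) (sym (trans-sum≡ rest w′)) ⟩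
    suc m + trans-sum rest w′                                    ∎
    where
    open ≤-Reasoning
    via-w : ∀ i → d Γ v (punchIn v i) ≤ 1 + d rest w′ i
    via-w i = ≤-trans (d-step Γ _ ev) (s≤s (≤-trans (≡≤ (cong (λ x → d Γ x (punchIn v i)) (sym punchIn-w′)))
        (d-delete Γ v conn w′ i)))

  -- A rest that is not short is a path with a doubled vertex. If w were an end of that path, v
  -- would prolong it and Γ would not be short. So w is inner or the twin, and the small
  -- transmission of w gives δ ≥ n - 1.
  rest-chain : 4 ≤ m → ∀ {u z} → suc m < 3 + d rest u z → 2 ≤ deg rest w′ × trans-sum Γ v + suc m ≤ tri (suc m)
  rest-chain 4≤m {u} {z} long = split (chain-position rest P k≡1 (≡≥ rest-count) 3≤e w′)
    where
    P = periphery rest u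
    open Periphery P
    m≤1+e : m ≤ 1 + e
    m≤1+e = ≤-trans (s≤s⁻¹ (s≤s⁻¹ long)) (s≤s (bounded z))
    k≤1 : k ≤ 1
    k≤1 = +-cancelˡ-≤ e k 1 (≤-trans (≡≥ size) (≤-trans m≤1+e (≡≤ (+-comm 1 e))))
    k≡1 : k ≡ 1
    k≡1 with k in eq | k≤1
    ... | zero | _ = ⊥-elim (<⇒≱ (n≤1+n (suc m)) (≤-trans (≡≥ rest-count) (path-count rest P eq)))
    ... | suc zero | _ = refl
    ... | suc (suc _) | s≤s ()
    m≡1+e : m ≡ 1 + e
    m≡1+e = trans size (trans (cong (e +_) k≡1) (+-comm e 1))
    3≤e : 3 ≤ e
    3≤e = s≤s⁻¹ (≤-trans 4≤m m≤1+e)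
    arith : ∀ D e {m} → m ≡ 1 + e → 1 ≤ e → D ≤ suc m + (tri (e ∸ 1) + (e ∸ 1)) → D + suc m ≤ tri (suc m)
    arith D (suc c) refl _ h = ≤-trans (+-monoˡ-≤ (3 + c) h) (≡≤ (certificate c (tri c)))
      where
      certificate : ∀ c t → 3 + c + (t + c) + (3 + c) ≡ 3 + c + (2 + c + (1 + c + t))
      certificate c t = solve (c ∷ t ∷ [])
    split : (Σ (Fin (suc m)) λ s → e ≤ d rest w′ s) ⊎ (2 ≤ deg rest w′ × trans-sum rest w′ ≤ tri (e ∸ 1) + (e ∸ 1)) → _
    split (inj₁ (s , far)) = ⊥-elim (<⇒≱ (s≤s (≤-trans (s≤s far) (far-from-pendant s)))
      (s≤s⁻¹ (s≤s⁻¹ (≤-trans (short v (punchIn v s)) (s≤s (s≤s (≡≤ m≡1+e)))))))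
    split (inj₂ (two , h)) = two , arith (trans-sum Γ v) e m≡1+e (≤-trans (s≤s z≤n) 3≤e) (≤-trans trans-sum-pendant
        (+-monoʳ-≤ (suc m) h))

  P = periphery Γ v
  open Periphery P

  1≤e : 1 ≤ e
  1≤e = positive-e Γ P v≢w

  2≤k : 2 ≤ k
  2≤k = short⇒2≤k short P

  -- A third neighbour of w lies at level 2 off the geodesic and contributes e - 2; with `tri k` at
  -- least k + 1 this gives δ ≥ n - 2.
  branching-deficit : 3 ≤ deg Γ w → trans-sum Γ v + m ≤ tri (suc m)
  branching-deficit three =
    let y , ewy , v≢y , p₂≢y = third-neighbour Γ v (path 2) three
        ly = two-away ewy v≢y in
    ≤-trans (+-monoʳ-≤ (trans-sum Γ v) (small e k size (≤-trans (≡≥ ly) (bounded y)) 2≤k))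
      (≤-trans (≡≥ (+-assoc (trans-sum Γ v) _ _))
        (subst (λ l → trans-sum Γ v + tri k + (e ∸ l) ≤ tri (suc m)) ly (deficit₁ Γ P (offPath Γ geo ly p₂≢y))))
    where
    two-away : ∀ {y} → Edge Γ w y → v ≢ y → d Γ v y ≡ 2
    two-away {y} ewy v≢y = ≤-antisym (≤-trans (d-step Γ y ev) (s≤s (d-edge≤1 Γ ewy)))
      (d-nonadj Γ v≢y (λ e → edge⇒≢ Γ ewy (deg≤1⇒≡ Γ one ev e)))
    small : ∀ e k {m} → suc m ≡ e + k → 2 ≤ e → 2 ≤ k → m ≤ tri k + (e ∸ 2)
    small (suc (suc e)) k refl _ 2≤k = ≤-trans (s≤s (≡≤ (+-comm e k))) (+-monoˡ-≤ e (tri≥suc 2≤k))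
    small 1 _ _ (s≤s ()) _

  rest-neighbour : ∀ {j} → m ≡ suc j → Σ (Fin (suc m)) λ y → Edge rest w′ y
  rest-neighbour refl = let y , e , _ = neighbour-toward rest {x = w′} {r = punchIn w′ fzero} (punchInᵢ≢i w′ fzero ∘ sym) in y , e

  rest-pendant : ¬ 3 ≤ deg Γ w → deg rest w′ ≤ 1
  rest-pendant ¬three = s≤s⁻¹ (≤-trans (≡≥ deg-w) (s≤s⁻¹ (≰⇒> ¬three)))

  rest-short : 4 ≤ m → ¬ 3 ≤ deg Γ w → Short rest
  rest-short 4≤m ¬three with short? rest
  ... | inj₁ s = s
  ... | inj₂ (_ , _ , long) = ⊥-elim (<⇒≱ (proj₁ (rest-chain 4≤m long)) (rest-pendant ¬three))

  -- With k = 2 and both extra vertices at the last level the deficit is exactly 3; the graph is then B1.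
  record Fork : Set where
    field
      k≡2 : k ≡ 2
      {x y} : Fin (2 + m)
      off-x : OffPath Γ geo x
      off-y : OffPath Γ geo y
      x≢y : x ≢ y
      level-x : d Γ v x ≡ e
      level-y : d Γ v y ≡ e

  deficit-3 : trans-sum Γ v + 3 ≤ tri (suc m)
  deficit-3 = ≤-trans (+-monoʳ-≤ (trans-sum Γ v) (≤-trans (s≤s 2≤k) (tri≥suc 2≤k))) (deficit₀ Γ P)

  -- `tri k` exceeds 3 as soon as k ≥ 3. For k = 2 it equals 3, and an extra vertex above the last
  -- level supplies the fourth unit.
  fork-or-deficit-4 : Fork ⊎ trans-sum Γ v + 4 ≤ tri (suc m)
  fork-or-deficit-4 with m≤n⇒m<n∨m≡n 2≤k
  ... | inj₁ 3≤k = inj₂ (≤-trans (+-monoʳ-≤ (trans-sum Γ v) (≤-trans (s≤s 3≤k) (tri≥suc 2≤k))) (deficit₀ Γ P))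
  ... | inj₂ 2≡k with extra Γ P (≤-trans (s≤s z≤n) 2≤k)
  ...   | x , offx with extra′ Γ P x 2≤k
  ...     | y , offy , x≢y = levels (d Γ v x ≟ e) (d Γ v y ≟ e)
    where
    gap : 1 ≤ (e ∸ d Γ v x) + (e ∸ d Γ v y) → trans-sum Γ v + 4 ≤ tri (suc m)
    gap 1≤ = ≤-trans (≡≤ (sym (+-assoc (trans-sum Γ v) 3 1)))
      (≤-trans (+-mono-≤ (+-monoʳ-≤ (trans-sum Γ v) (≤-trans (s≤s 2≤k) (tri≥suc 2≤k))) 1≤) (deficit₂ Γ P offx offy x≢y))
    levels : Dec (d Γ v x ≡ e) → Dec (d Γ v y ≡ e) → Fork ⊎ trans-sum Γ v + 4 ≤ tri (suc m)
    levels (yes lx) (yes ly) = inj₁ (record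
      { k≡2 = sym 2≡k ; off-x = offx ; off-y = offy ; x≢y = x≢y ; level-x = lx ; level-y = ly })
    levels (no lx) _ = inj₂ (gap (≤-trans (m<n⇒0<n∸m (≤∧≢⇒< (bounded x) lx)) (m≤m+n _ _)))
    levels _ (no ly) = inj₂ (gap (≤-trans (m<n⇒0<n∸m (≤∧≢⇒< (bounded y) ly)) (m≤n+m _ _)))

-- f ≥ 3n - 9. B1 satisfies this with equality, so it is no exception, and the bound passes down a
-- pendant path at a cost of δ ≥ 3 per vertex.
PendantBound : ℕ → Set
PendantBound n = ∀ (Γ : ConnectedGraph n) {v w} → Edge Γ v w → deg Γ v ≤ 1 → Short Γ → edges Γ ≡ suc n →
  Wiener Γ + 3 * n ≤ pathWiener n + 9

pendant-step : ∀ m → 3 ≤ m → (4 ≤ m → PendantBound (suc m)) → PendantBound (2 + m)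
pendant-step m 3≤m IH Γ {v} {w} ev one short count = split (3 ≤? deg Γ w) (4 ≤? m)
  where
  open Pendant Γ ev one short count
  base-bound = bicyclic-bound (suc m) rest (≡≥ rest-count)
  split : Dec (3 ≤ deg Γ w) → Dec (4 ≤ m) → Wiener Γ + 3 * (2 + m) ≤ pathWiener (2 + m) + 9
  split (yes three) _ = peel-bound (2 * suc m) 5 m 0 (3 * (2 + m)) 9 base-bound (+0ʳ (branching-deficit three))
      (≡≤ (residual m))
    where
    residual : ∀ m → 3 * (2 + m) + 5 ≡ 2 * suc m + m + 9
    residual m = solve (m ∷ [])
  split (no ¬three) (yes 4≤m) = peel-bound (3 * suc m) 9 3 0 (3 * (2 + m)) 9
    (IH 4≤m rest (proj₂ (rest-neighbour (sym (suc-pred m {{>-nonZero (≤-trans (s≤s z≤n) 3≤m)}})))) (rest-pendant ¬three)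
        (rest-short 4≤m ¬three) rest-count)
    (+0ʳ deficit-3) (≡≤ (residual m))
    where
    residual : ∀ m → 3 * (2 + m) + 9 ≡ 3 * suc m + 3 + 9
    residual m = solve (m ∷ [])
  -- Order 5 starts the induction: on the four remaining vertices 2n - 5 and 3n - 9 agree.
  split (no _) (no ¬4≤m) = peel-bound (2 * suc m) 5 3 0 (3 * (2 + m)) 9 base-bound (+0ʳ deficit-3)
    (subst (λ l → 3 * (2 + l) + 5 ≤ 2 * suc l + 3 + 9) (≤-antisym 3≤m (s≤s⁻¹ (≰⇒> ¬4≤m))) ≤-refl)

pendant-bound : ∀ m → PendantBound (5 + m)
pendant-bound zero = pendant-step 3 ≤-refl (λ { (s≤s (s≤s (s≤s ()))) })
pendant-bound (suc m) = pendant-step (4 + m) (s≤s (s≤s (s≤s z≤n))) (λ _ → pendant-bound m)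

module _ {m} (Γ : ConnectedGraph (6 + m)) {v w} (ev : Edge Γ v w) (one : deg Γ v ≤ 1) (short : Short Γ)
    (count : edges Γ ≡ 7 + m) where
  open Pendant Γ ev one short count

  -- The unit beyond 3n - 9 has three sources. If w branches and the rest is short, f(rest) is one
  -- larger; if w branches and the rest is long, δ is one larger; if w does not branch, δ ≥ 4
  -- replaces δ ≥ 3.
  pendant-bound⁺ : Fork ⊎ Wiener Γ + 3 * (6 + m) ≤ pathWiener (6 + m) + 8
  pendant-bound⁺ with 3 ≤? deg Γ w | fork-or-deficit-4 | short? rest
  ... | _ | inj₁ fork | _ = inj₁ fork
  ... | yes three | inj₂ _ | inj₁ short′ = inj₂ (peel-bound (2 * (5 + m)) 4 (4 + m) 0 (3 * (6 + m)) 8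
      (short-bound rest short′ (≡≥ rest-count) (s≤s (s≤s (s≤s z≤n)))) (+0ʳ (branching-deficit three)) (≡≤ (residual m)))
    where
    residual : ∀ m → 3 * (6 + m) + 4 ≡ 2 * (5 + m) + (4 + m) + 8
    residual m = solve (m ∷ [])
  ... | yes three | inj₂ _ | inj₂ (_ , _ , long) = inj₂ (peel-bound (2 * (5 + m)) 5 (5 + m) 0 (3 * (6 + m)) 8
      (bicyclic-bound (5 + m) rest (≡≥ rest-count)) (+0ʳ (proj₂ (rest-chain (s≤s (s≤s (s≤s (s≤s z≤n)))) long)))
          (≡≤ (residual m)))
    where
    residual : ∀ m → 3 * (6 + m) + 5 ≡ 2 * (5 + m) + (5 + m) + 8
    residual m = solve (m ∷ [])
  ... | no ¬three | inj₂ def | _ = inj₂ (peel-bound (3 * (5 + m)) 9 4 0 (3 * (6 + m)) 8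
      (pendant-bound m rest (proj₂ (rest-neighbour refl)) (rest-pendant ¬three) (rest-short (s≤s (s≤s (s≤s (s≤s z≤n))))
          ¬three) rest-count)
      (+0ʳ def) (≡≤ (residual m)))
    where
    residual : ∀ m → 3 * (6 + m) + 9 ≡ 3 * (5 + m) + 4 + 8
    residual m = solve (m ∷ [])

-- Minimum degree two

every : (Bool → Bool) → Bool
every f = f true ∧ f false

every-elim : ∀ (f : Bool → Bool) → T (every f) → ∀ b → T (f b)
every-elim f h true = proj₁ (Equivalence.to T-∧ h)
every-elim f h false = proj₂ (Equivalence.to (T-∧ {f true}) h)

-- Six vertices v, p₁, p₂, z, a, c (numbered 0 to 5) around the hexagon v p₁ p₂ z c a, of which the edge a c may be missing.
-- The five undecided pairs are the parameters: α = p₁a, β = p₁c, γ = p₂a, δ = ac, ε = p₂c.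
module Hexagon (Γ : ConnectedGraph 6) (q : ℕ → Fin 6) (inj : InjectiveBelow 6 q) (short : Short Γ) (count : edges Γ ≡ 7)
  (e₀₁ : Edge Γ (q 0) (q 1)) (e₁₂ : Edge Γ (q 1) (q 2)) (e₂₃ : Edge Γ (q 2) (q 3)) (e₀₄ : Edge Γ (q 0) (q 4))
      (e₃₅ : Edge Γ (q 3) (q 5))
  (n₀₂ : ¬ Edge Γ (q 0) (q 2)) (n₀₃ : ¬ Edge Γ (q 0) (q 3)) (n₁₃ : ¬ Edge Γ (q 1) (q 3)) (n₀₅ : ¬ Edge Γ (q 0) (q 5))
      (n₃₄ : ¬ Edge Γ (q 3) (q 4))
  (c-parent : Edge Γ (q 1) (q 5) ⊎ Edge Γ (q 4) (q 5))
  (a-neighbour : Edge Γ (q 1) (q 4) ⊎ Edge Γ (q 2) (q 4) ⊎ Edge Γ (q 4) (q 5))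
  (c₅₀ : d Γ (q 0) (q 5) ≤ 2) where

  adjacency : Bool → Bool → Bool → Bool → Bool → ℕ → ℕ → Bool
  adjacency α β γ δ ε 0 1 = true
  adjacency α β γ δ ε 0 4 = true
  adjacency α β γ δ ε 1 2 = true
  adjacency α β γ δ ε 2 3 = true
  adjacency α β γ δ ε 3 5 = true
  adjacency α β γ δ ε 1 4 = α
  adjacency α β γ δ ε 1 5 = β
  adjacency α β γ δ ε 2 4 = γ
  adjacency α β γ δ ε 4 5 = δ
  adjacency α β γ δ ε 2 5 = ε
  adjacency α β γ δ ε _ _ = false

  -- Bounds a distance by 1 for an edge and by 2 for a known common neighbour; otherwise 3, the
  -- bound from shortness at n = 6.
  grade : Bool → Bool → ℕ
  grade near mid = if near then 1 else if mid then 2 else 3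

  bound : Bool → Bool → Bool → Bool → Bool → ℕ → ℕ → ℕ
  bound α β γ δ ε 0 1 = 1
  bound α β γ δ ε 0 2 = 2
  bound α β γ δ ε 0 4 = 1
  bound α β γ δ ε 0 5 = 2
  bound α β γ δ ε 1 2 = 1
  bound α β γ δ ε 1 3 = 2
  bound α β γ δ ε 2 3 = 1
  bound α β γ δ ε 3 5 = 1
  bound α β γ δ ε 1 4 = grade α true
  bound α β γ δ ε 1 5 = grade β ((α ∧ δ) ∨ ε)
  bound α β γ δ ε 2 4 = grade γ (α ∨ (ε ∧ δ))
  bound α β γ δ ε 4 5 = grade δ ((α ∧ β) ∨ (γ ∧ ε))
  bound α β γ δ ε 2 5 = grade ε true
  bound α β γ δ ε 3 4 = grade false (γ ∨ δ)
  bound α β γ δ ε _ _ = 3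

  implies : Bool → Bool → Bool
  implies true b = b
  implies false b = true

  -- The premises are the edge count, a parent of c at level 1, and a neighbour of a other than v.
  -- The constant is 25 = 35 + 8 - 3·6, with 35 the Wiener index of the path on six vertices.
  check : Bool → Bool → Bool → Bool → Bool → Bool
  check α β γ δ ε = implies ((pairSum 6 (λ i k → ind (adjacency α β γ δ ε i k)) ≡ᵇ 7) ∧ ((β ∨ δ) ∧ (α ∨ (γ ∨ δ))))
    (pairSum 6 (bound α β γ δ ε) ≤ᵇ 25)

  -- All 32 assignments are evaluated at once in the innermost `tt`.
  checked : ∀ α β γ δ ε → T (check α β γ δ ε)
  checked α β γ δ ε =
    every-elim (check α β γ δ) (every-elim (λ δ → every (check α β γ δ)) (every-elim (λ γ → every λ δ → every (check α β γ δ))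
      (every-elim (λ β → every λ γ → every λ δ → every (check α β γ δ))
        (every-elim (λ α → every λ β → every λ γ → every λ δ → every (check α β γ δ)) tt α) β) γ) δ) ε

  implies-elim : ∀ {a b} → T (implies a b) → T a → T b
  implies-elim {true} h _ = h

  adj-true : ∀ {i k} → Edge Γ (q i) (q k) → adj Γ (q i) (q k) ≡ true
  adj-true = Equivalence.to T-≡

  adj-false : ∀ {i k} → ¬ Edge Γ (q i) (q k) → adj Γ (q i) (q k) ≡ false
  adj-false {i} {k} h with adj Γ (q i) (q k)
  ... | true = ⊥-elim (h tt)
  ... | false = refl

  α β γ δ ε : Bool
  α = adj Γ (q 1) (q 4)
  β = adj Γ (q 1) (q 5)
  γ = adj Γ (q 2) (q 4)
  δ = adj Γ (q 4) (q 5)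
  ε = adj Γ (q 2) (q 5)

  adjacency-correct : ∀ i k → i < k → k < 6 → adj Γ (q i) (q k) ≡ adjacency α β γ δ ε i k
  adjacency-correct 0 1 _ _ = adj-true {0} {1} e₀₁
  adjacency-correct 0 2 _ _ = adj-false {0} {2} n₀₂
  adjacency-correct 0 3 _ _ = adj-false {0} {3} n₀₃
  adjacency-correct 0 4 _ _ = adj-true {0} {4} e₀₄
  adjacency-correct 0 5 _ _ = adj-false {0} {5} n₀₅
  adjacency-correct 1 2 _ _ = adj-true {1} {2} e₁₂
  adjacency-correct 1 3 _ _ = adj-false {1} {3} n₁₃
  adjacency-correct 1 4 _ _ = refl
  adjacency-correct 1 5 _ _ = refl
  adjacency-correct 2 3 _ _ = adj-true {2} {3} e₂₃
  adjacency-correct 2 4 _ _ = refl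
  adjacency-correct 2 5 _ _ = refl
  adjacency-correct 3 4 _ _ = adj-false {3} {4} n₃₄
  adjacency-correct 3 5 _ _ = adj-true {3} {5} e₃₅
  adjacency-correct 4 5 _ _ = refl
  adjacency-correct (suc _) 1 (s≤s ()) _
  adjacency-correct (suc (suc _)) 2 (s≤s (s≤s ())) _
  adjacency-correct (suc (suc (suc _))) 3 (s≤s (s≤s (s≤s ()))) _
  adjacency-correct (suc (suc (suc (suc _)))) 4 (s≤s (s≤s (s≤s (s≤s ())))) _
  adjacency-correct (suc (suc (suc (suc (suc _))))) 5 (s≤s (s≤s (s≤s (s≤s (s≤s ()))))) _
  adjacency-correct _ (suc (suc (suc (suc (suc (suc _)))))) _ (s≤s (s≤s (s≤s (s≤s (s≤s (s≤s ()))))))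

  two : ∀ {u w} x → Edge Γ u x → Edge Γ x w → d Γ u w ≤ 2
  two {u} {w} x e e′ = ≤-trans (d-step Γ w e) (s≤s (d-edge≤1 Γ e′))

  ≤3 : ∀ u w → d Γ u w ≤ 3
  ≤3 u w = s≤s⁻¹ (s≤s⁻¹ (s≤s⁻¹ (short u w)))

  grade-≤ : ∀ {u w} near mid → (T near → Edge Γ u w) → (T mid → d Γ u w ≤ 2) → d Γ u w ≤ grade near mid
  grade-≤ true mid h _ = d-edge≤1 Γ (h tt)
  grade-≤ false true _ h = h tt
  grade-≤ {u} {w} false false _ _ = ≤3 u w

  via : ∀ {u w} x y {a b a′ b′} → (T a → Edge Γ u x) → (T b → Edge Γ x w) → (T a′ → Edge Γ u y) → (T b′ → Edge Γ y w) →
    T ((a ∧ b) ∨ (a′ ∧ b′)) → d Γ u w ≤ 2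
  via x y {a} {b} {a′} {b′} f g f′ g′ h with Equivalence.to (T-∨ {a ∧ b}) h
  ... | inj₁ ab = let ta , tb = Equivalence.to (T-∧ {a}) ab in two x (f ta) (g tb)
  ... | inj₂ ab = let ta , tb = Equivalence.to (T-∧ {a′}) ab in two y (f′ ta) (g′ tb)

  es : ∀ {u w} → Edge Γ u w → Edge Γ w u
  es = edge-sym Γ

  bound-correct : ∀ i k → i < k → k < 6 → d Γ (q i) (q k) ≤ bound α β γ δ ε i k
  bound-correct 0 1 _ _ = d-edge≤1 Γ e₀₁
  bound-correct 0 2 _ _ = two (q 1) e₀₁ e₁₂
  bound-correct 0 3 _ _ = ≤3 (q 0) (q 3)
  bound-correct 0 4 _ _ = d-edge≤1 Γ e₀₄
  bound-correct 0 5 _ _ = c₅₀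
  bound-correct 1 2 _ _ = d-edge≤1 Γ e₁₂
  bound-correct 1 3 _ _ = two (q 2) e₁₂ e₂₃
  bound-correct 1 4 _ _ = grade-≤ α true id (λ _ → two (q 0) (es e₀₁) e₀₄)
  bound-correct 1 5 _ _ = grade-≤ β ((α ∧ δ) ∨ ε) id (λ h → via (q 4) (q 2) {α} {δ} {true} {ε} id id (λ _ → e₁₂) id h)
  bound-correct 2 3 _ _ = d-edge≤1 Γ e₂₃
  bound-correct 2 4 _ _ = grade-≤ γ (α ∨ (ε ∧ δ)) id (λ h → via (q 1) (q 5) {true} {α} {ε} {δ} (λ _ → es e₁₂) id id es h)
  bound-correct 2 5 _ _ = grade-≤ ε true id (λ _ → two (q 3) e₂₃ e₃₅)
  bound-correct 3 4 _ _ = grade-≤ false (γ ∨ δ) (λ ()) (λ h → via (q 2) (q 5) {true} {γ} {true} {δ} (λ _ → es e₂₃) id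
      (λ _ → e₃₅) es h)
  bound-correct 3 5 _ _ = d-edge≤1 Γ e₃₅
  bound-correct 4 5 _ _ = grade-≤ δ ((α ∧ β) ∨ (γ ∧ ε)) id (λ h → via (q 1) (q 2) {α} {β} {γ} {ε} es id es id h)
  bound-correct (suc _) 1 (s≤s ()) _
  bound-correct (suc (suc _)) 2 (s≤s (s≤s ())) _
  bound-correct (suc (suc (suc _))) 3 (s≤s (s≤s (s≤s ()))) _
  bound-correct (suc (suc (suc (suc _)))) 4 (s≤s (s≤s (s≤s (s≤s ())))) _
  bound-correct (suc (suc (suc (suc (suc _))))) 5 (s≤s (s≤s (s≤s (s≤s (s≤s ()))))) _
  bound-correct _ (suc (suc (suc (suc (suc (suc _)))))) _ (s≤s (s≤s (s≤s (s≤s (s≤s (s≤s ()))))))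

  seven : T (pairSum 6 (λ i k → ind (adjacency α β γ δ ε i k)) ≡ᵇ 7)
  seven = ≡⇒≡ᵇ _ 7 (trans (sym (pairSum-cong 6 λ i k i<k k<6 → cong ind (adjacency-correct i k i<k k<6)))
      (trans (sym (edges≡pairSum Γ q inj)) count))

  either : T (β ∨ δ)
  either = Equivalence.from T-∨ c-parent

  some : T (α ∨ (γ ∨ δ))
  some = Equivalence.from (T-∨ {α}) ([ inj₁ , (λ h → inj₂ (Equivalence.from (T-∨ {γ}) h)) ]′ a-neighbour)

  hexagon-bound : Wiener Γ ≤ 25
  hexagon-bound = ≤-trans (≡≤ (Wiener≡pairSum Γ q inj)) (≤-trans (pairSum-mono 6 bound-correct)
    (≤ᵇ⇒≤ _ 25 (implies-elim (checked α β γ δ ε) (Equivalence.from (T-∧ {pairSum 6 (λ i k → ind (adjacency α β γ δ ε i k))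
        ≡ᵇ 7}) (seven , Equivalence.from (T-∧ {β ∨ δ}) (either , some))))))

-- The Wiener index of B1 n is pathWiener n − 3n + 9.
TightBound : ∀ {m} → ConnectedGraph (6 + m) → Set
TightBound {m} Γ = Wiener Γ + 3 * (6 + m) ≤ pathWiener (6 + m) + 8

hexagon-bound₀ : ∀ {m} (Γ : ConnectedGraph (6 + m)) → Short Γ → edges Γ ≡ 7 + m → (q : ℕ → Fin (6 + m)) → m ≡ 0 →
    InjectiveBelow 6 q →
  Edge Γ (q 0) (q 1) → Edge Γ (q 1) (q 2) → Edge Γ (q 2) (q 3) → Edge Γ (q 0) (q 4) → Edge Γ (q 3) (q 5) →
  ¬ Edge Γ (q 0) (q 2) → ¬ Edge Γ (q 0) (q 3) → ¬ Edge Γ (q 1) (q 3) → ¬ Edge Γ (q 0) (q 5) → ¬ Edge Γ (q 3) (q 4) →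
  Edge Γ (q 1) (q 5) ⊎ Edge Γ (q 4) (q 5) → Edge Γ (q 1) (q 4) ⊎ Edge Γ (q 2) (q 4) ⊎ Edge Γ (q 4) (q 5) →
  d Γ (q 0) (q 5) ≤ 2 → Wiener Γ ≤ 25
hexagon-bound₀ Γ short count q refl inj e₀₁ e₁₂ e₂₃ e₀₄ e₃₅ n₀₂ n₀₃ n₁₃ n₀₅ n₃₄ cp an c₅₀ =
  Hexagon.hexagon-bound Γ q inj short count e₀₁ e₁₂ e₂₃ e₀₄ e₃₅ n₀₂ n₀₃ n₁₃ n₀₅ n₃₄ cp an c₅₀

module _ {m} (Γ : ConnectedGraph (6 + m)) (short : Short Γ) (count : edges Γ ≡ 7 + m) (deg≥2 : ∀ u → 2 ≤ deg Γ u)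
  {v} (v≤2 : deg Γ v ≤ 2) (P : Periphery Γ v) where
  open Periphery P

  module _ {a x} (ea : Edge Γ v a) (p₁≢a : path 1 ≢ a) (lx : d Γ v x ≡ 2) (p₂≢x : path 2 ≢ x) (k≡2 : k ≡ 2) where

    private
      offa : OffPath Γ geo a
      offa = off-neighbour Γ P ea p₁≢a

      offx : OffPath Γ geo x
      offx = offPath Γ geo lx p₂≢x

      la : d Γ v a ≡ 1
      la = d-edge Γ ea

      a≢x : a ≢ x
      a≢x eq = case trans (sym la) (trans (cong (d Γ v) eq) lx) of λ ()

      e≡3+m : e ≡ 3 + m
      e≡3+m = +-cancelʳ-≡ 2 e (3 + m) (trans (cong (e +_) (sym k≡2)) (trans (sym size) (+-comm 2 (3 + m))))

      second-last : Σ (Fin (6 + m)) λ y → Edge Γ (path e) y × path (e ∸ 1) ≢ y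
      second-last = second-neighbour Γ (path (e ∸ 1)) (deg≥2 (path e))

    -- The last vertex needs a second neighbour, and it can only be a or x. Their levels 1 and 2 are
    -- too low for it unless e = 3, so n = 6 and the neighbour is x.
    last~x : m ≡ 0 × Edge Γ (path e) x
    last~x with second-last
    ... | y , ey , p≢y with vertices Γ P k≡2 offa offx a≢x y
    ...   | inj₂ (inj₁ refl) = ⊥-elim (<⇒≱ (s≤s (s≤s (s≤s (z≤n {m})))) (≤-trans (≡≥ e≡3+m)
        (≤-trans (nbr-level-≤ Γ geo ≤-refl ey) (≡≤ (cong suc la)))))
    ...   | inj₂ (inj₂ refl) = n≤0⇒n≡0 (+-cancelˡ-≤ 3 m 0 (≤-trans (≡≥ e≡3+m) (≤-trans (nbr-level-≤ Γ geo ≤-refl ey)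
        (≡≤ (cong suc lx))))) , ey
    ...   | inj₁ (i , i≤e , refl) with m≤n⇒m<n∨m≡n i≤e
    ...     | inj₂ refl = ⊥-elim (edge⇒≢ Γ ey refl)
    ...     | inj₁ i<e = ⊥-elim (p≢y (cong path (≤-antisym (pred-mono-≤ (≤-trans (nbr-level-≤ Γ geo ≤-refl ey)
        (≡≤ (cong suc (level i i≤e))))) (pred-mono-≤ i<e))))

    hexagon-case : Wiener Γ + 18 ≤ 43 × m ≡ 0
    hexagon-case = hex (proj₁ last~x) , proj₁ last~x
      where
      hex : m ≡ 0 → Wiener Γ + 18 ≤ 43
      hex m≡0 = +-monoˡ-≤ 18 (hexagon-bound₀ Γ short count (path ⟨ 4 ⟩▹ a ⟨ 5 ⟩▹ x) m≡0
        (subst (λ e → InjectiveBelow (3 + e) (path ⟨ suc e ⟩▹ a ⟨ 2 + e ⟩▹ x)) e≡3 (two-injective Γ P offa offx a≢x))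
        (edge 0 (pe 1)) (edge 1 (pe 2)) (edge 2 (pe 3)) (subst (λ u → Edge Γ u a) (sym start) ea)
        (subst (λ j → Edge Γ (path j) x) e≡3 (proj₂ last~x))
        (no-chord 0 2 (s≤s (s≤s z≤n)) z≤n (pe 2)) (no-chord 0 3 (s≤s (s≤s z≤n)) z≤n (pe 3)) (no-chord 1 3
            (s≤s (s≤s (s≤s z≤n))) (pe 1) (pe 3))
        (λ e₀₅ → <⇒≱ (s≤s (s≤s z≤n)) (≤-trans (≡≥ lx) (nbr-level-≥ Γ geo z≤n e₀₅)))
        (λ e₃₄ → <⇒≱ (s≤s (s≤s (s≤s z≤n))) (≤-trans (nbr-level-≤ Γ geo (pe 3) e₃₄) (≡≤ (cong suc la))))
        parent neighbour (≤-trans (≡≤ (cong (λ u → d Γ u x) start)) (≡≤ lx)))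
        where
        e≡3 : e ≡ 3
        e≡3 = trans e≡3+m (cong (3 +_) m≡0)
        pe : ∀ i {_ : T (i ≤ᵇ 3)} → i ≤ e
        pe i {h} = ≤-trans (≤ᵇ⇒≤ i 3 h) (≡≥ e≡3)
        no-chord : ∀ i j → suc i < j → i ≤ e → j ≤ e → ¬ Edge Γ (path i) (path j)
        no-chord i j gap i≤e j≤e h = <⇒≱ gap (≤-trans (≡≥ (level j j≤e)) (nbr-level-≥ Γ geo i≤e h))
        parent : Edge Γ (path 1) x ⊎ Edge Γ a x
        parent with d-next Γ {x} {v} {1} (trans (d-sym Γ x v) lx)
        ... | y , exy , ly with deg≤2⇒≡ Γ v≤2 p₁≢a (first-edge Γ P (pe 1)) ea (edge-sym Γ (d≡1⇒edge Γ ly))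
        ...   | inj₁ refl = inj₁ (edge-sym Γ exy)
        ...   | inj₂ refl = inj₂ (edge-sym Γ exy)
        neighbour : Edge Γ (path 1) a ⊎ Edge Γ (path 2) a ⊎ Edge Γ a x
        neighbour with second-neighbour Γ {a} v (deg≥2 a)
        ... | y , eay , v≢y with vertices Γ P k≡2 offa offx a≢x y
        ...   | inj₂ (inj₁ refl) = ⊥-elim (edge⇒≢ Γ eay refl)
        ...   | inj₂ (inj₂ refl) = inj₂ (inj₂ eay)
        ...   | inj₁ (0 , _ , eq) = ⊥-elim (v≢y (trans (sym start) eq))
        ...   | inj₁ (1 , _ , refl) = inj₁ (edge-sym Γ eay)
        ...   | inj₁ (2 , _ , refl) = inj₂ (inj₁ (edge-sym Γ eay))
        ...   | inj₁ (suc (suc (suc i)) , i≤e , refl) = ⊥-elim (<⇒≱ (s≤s (s≤s (s≤s (z≤n {i}))))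
            (≤-trans (nbr-level-≤ Γ geo i≤e (edge-sym Γ eay)) (≡≤ (cong suc la))))

    tight-hexagon : TightBound Γ
    tight-hexagon = let h , m≡0 = hexagon-case in transport m≡0 (Wiener Γ) h
      where
      transport : ∀ {m} → m ≡ 0 → ∀ w → w + 18 ≤ 43 → w + 3 * (6 + m) ≤ pathWiener (6 + m) + 8
      transport refl w h = h

module NoPendant {m} (Γ : ConnectedGraph (6 + m)) (short : Short Γ) (count : edges Γ ≡ 7 + m) (deg≥2 : ∀ u → 2 ≤ deg Γ u) where

  -- Besides the second neighbour of v, one of c and c′ is off the geodesic, at level 2. For k ≥ 3
  -- this gives δ ≥ 2n - 5, which with f(rest) ≥ n - 3 makes 3n - 8; k = 2 leaves the hexagon.
  two-level : ∀ {v} → Noncut Γ v → deg Γ v ≤ 2 → ∀ {c c′} → c ≢ c′ → d Γ v c ≡ 2 → d Γ v c′ ≡ 2 → TightBound Γ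
  two-level {v} nc v≤2 {c} {c′} c≢c′ lc lc′ with second-neighbour Γ (Periphery.path (periphery Γ v) 1) (deg≥2 v)
  ... | a , ea , p₁≢a = pick (path 2 ≟F c)
    where
    P = periphery Γ v
    open Periphery P
    open Peeled (peel Γ nc)
    la : d Γ v a ≡ 1
    la = d-edge Γ ea
    2≤e : 2 ≤ e
    2≤e = ≤-trans (≡≥ lc) (bounded c)
    with-extra : ∀ x → d Γ v x ≡ 2 → path 2 ≢ x → TightBound Γ
    with-extra x lx p₂≢x with m≤n⇒m<n∨m≡n (short⇒2≤k short P)
    ... | inj₂ 2≡k = tight-hexagon Γ short count deg≥2 v≤2 P ea p₁≢a lx p₂≢x (sym 2≡k)
    ... | inj₁ 3≤k = peel-bound (5 + m) 2 (7 + 2 * m) 0 (3 * (6 + m)) 8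
      (unicyclic-bound (5 + m) rest (fewer-edges (5 + m) 2 (≡≥ count) v≤2))
      (+0ʳ (≤-trans (+-monoʳ-≤ (trans-sum Γ v) (small e k size 2≤e 3≤k)) (≤-trans (≡≥ (+-assoc (trans-sum Γ v) _ _))
        (subst₂ (λ l l′ → trans-sum Γ v + tri k + ((e ∸ l) + (e ∸ l′)) ≤ tri (5 + m)) la lx (deficit₂ Γ P
          (off-neighbour Γ P ea p₁≢a) (offPath Γ geo lx p₂≢x) (λ eq → case trans (sym la) (trans (cong (d Γ v) eq) lx) of
              λ ()))))))
      (≡≤ (residual m))
      where
      residual : ∀ m → 3 * (6 + m) + 2 ≡ 5 + m + (7 + 2 * m) + 8
      residual m = solve (m ∷ [])
      small : ∀ e k {m} → 5 + m ≡ e + k → 2 ≤ e → 3 ≤ k → 7 + 2 * m ≤ tri k + ((e ∸ 1) + (e ∸ 2))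
      small (suc (suc e)) (suc (suc (suc k))) {m} eq _ _ = ≤-trans
        (≡≤ (trans (cong (λ l → 7 + 2 * l) (+-cancelˡ-≡ 5 m (e + k) (trans eq (shift e k)))) (certificate e k)))
            (+-monoˡ-≤ (suc e + e) (tri≥2k k))
        where
        shift : ∀ e k → 2 + e + (3 + k) ≡ 5 + (e + k)
        shift e k = solve (e ∷ k ∷ [])
        certificate : ∀ e k → 7 + 2 * (e + k) ≡ 2 * (3 + k) + (suc e + e)
        certificate e k = solve (e ∷ k ∷ [])
      small _ 1 _ _ (s≤s ())
      small _ 2 _ _ (s≤s (s≤s ()))
      small 1 _ _ (s≤s ()) _
    pick : Dec (path 2 ≡ c) → TightBound Γ
    pick (yes refl) = with-extra c′ lc′ c≢c′
    pick (no p₂≢c) = with-extra c lc p₂≢c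

-- A triangle v a b attached to the rest of the graph at b only; c witnesses that b has degree at
-- least 3.
record Hanging {n} (Γ : ConnectedGraph n) (v : Fin n) : Set where
  field
    {a b c} : Fin n
    va : Edge Γ v a
    vb : Edge Γ v b
    ab : Edge Γ a b
    v≤2 : deg Γ v ≤ 2
    a≤2 : deg Γ a ≤ 2
    bc : Edge Γ b c
    v≢c : v ≢ c
    a≢c : a ≢ c

  v≢a : v ≢ a
  v≢a = edge⇒≢ Γ va
  v≢b : v ≢ b
  v≢b = edge⇒≢ Γ vb
  a≢b : a ≢ b
  a≢b = edge⇒≢ Γ ab
  3≤b : 3 ≤ deg Γ b
  3≤b = 3≤deg Γ v≢a v≢c a≢c (edge-sym Γ vb) (edge-sym Γ ab) bc
  v-neighbours : ∀ {y} → Edge Γ v y → y ≡ a ⊎ y ≡ b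
  v-neighbours = deg≤2⇒≡ Γ v≤2 a≢b va vb
  a-neighbours : ∀ {y} → Edge Γ a y → y ≡ v ⊎ y ≡ b
  a-neighbours = deg≤2⇒≡ Γ a≤2 v≢b (edge-sym Γ va) ab

module Excess {m} (Γ : ConnectedGraph (6 + m)) (count : edges Γ ≡ 7 + m) (deg≥2 : ∀ u → 2 ≤ deg Γ u) where

  -- Handshake: 2(n + 1) - 2n = 2. Either one vertex has degree 4, or two have degree 3, and all
  -- others have degree 2.
  excess : sumFin (λ u → deg Γ u ∸ 2) ≡ 2
  excess = +-cancelˡ-≡ ((6 + m) * 2) _ 2 (trans (cong (_+ sumFin (λ u → deg Γ u ∸ 2)) (sym (sumFin-const (6 + m) 2)))
    (trans (sym (sumFin-+ {6 + m} (λ _ → 2) (λ u → deg Γ u ∸ 2)))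
      (trans (sumFin-cong (λ u → m+[n∸m]≡n (deg≥2 u))) (trans (handshake Γ) (trans (cong (2 *_) count) (twice m))))))
    where
    twice : ∀ m → 2 * (7 + m) ≡ (6 + m) * 2 + 2
    twice m = solve (m ∷ [])

  excess-≤ : ∀ K q → InjectiveBelow K q → sumTo K (λ i → deg Γ (q i) ∸ 2) ≤ 2
  excess-≤ K q inj = ≤-trans (sumTo≤sumFin K q inj (λ u → deg Γ u ∸ 2)) (≡≤ excess)

  no-three : ∀ {a b c} → a ≢ b → a ≢ c → b ≢ c → 3 ≤ deg Γ a → 3 ≤ deg Γ b → 3 ≤ deg Γ c → ⊥
  no-three a≢b a≢c b≢c ha hb hc = <⇒≱ (s≤s (s≤s (s≤s z≤n))) (≤-trans
    (∸-monoˡ-≤ 2 ha ⊹ ∸-monoˡ-≤ 2 hb ⊹ ∸-monoˡ-≤ 2 hc) (≤-trans (≡≤ (sym (+-assoc (deg Γ _ ∸ 2) _ _))) (excess-≤ 3 _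
        (triple-injective Γ a≢b a≢c b≢c))))

  excess₂ : ∀ {a b} → a ≢ b → (deg Γ a ∸ 2) + (deg Γ b ∸ 2) ≤ 2
  excess₂ a≢b = excess-≤ 2 _ (pair-injective Γ a≢b)

  others≤2 : ∀ {a b x} → a ≢ b → 3 ≤ deg Γ a → 3 ≤ deg Γ b → a ≢ x → b ≢ x → deg Γ x ≤ 2
  others≤2 {x = x} a≢b ha hb a≢x b≢x with 3 ≤? deg Γ x
  ... | yes hx = ⊥-elim (no-three a≢b a≢x b≢x ha hb hx)
  ... | no ¬hx = s≤s⁻¹ (≰⇒> ¬hx)

  at-most-3 : ∀ {a b} → a ≢ b → 3 ≤ deg Γ b → deg Γ a ≤ 3
  at-most-3 {a} a≢b hb with 4 ≤? deg Γ a
  ... | yes ha = ⊥-elim (<⇒≱ (s≤s (s≤s (s≤s z≤n))) (≤-trans (∸-monoˡ-≤ 2 ha ⊹ ∸-monoˡ-≤ 2 hb) (excess₂ a≢b)))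
  ... | no ¬ha = s≤s⁻¹ (≰⇒> ¬ha)

  deg≤4 : ∀ a → deg Γ a ≤ 4
  deg≤4 a = ≤-trans (m≤n+m∸n (deg Γ a) 2) (+-monoʳ-≤ 2 (excess-≤ 1 (λ _ → a) λ { .0 .0 (s≤s z≤n) (s≤s z≤n) _ → refl }))

  -- A farthest vertex is deletable but may have large degree, in which case one of its neighbours
  -- serves. `near-far` keeps u close to a farthest vertex, which later separates it from a triangle
  -- at r.
  record LowNoncut (r : Fin (6 + m)) : Set where
    field
      {f u} : Fin (6 + m)
      far : ∀ w → d Γ r w ≤ d Γ r f
      near-far : u ≡ f ⊎ Edge Γ f u
      u≢r : u ≢ r
      u≤2 : deg Γ u ≤ 2
      noncut : Noncut Γ u

  -- Suppose the farthest vertex f has degree at least 3. Besides the neighbour z nearer to r it has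
  -- two more, and by the excess one of them, y, has degree 2. Only f could use y on its way to r,
  -- since y is itself nearer to r than f or equally far.
  findLowNoncut : ∀ r → LowNoncut r
  findLowNoncut r with farthest Γ r
  ... | f , r≢f , far with deg Γ f ≤? 2
  ...   | yes f≤2 = record { far = far ; near-far = inj₁ refl ; u≢r = r≢f ∘ sym ; u≤2 = f≤2 ; noncut =
      farthest-noncut Γ r≢f far }
  ...   | no f≰2 = choose
    where
    3≤f : 3 ≤ deg Γ f
    3≤f = ≰⇒> f≰2
    toward = neighbour-toward Γ (r≢f ∘ sym)
    z = proj₁ toward
    fz = proj₁ (proj₂ toward)
    dz : d Γ z r < d Γ f r
    dz = proj₂ (proj₂ toward)
    far′ : ∀ w → d Γ w r ≤ d Γ f r
    far′ w = subst₂ _≤_ (d-sym Γ r w) (d-sym Γ r f) (far w)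
    found : ∀ y → Edge Γ f y → z ≢ y → deg Γ y ≤ 2 → LowNoncut r
    found y fy z≢y y≤2 = record { far = far ; near-far = inj₂ fy ; u≢r = y≢r ; u≤2 = y≤2 ; noncut = r , y≢r ∘ sym , avoid }
      where
      y≢r : y ≢ r
      y≢r refl = z≢y (d≡0⇒≡ Γ (n≤0⇒n≡0 (s≤s⁻¹ (≤-trans dz (d-edge≤1 Γ fy)))))
      t = proj₁ (neighbour-toward Γ y≢r)
      yt = proj₁ (proj₂ (neighbour-toward Γ y≢r))
      dt : d Γ t r < d Γ y r
      dt = proj₂ (proj₂ (neighbour-toward Γ y≢r))
      f≢t : f ≢ t
      f≢t eq = <⇒≱ dt (subst (λ x → d Γ y r ≤ d Γ x r) eq (far′ y))
      avoid : ∀ x → x ≢ y → x ≢ r → Σ (Fin (6 + m)) λ x′ → x′ ≢ y × Edge Γ x x′ × d Γ x′ r < d Γ x r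
      avoid x x≢y x≢r with neighbour-toward Γ x≢r
      ... | x′ , e , lt with x′ ≟F y
      ...   | no x′≢y = x′ , x′≢y , e , lt
      ...   | yes refl with deg≤2⇒≡ Γ y≤2 f≢t (edge-sym Γ fy) yt (edge-sym Γ e)
      -- The detour around y: f descends through z.
      ...     | inj₁ refl = z , z≢y , fz , dz
      ...     | inj₂ refl = ⊥-elim (<-asym dt lt)
    choose : LowNoncut r
    choose with second-neighbour Γ z (<⇒≤ 3≤f)
    ... | y₁ , e₁ , z≢y₁ with third-neighbour Γ z y₁ 3≤f
    ...   | y₂ , e₂ , z≢y₂ , y₁≢y₂ with deg Γ y₁ ≤? 2 | deg Γ y₂ ≤? 2
    ...     | yes low | _ = found y₁ e₁ z≢y₁ low
    ...     | no _ | yes low = found y₂ e₂ z≢y₂ low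
    ...     | no h₁ | no h₂ = ⊥-elim (no-three (edge⇒≢ Γ e₁) (edge⇒≢ Γ e₂) y₁≢y₂ 3≤f (≰⇒> h₁) (≰⇒> h₂))

  opaque
    lowNoncut : ∀ r → LowNoncut r
    lowNoncut = findLowNoncut

module Local {m} (Γ : ConnectedGraph (6 + m)) (short : Short Γ) (count : edges Γ ≡ 7 + m) (deg≥2 : ∀ u → 2 ≤ deg Γ u) where
  open NoPendant Γ short count deg≥2
  open Excess Γ count deg≥2

  module _ {v} (nc : Noncut Γ v) (v≤2 : deg Γ v ≤ 2) where

    private
      P = periphery Γ v
    open Periphery P

    -- With two vertices at distance 2 the bound holds. With a single one, c, adjacency among a, b
    -- and c decides: edges ab and ac together would give three vertices of degree 3, ab alone is a
    -- hanging triangle, and without ab the estimate moves to a.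
    local₀ : TightBound Γ ⊎ (Hanging Γ v × 3 ≤ e)
    local₀ with second-neighbour Γ (path 1) (deg≥2 v)
    ... | a , va , p₁≢a with any? (λ c → (d Γ v c ≟ 2) ×-dec ¬? (path 2 ≟F c))
    ...   | yes (c , lc , p₂≢c) = inj₁ (two-level nc v≤2 p₂≢c (level 2 2≤e) lc)
      where
      2≤e : 2 ≤ e
      2≤e = ≤-trans (≡≥ lc) (bounded c)
    ...   | no ¬other = split (edge? Γ b a) (edge? Γ a c)
      where
      b c : Fin (6 + m)
      b = path 1
      c = path 2
      v≢a = edge⇒≢ Γ va
      1≤e : 1 ≤ e
      1≤e = positive-e Γ P v≢a
      vb : Edge Γ v b
      vb = first-edge Γ P 1≤e
      v≢b = edge⇒≢ Γ vb
      only-c : ∀ {x} → d Γ v x ≡ 2 → x ≡ c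
      only-c {x} lx with c ≟F x
      ... | yes eq = sym eq
      ... | no c≢x = ⊥-elim (¬other (x , lx , c≢x))
      level≥2 : ∀ {x} → v ≢ x → b ≢ x → a ≢ x → 2 ≤ d Γ v x
      level≥2 {x} v≢x b≢x a≢x = d-nonadj Γ v≢x λ vx → [ b≢x ∘ sym , a≢x ∘ sym ]′ (deg≤2⇒≡ Γ v≤2 p₁≢a vb va vx)
      -- Some vertex differs from v, a, b and c since n ≥ 6; it is not at level 2, where c is alone,
      -- so it lies beyond.
      3≤e : 3 ≤ e
      3≤e with fresh 4 (triple Γ v b a ⟨ 3 ⟩▹ c) (s≤s (s≤s (s≤s (s≤s (s≤s z≤n)))))
      ... | x , f = ≤-trans (≤∧≢⇒< (level≥2 (f 0 (s≤s z≤n)) (f 1 (s≤s (s≤s z≤n))) (f 2 (s≤s (s≤s (s≤s z≤n)))))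
          (λ two → f 3 ≤-refl (sym (only-c (sym two))))) (bounded x)
      2≤e : 2 ≤ e
      2≤e = <⇒≤ 3≤e
      la : d Γ v a ≡ 1
      la = d-edge Γ va
      bc : Edge Γ b c
      bc = edge 1 2≤e
      cp₃ : Edge Γ c (path 3)
      cp₃ = edge 2 3≤e
      distinct : ∀ {x y i j} → d Γ v x ≡ i → d Γ v y ≡ j → i ≢ j → x ≢ y
      distinct lx ly i≢j refl = i≢j (trans (sym lx) ly)
      v≢c : v ≢ c
      v≢c = distinct (d-refl Γ v) (level 2 2≤e) (λ ())
      a≢c : a ≢ c
      a≢c = distinct la (level 2 2≤e) (λ ())
      a≢p₃ : a ≢ path 3
      a≢p₃ = distinct la (level 3 3≤e) (λ ())
      a≁p₃ : ¬ Edge Γ a (path 3)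
      a≁p₃ h = <⇒≱ (s≤s (s≤s (s≤s z≤n))) (≤-trans (nbr-level-≤ Γ geo 3≤e (edge-sym Γ h)) (≡≤ (cong suc la)))
      a-neighbours : ∀ {y} → Edge Γ a y → y ≡ v ⊎ y ≡ b ⊎ y ≡ c
      a-neighbours {y} ay with v ≟F y | b ≟F y
      ... | yes eq | _ = inj₁ (sym eq)
      ... | no _ | yes eq = inj₂ (inj₁ (sym eq))
      ... | no v≢y | no b≢y = inj₂ (inj₂ (only-c (≤-antisym
              (≤-trans (d-lip Γ v (edge-sym Γ ay)) (≡≤ (cong suc la))) (level≥2 v≢y b≢y (edge⇒≢ Γ ay)))))
      split : Dec (Edge Γ b a) → Dec (Edge Γ a c) → TightBound Γ ⊎ (Hanging Γ v × 3 ≤ e)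
      split (yes ba) (yes ac) = ⊥-elim (no-three p₁≢a (distinct (level 1 1≤e) (level 2 2≤e) (λ ())) a≢c
        (3≤deg Γ v≢a v≢c a≢c (edge-sym Γ vb) ba bc)
        (3≤deg Γ v≢b v≢c (distinct (level 1 1≤e) (level 2 2≤e) (λ ())) (edge-sym Γ va) (edge-sym Γ ba) ac)
        (3≤deg Γ p₁≢a (distinct (level 1 1≤e) (level 3 3≤e) (λ ())) a≢p₃ (edge-sym Γ bc) (edge-sym Γ ac) cp₃))
      split (yes ba) (no a≁c) = inj₂ (record { va = va ; vb = vb ; ab = edge-sym Γ ba ; v≤2 = v≤2 ; a≤2 = a≤2 ; bc =
          bc ; v≢c = v≢c ; a≢c = a≢c } , 3≤e)
        where
        a≤2 : deg Γ a ≤ 2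
        a≤2 with 3 ≤? deg Γ a
        ... | no ¬3 = s≤s⁻¹ (≰⇒> ¬3)
        ... | yes 3≤a with third-neighbour Γ v b 3≤a
        ...   | y , ay , v≢y , b≢y = ⊥-elim ([ v≢y ∘ sym , [ b≢y ∘ sym , (λ { refl → a≁c ay }) ]′ ]′ (a-neighbours ay))
      -- Now a has only the neighbours v and c, and both b and `path 3` are at distance 2 from a.
      -- Deleting a is harmless because v reaches c through b.
      split (no b≁a) _ = inj₁ (two-level (c , a≢c ∘ sym , avoid) a≤2 (distinct (level 1 1≤e) (level 3 3≤e) (λ ()))
        (≤-antisym (≤-trans (d-step Γ b (edge-sym Γ va)) (s≤s (d-edge≤1 Γ vb))) (d-nonadj Γ (p₁≢a ∘ sym) (b≁a ∘ edge-sym Γ)))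
        (≤-antisym (≤-trans (d-step Γ (path 3) ac) (s≤s (d-edge≤1 Γ cp₃))) (d-nonadj Γ a≢p₃ a≁p₃)))
        where
        a-neighbours′ : ∀ {y} → Edge Γ a y → y ≡ v ⊎ y ≡ c
        a-neighbours′ ay with a-neighbours ay
        ... | inj₁ eq = inj₁ eq
        ... | inj₂ (inj₁ refl) = ⊥-elim (b≁a (edge-sym Γ ay))
        ... | inj₂ (inj₂ eq) = inj₂ eq
        ac : Edge Γ a c
        ac with second-neighbour Γ v (deg≥2 a)
        ... | y , ay , v≢y with a-neighbours′ ay
        ...   | inj₁ eq = ⊥-elim (v≢y (sym eq))
        ...   | inj₂ refl = ay
        a≤2 : deg Γ a ≤ 2
        a≤2 with 3 ≤? deg Γ a
        ... | no ¬3 = s≤s⁻¹ (≰⇒> ¬3)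
        ... | yes 3≤a with third-neighbour Γ v c 3≤a
        ...   | y , ay , v≢y , c≢y = ⊥-elim ([ v≢y ∘ sym , c≢y ∘ sym ]′ (a-neighbours′ ay))
        avoid : ∀ x → x ≢ a → x ≢ c → Σ (Fin (6 + m)) λ y → y ≢ a × Edge Γ x y × d Γ y c < d Γ x c
        avoid x x≢a x≢c with neighbour-toward Γ x≢c
        ... | y , e′ , lt with y ≟F a
        ...   | no y≢a = y , y≢a , e′ , lt
        ...   | yes refl with a-neighbours′ (edge-sym Γ e′)
        ...     | inj₂ refl = ⊥-elim (x≢c refl)
        ...     | inj₁ refl = b , p₁≢a , vb , ≤-trans (s≤s (d-edge≤1 Γ bc)) (≡≥ (level 2 2≤e))

    opaque
      local : TightBound Γ ⊎ (Hanging Γ v × 3 ≤ e)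
      local = local₀

-- Graphs given by their distances

infixl 5 _⟪_⟫_
_⟪_⟫_ : (ℕ → ℕ → ℕ) → ℕ → (ℕ → ℕ) → ℕ → ℕ → ℕ
(δ ⟪ K ⟫ r) i k with k <? K
... | yes _ = δ i k
... | no _ = r i

⟪⟫-old : ∀ δ {K} r {k} i → k < K → (δ ⟪ K ⟫ r) i k ≡ δ i k
⟪⟫-old δ {K} r {k} i k<K with k <? K
... | yes _ = refl
... | no k≮K = ⊥-elim (k≮K k<K)

⟪⟫-new : ∀ δ K r i → (δ ⟪ K ⟫ r) i K ≡ r i
⟪⟫-new δ K r i with K <? K
... | yes K<K = ⊥-elim (<-irrefl refl K<K)
... | no _ = refl

pairSum-⟪⟫ : ∀ δ K r → pairSum (suc K) (δ ⟪ K ⟫ r) ≡ pairSum K δ + sumTo K r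
pairSum-⟪⟫ δ K r = cong₂ _+_ (pairSum-cong K λ i k _ k<K → ⟪⟫-old δ r i k<K) (sumTo-cong K λ i _ → ⟪⟫-new δ K r i)

-- K distinct vertices with a prescribed distance table, read above the diagonal only. With K = n
-- the table determines the graph and its Wiener index.
record Layout {n} (Γ : ConnectedGraph n) (K : ℕ) (δ : ℕ → ℕ → ℕ) : Set where
  field
    q : ℕ → Fin n
    injective : InjectiveBelow K q
    distance : ∀ i k → i < k → k < K → d Γ (q i) (q k) ≡ δ i k

extend : ∀ {n} {Γ : ConnectedGraph n} {K δ} (L : Layout Γ K δ) x r →
  (∀ i → i < K → d Γ (Layout.q L i) x ≡ r i) → (∀ i → i < K → 1 ≤ r i) → Layout Γ (suc K) (δ ⟪ K ⟫ r)
extend {Γ = Γ} {K} {δ} L x r dist-x pos = record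
  { q = q ⟨ K ⟩▹ x
  ; injective = ▹-injective injective λ i i<K eq → <⇒≱ (pos i i<K) (≡≤ (trans (sym (dist-x i i<K))
      (trans (cong (d Γ (q i)) (sym eq)) (d-refl Γ (q i)))))
  ; distance = dist′ }
  where
  open Layout L
  dist′ : ∀ i k → i < k → k < suc K → d Γ ((q ⟨ K ⟩▹ x) i) ((q ⟨ K ⟩▹ x) k) ≡ (δ ⟪ K ⟫ r) i k
  dist′ i k i<k k<sK with m≤n⇒m<n∨m≡n (s≤s⁻¹ k<sK)
  ... | inj₁ k<K = trans (cong₂ (d Γ) (▹-old q x (<-trans i<k k<K)) (▹-old q x k<K)) (trans (distance i k i<k k<K)
      (sym (⟪⟫-old δ r i k<K)))
  ... | inj₂ refl = trans (cong₂ (d Γ) (▹-old q x i<k) (▹-new q K x)) (trans (dist-x i i<k) (sym (⟪⟫-new δ K r i)))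

layout-wiener : ∀ {n} {Γ : ConnectedGraph n} {δ} → Layout Γ n δ → Wiener Γ ≡ pairSum n δ
layout-wiener {n} {Γ} L = trans (Wiener≡pairSum Γ q injective) (pairSum-cong n distance)
  where open Layout L

adj-by-distance : ∀ {n n′} (Γ : ConnectedGraph n) (Δ : ConnectedGraph n′) {u v u′ v′} → d Γ u v ≡ d Δ u′ v′ →
    adj Γ u v ≡ adj Δ u′ v′
adj-by-distance Γ Δ {u} {v} {u′} {v′} eq with adj Γ u v in eq₁ | adj Δ u′ v′ in eq₂
... | true | true = refl
... | false | false = refl
... | true | false = ⊥-elim (subst T eq₂ (d≡1⇒edge Δ (trans (sym eq) (d-edge Γ (subst T (sym eq₁) tt)))))
... | false | true = ⊥-elim (subst T eq₁ (d≡1⇒edge Γ (trans eq (d-edge Δ (subst T (sym eq₂) tt)))))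

-- Matching positions in the two enumerations preserves distances, and adjacency is distance 1.
layout-iso : ∀ {n} {Γ Δ : ConnectedGraph n} {δ} → Layout Γ n δ → Layout Δ n δ → adj Γ ≅ adj Δ
layout-iso {n} {Γ} {Δ} {δ} L M = permutation f g (λ w → inverse M.q L.q M.injective L.injective w) (λ u →
    inverse L.q M.q L.injective M.injective u)
  , λ u v → adj-by-distance Γ Δ (trans (cong₂ (d Γ) (sym (hit L.q L.injective u)) (sym (hit L.q L.injective v)))
      (same _ _ (below L.q L.injective u) (below L.q L.injective v)))
  where
  module L = Layout L
  module M = Layout M
  index : (q : ℕ → Fin n) → InjectiveBelow n q → Fin n → ℕ
  index q inj u = proj₁ (surjectiveBelow q inj u)
  below : ∀ q inj u → index q inj u < n
  below q inj u = proj₁ (proj₂ (surjectiveBelow q inj u))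
  hit : ∀ q inj u → q (index q inj u) ≡ u
  hit q inj u = proj₂ (proj₂ (surjectiveBelow q inj u))
  f g : Fin n → Fin n
  f u = M.q (index L.q L.injective u)
  g w = L.q (index M.q M.injective w)
  inverse : ∀ q q′ inj inj′ u → q (index q′ inj′ (q′ (index q inj u))) ≡ u
  inverse q q′ inj inj′ u = trans (cong q (inj′ _ _ (below q′ inj′ _) (below q inj u) (hit q′ inj′ _))) (hit q inj u)
  same : ∀ i k → i < n → k < n → d Γ (L.q i) (L.q k) ≡ d Δ (M.q i) (M.q k)
  same i k i<n k<n with <-cmp i k
  ... | tri< i<k _ _ = trans (L.distance i k i<k k<n) (sym (M.distance i k i<k k<n))
  ... | tri≈ _ refl _ = trans (d-refl Γ _) (sym (d-refl Δ _))
  ... | tri> _ _ k<i = trans (d-sym Γ _ _) (trans (trans (L.distance k i k<i i<n) (sym (M.distance k i k<i i<n))) (d-sym Δ _ _))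

∸-≤-suc : ∀ a b → a ∸ b ≤ suc (a ∸ suc b)
∸-≤-suc zero b = ≤-trans (≡≤ (0∸n≡0 b)) z≤n
∸-≤-suc (suc a) zero = ≤-refl
∸-≤-suc (suc a) (suc b) = ∸-≤-suc a b

-- A path that a 1-Lipschitz potential certifies to be a geodesic.
record Strand {n} (Γ : ConnectedGraph n) (D : ℕ) : Set where
  field
    path : ℕ → Fin n
    edge : ∀ i → i < D → Edge Γ (path i) (path (suc i))
    φ : Fin n → ℕ
    φ-lipschitz : ∀ {u w} → Edge Γ u w → φ u ≤ suc (φ w)
    φ-path : ∀ i → i ≤ D → φ (path i) ≡ i

module _ {n} {Γ : ConnectedGraph n} {D} (S : Strand Γ D) where
  open Strand S

  φ-≤ : ∀ {u w i j} → φ u ≡ i → φ w ≡ j → i ≤ d Γ u w + j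
  φ-≤ {u} {w} refl refl = lipschitz Γ φ φ-lipschitz u w

  φ-≤′ : ∀ {u w i j} → φ u ≡ i → φ w ≡ j → j ≤ d Γ u w + i
  φ-≤′ {u} {w} hu hw = ≤-trans (φ-≤ hw hu) (≡≤ (cong (_+ _) (d-sym Γ w u)))

  strand-distance : ∀ i k → i ≤ k → k ≤ D → d Γ (path i) (path k) ≡ k ∸ i
  strand-distance i k i≤k k≤D = ≤-antisym upper (+-cancelʳ-≤ i (k ∸ i) _ (≤-trans (≡≤ (m∸n+n≡m i≤k))
      (φ-≤′ (φ-path i (≤-trans i≤k k≤D)) (φ-path k k≤D))))
    where
    upper : d Γ (path i) (path k) ≤ k ∸ i
    upper = ≤-trans (≡≤ (cong (λ l → d Γ (path i) (path l)) (sym (m+[n∸m]≡n i≤k))))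
      (path-≤ Γ path D edge i (k ∸ i) (≤-trans (≡≤ (m+[n∸m]≡n i≤k)) k≤D))

  strandLayout : Layout Γ (suc D) (λ i k → k ∸ i)
  strandLayout = record
    { q = path
    ; injective = λ i j i≤D j≤D eq → trans (sym (φ-path i (s≤s⁻¹ i≤D))) (trans (cong φ eq) (φ-path j (s≤s⁻¹ j≤D)))
    ; distance = λ i k i<k k≤D → strand-distance i k (<⇒≤ i<k) (s≤s⁻¹ k≤D) }

  StrandTwin : ℕ → Fin n → Set
  StrandTwin = Twin Γ path D edge

  -- Equality in `twin-peak`: since φ places x at position j, the potential also bounds the
  -- distances from below.
  twin-φ : ∀ {j x} → StrandTwin j x → φ x ≡ j → ∀ t → t ≤ D → d Γ (path t) x ≡ peak 1 j t
  twin-φ {j} {x} tw φx t t≤D = ≤-antisym (twin-peak Γ path D edge tw t t≤D) lower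
    where
    lower : peak 1 j t ≤ d Γ (path t) x
    lower with compare j t
    ... | equal .j = ≤-trans (≡≤ (peak-at 1 j)) (d-pos Γ (edge⇒≢ Γ (Twin.at tw)))
    ... | less .j s = ≤-trans (≡≤ (peak-above 1 j s)) (+-cancelʳ-≤ j (suc s) _ (≤-trans (≡≤ (cong suc (+-comm s j)))
        (φ-≤ (φ-path t t≤D) φx)))
    ... | greater .t s = ≤-trans (≡≤ (peak-below 1 t s)) (+-cancelʳ-≤ t (suc s) _ (≤-trans (≡≤ (cong suc (+-comm s t)))
        (φ-≤′ (φ-path t t≤D) φx)))

  1≤peak : ∀ j t → 1 ≤ peak 1 j t
  1≤peak zero zero = ≤-refl
  1≤peak zero (suc t) = s≤s z≤n
  1≤peak (suc j) zero = s≤s z≤n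
  1≤peak (suc j) (suc t) = 1≤peak j t

  -- Truncation in `D ∸ φ u` is harmless where φ exceeds D, since it keeps the Lipschitz property.
  reverse : Strand Γ D
  reverse = record
    { path = λ i → path (D ∸ i) ; edge = edge′ ; φ = λ u → D ∸ φ u
    ; φ-lipschitz = λ {u} {w} e → ≤-trans (∸-≤-suc D (φ u)) (s≤s (∸-monoʳ-≤ D (φ-lipschitz (edge-sym Γ e))))
    ; φ-path = λ i i≤D → trans (cong (D ∸_) (φ-path (D ∸ i) (m∸n≤m D i))) (m∸[m∸n]≡n i≤D) }
    where
    edge′ : ∀ i → i < D → Edge Γ (path (D ∸ i)) (path (D ∸ suc i))
    edge′ i i<D = subst (λ l → Edge Γ (path l) (path (D ∸ suc i))) (sym (+-∸-assoc 1 i<D)) (edge-sym Γ (edge (D ∸ suc i)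
        (∸-monoʳ-< (s≤s z≤n) i<D)))

module _ {n} {Γ : ConnectedGraph n} {D} (S : Strand Γ D) where
  open Strand S

  reverse-twin : ∀ {j j′ x} → j + j′ ≡ D → StrandTwin S j x → StrandTwin (reverse S) j′ x
  reverse-twin {j} {j′} {x} refl tw = record
    { j≤D = m≤n+m j′ j
    ; at = subst (λ l → Edge Γ (path l) x) (sym (m+n∸n≡m j j′)) (Twin.at tw)
    ; before = λ { i refl → subst (λ l → Edge Γ (path l) x) (sym (trans (cong (_∸ i) (+-suc j i)) (m+n∸n≡m (suc j) i)))
        (Twin.after tw (≤-trans (≡≤ (+-comm 1 j)) (+-monoʳ-≤ j (s≤s z≤n)))) }
    ; after = after′ j refl }
    where
    after′ : ∀ i → i ≡ j → suc j′ ≤ j + j′ → Edge Γ (path (j + j′ ∸ suc j′)) x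
    after′ zero refl h = ⊥-elim (<-irrefl refl h)
    after′ (suc i) refl _ = subst (λ l → Edge Γ (path l) x) (sym (m+n∸n≡m i j′)) (Twin.before tw i refl)

  reverse-φ : ∀ {j j′ x} → j + j′ ≡ D → φ x ≡ j → Strand.φ (reverse S) x ≡ j′
  reverse-φ {j} {j′} refl φx = trans (cong (j + j′ ∸_) φx) (m+n∸m≡n j j′)

-- Distances in a path of length D with a twin of its vertex j, and with a second twin, of vertex j′, at distance c from the first.
chainδ : ℕ → ℕ → ℕ → ℕ → ℕ
chainδ D j = (λ i k → k ∸ i) ⟪ suc D ⟫ peak 1 j

forkδ : ℕ → ℕ → ℕ → ℕ → ℕ → ℕ → ℕ
forkδ D j j′ c = chainδ D j ⟪ 2 + D ⟫ (peak 1 j′ ⟨ suc D ⟩▹ c)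

module _ {n} {Γ : ConnectedGraph n} {D} (S : Strand Γ D) {j x} (tw : StrandTwin S j x) (φx : Strand.φ S x ≡ j) where

  chainLayout : Layout Γ (2 + D) (chainδ D j)
  chainLayout = extend (strandLayout S) x (peak 1 j) (λ t t≤D → twin-φ S tw φx t (s≤s⁻¹ t≤D)) (λ t _ → 1≤peak S j t)

  forkLayout : ∀ {j′ y} c → StrandTwin S j′ y → Strand.φ S y ≡ j′ → d Γ x y ≡ suc c → Layout Γ (3 + D) (forkδ D j j′ (suc c))
  forkLayout {j′} {y} c tw′ φy dxy = extend chainLayout y (peak 1 j′ ⟨ suc D ⟩▹ suc c) dist′ pos
    where
    open Strand S
    dist′ : ∀ i → i < 2 + D → d Γ ((path ⟨ suc D ⟩▹ x) i) y ≡ (peak 1 j′ ⟨ suc D ⟩▹ suc c) i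
    dist′ i i<2+D with i <? suc D
    ... | yes i≤D = twin-φ S tw′ φy i (s≤s⁻¹ i≤D)
    ... | no _ = dxy
    pos : ∀ i → i < 2 + D → 1 ≤ (peak 1 j′ ⟨ suc D ⟩▹ suc c) i
    pos i _ with i <? suc D
    ... | yes _ = 1≤peak S j′ i
    ... | no _ = s≤s z≤n

pairSum-∸ : ∀ n → pairSum n (λ i k → k ∸ i) ≡ pathWiener n
pairSum-∸ zero = refl
pairSum-∸ (suc n) = cong₂ _+_ (pairSum-∸ n) (trans (sym (+-identityʳ _)) (trans (cong (sumTo n (λ i → n ∸ i) +_)
    (sym (n∸n≡0 n))) (sumTo-∸ n)))

-- The path itself plus the transmission of the twin. Subtracted from the Wiener index of the path
-- on j + j′ + 2 vertices it leaves j + j′ + j·j′.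
pairSum-chain : ∀ j j′ → pairSum (2 + (j + j′)) (chainδ (j + j′) j) ≡ pathWiener (suc (j + j′)) + (tri j + 1 + tri j′)
pairSum-chain j j′ = trans (pairSum-⟪⟫ (λ i k → k ∸ i) (suc (j + j′)) (peak 1 j)) (cong₂ _+_ (pairSum-∸ (suc (j + j′)))
    (sumTo-peak 1 j j′))

-- `h` says that the second twin also doubles an end of the path: j = 0 for `B1`, j = D for `B33`.
pairSum-fork : ∀ D j c → sumTo (suc D) (peak 1 j) ≡ tri D + 1 → pairSum (3 + D) (forkδ D 0 j c) ≡ pathWiener (suc D) +
    (1 + tri D) + (tri D + 1 + c)
pairSum-fork D j c h = trans (pairSum-⟪⟫ (chainδ D 0) (2 + D) (peak 1 j ⟨ suc D ⟩▹ c)) (cong₂ _+_ (pairSum-chain 0 D)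
  (trans (sumTo-▹ id (peak 1 j) (suc D) c) (cong (_+ c) h)))

-- Identification of the extremal graphs

peripheryStrand : ∀ {m} {Γ : ConnectedGraph (suc m)} {v} (P : Periphery Γ v) → Strand Γ (Periphery.e P)
peripheryStrand {Γ = Γ} {v} P = record { path = path ; edge = edge ; φ = d Γ v ; φ-lipschitz = d-lip Γ v ; φ-path = level }
  where open Periphery P

-- Both orientations are kept, since either arm may be the short one that decides which `B n s` this
-- is.
record ChainShape {n} (Γ : ConnectedGraph n) : Set where
  field
    j j′ : ℕ
    1≤j : 1 ≤ j
    1≤j′ : 1 ≤ j′
    order : n ≡ 2 + (j + j′)
    layout : Layout Γ n (chainδ (j + j′) j)
    layout′ : Layout Γ n (chainδ (j + j′) j′)

chainShape : ∀ {m} (Γ : ConnectedGraph (suc m)) → 2 + m ≤ edges Γ → ∀ {u z} → suc m < 3 + d Γ u z → ChainShape Γ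
chainShape {m} Γ count {u} {z} long = shape (extra Γ P (≡≥ k≡1))
  where
  P = periphery Γ u
  open Periphery P
  k≤1 : k ≤ 1
  k≤1 = +-cancelˡ-≤ e k 1 (≤-trans (≡≥ size) (≤-trans (s≤s⁻¹ (s≤s⁻¹ long)) (≤-trans (s≤s (bounded z)) (≡≤ (+-comm 1 e)))))
  k≡1 : k ≡ 1
  k≡1 with k in eq | k≤1
  ... | zero | _ = ⊥-elim (<⇒≱ (n≤1+n (suc m)) (≤-trans count (path-count Γ P eq)))
  ... | suc zero | _ = refl
  ... | suc (suc _) | s≤s ()
  S = peripheryStrand P
  shape : Σ (Fin (suc m)) (OffPath Γ geo) → ChainShape Γ
  shape (x , off) with chain-extra-twin Γ P k≡1 count off
  ... | i , lx , i<e , tw = assemble (e ∸ suc i) (m+[n∸m]≡n (<⇒≤ i<e)) (m<n⇒0<n∸m i<e)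
    where
    assemble : ∀ j′ → suc i + j′ ≡ e → 1 ≤ j′ → ChainShape Γ
    assemble j′ eq 1≤j′ = record
      { j = suc i ; j′ = j′ ; 1≤j = s≤s z≤n ; 1≤j′ = 1≤j′
      ; order = trans (sym (size-K Γ P 1 k≡1)) (cong (2 +_) (sym eq))
      ; layout = subst₂ (λ n D → Layout Γ n (chainδ D (suc i))) (size-K Γ P 1 k≡1) (sym eq) (chainLayout S tw lx)
      ; layout′ = subst₂ (λ n D → Layout Γ n (chainδ D j′)) (size-K Γ P 1 k≡1) (sym eq)
          (chainLayout (reverse S) (reverse-twin S eq tw) (reverse-φ S eq lx)) }

deg-cover : ∀ {n} (Γ : ConnectedGraph n) K q u → InjectiveBelow K q → (∀ i → i < K → Edge Γ u (q i)) → deg Γ u ≤ K →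
    ∀ {y} → Edge Γ u y → Hits K q y
deg-cover Γ K q u inj nbr le {y} e with hits? K q y
... | inj₁ h = h
... | inj₂ miss = ⊥-elim (<⇒≱ (neighbours≤deg Γ (suc K) (q ⟨ K ⟩▹ y) u (▹-injective inj miss) nbr′) le)
  where
  nbr′ : ∀ i → i < suc K → Edge Γ u ((q ⟨ K ⟩▹ y) i)
  nbr′ i i<sK with i <? K
  ... | yes i<K = nbr i i<K
  ... | no _ = e

deg≤3⇒≡ : ∀ {n} (Γ : ConnectedGraph n) {u a b c y} → deg Γ u ≤ 3 → a ≢ b → a ≢ c → b ≢ c → Edge Γ u a → Edge Γ u b →
    Edge Γ u c →
  Edge Γ u y → y ≡ a ⊎ y ≡ b ⊎ y ≡ c
deg≤3⇒≡ Γ {u} {a} {b} {c} le a≢b a≢c b≢c ea eb ec e with deg-cover Γ 3 (triple Γ a b c) u (triple-injective Γ a≢b a≢c b≢c)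
    (λ { 0 _ → ea ; 1 _ → eb ; 2 _ → ec ; (suc (suc (suc _))) (s≤s (s≤s (s≤s ()))) }) le e
... | 0 , _ , eq = inj₁ (sym eq)
... | 1 , _ , eq = inj₂ (inj₁ (sym eq))
... | 2 , _ , eq = inj₂ (inj₂ (sym eq))
... | suc (suc (suc _)) , s≤s (s≤s (s≤s ())) , _

closed⇒all : ∀ {n} (Γ : ConnectedGraph n) (S : Fin n → Set) → (∀ {x y} → S x → Edge Γ x y → S y) → ∀ {r} → S r → ∀ x → S x
closed⇒all Γ S closed {r} Sr x = go (connected Γ r x) Sr
  where
  go : ∀ {a b} → Walk (adj Γ) a b → S a → S b
  go stay s = s
  go (step e w) s = go w (closed s e)

-- Two hanging triangles

module Dumbbell {m} (Γ : ConnectedGraph (6 + m)) (count : edges Γ ≡ 7 + m) (deg≥2 : ∀ u → 2 ≤ deg Γ u)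
  {v u} (H : Hanging Γ v) (K : Hanging Γ u) (u≢v : u ≢ v) (u≢a : u ≢ Hanging.a H) where
  open Excess Γ count deg≥2
  private
    module H = Hanging H
    module K = Hanging K
  open H using (a; b)
  open K using () renaming (a to a′; b to b′)

  low≢high : ∀ {x y} → deg Γ x ≤ 2 → 3 ≤ deg Γ y → x ≢ y
  low≢high hx hy refl = <⇒≱ hy hx

  a′≢v : a′ ≢ v
  a′≢v eq = [ u≢a , low≢high K.v≤2 H.3≤b ]′ (H.v-neighbours (edge-sym Γ (subst (Edge Γ u) eq K.va)))

  a′≢a : a′ ≢ a
  a′≢a eq = [ u≢v , low≢high K.v≤2 H.3≤b ]′ (H.a-neighbours (edge-sym Γ (subst (Edge Γ u) eq K.va)))

  Low High : Fin (6 + m) → Set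
  Low x = x ≡ v ⊎ x ≡ a
  High x = x ≡ u ⊎ x ≡ a′

  low-neighbours : ∀ {x y} → Low x → Edge Γ x y → Low y ⊎ y ≡ b
  low-neighbours (inj₁ refl) e = [ inj₁ ∘ inj₂ , inj₂ ]′ (H.v-neighbours e)
  low-neighbours (inj₂ refl) e = [ inj₁ ∘ inj₁ , inj₂ ]′ (H.a-neighbours e)

  high-neighbours : ∀ {x y} → High x → Edge Γ x y → High y ⊎ y ≡ b′
  high-neighbours (inj₁ refl) e = [ inj₁ ∘ inj₂ , inj₂ ]′ (K.v-neighbours e)
  high-neighbours (inj₂ refl) e = [ inj₁ ∘ inj₁ , inj₂ ]′ (K.a-neighbours e)

  low-deg : ∀ {x} → Low x → deg Γ x ≤ 2
  low-deg (inj₁ refl) = H.v≤2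
  low-deg (inj₂ refl) = H.a≤2

  high-deg : ∀ {x} → High x → deg Γ x ≤ 2
  high-deg (inj₁ refl) = K.v≤2
  high-deg (inj₂ refl) = K.a≤2

  low-high : ∀ {x} → Low x → High x → ⊥
  low-high (inj₁ refl) (inj₁ eq) = u≢v (sym eq)
  low-high (inj₁ refl) (inj₂ eq) = a′≢v (sym eq)
  low-high (inj₂ refl) (inj₁ eq) = u≢a (sym eq)
  low-high (inj₂ refl) (inj₂ eq) = a′≢a (sym eq)

  opaque
    low? : ∀ x → Dec (Low x)
    low? x with x ≟F v | x ≟F a
    ... | yes eq | _ = yes (inj₁ eq)
    ... | _ | yes eq = yes (inj₂ eq)
    ... | no n₁ | no n₂ = no [ n₁ , n₂ ]′

  opaque
    high? : ∀ x → Dec (High x)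
    high? x with x ≟F u | x ≟F a′
    ... | yes eq | _ = yes (inj₁ eq)
    ... | _ | yes eq = yes (inj₂ eq)
    ... | no n₁ | no n₂ = no [ n₁ , n₂ ]′

  -- A common attachment vertex would have degree 4 with all its neighbours in the two triangles.
  -- These five vertices would then be closed under adjacency, against n ≥ 6.
  b≢b′ : b ≢ b′
  b≢b′ b≡b′ = let x , miss = fresh 5 five (s≤s (s≤s (s≤s (s≤s (s≤s (s≤s z≤n)))))) in
    let i , i<5 , eq = hit (closed⇒all Γ Bowtie closed (inj₁ (inj₁ refl)) x) in miss i i<5 eq
    where
    five : ℕ → Fin (6 + m)
    five = triple Γ v a u ⟨ 3 ⟩▹ a′ ⟨ 4 ⟩▹ b
    four-injective : InjectiveBelow 4 (triple Γ v a u ⟨ 3 ⟩▹ a′)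
    four-injective = ▹-injective (triple-injective Γ H.v≢a (u≢v ∘ sym) (u≢a ∘ sym))
      λ { 0 _ → a′≢v ∘ sym ; 1 _ → a′≢a ∘ sym ; 2 _ → K.v≢a ; (suc (suc (suc _))) (s≤s (s≤s (s≤s ()))) }
    bu : Edge Γ b u
    bu = subst (λ x → Edge Γ x u) (sym b≡b′) (edge-sym Γ K.vb)
    ba′ : Edge Γ b a′
    ba′ = subst (λ x → Edge Γ x a′) (sym b≡b′) (edge-sym Γ K.ab)
    b-neighbours : ∀ {y} → Edge Γ b y → Hits 4 (triple Γ v a u ⟨ 3 ⟩▹ a′) y
    b-neighbours = deg-cover Γ 4 _ b four-injective
      (λ { 0 _ → edge-sym Γ H.vb ; 1 _ → edge-sym Γ H.ab ; 2 _ → bu ; 3 _ → ba′ ; (suc (suc (suc (suc _))))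
          (s≤s (s≤s (s≤s (s≤s ())))) })
      (deg≤4 b)
    Bowtie : Fin (6 + m) → Set
    Bowtie x = Low x ⊎ High x ⊎ x ≡ b
    hit : ∀ {y} → Bowtie y → Hits 5 five y
    hit (inj₁ (inj₁ eq)) = 0 , s≤s z≤n , sym eq
    hit (inj₁ (inj₂ eq)) = 1 , s≤s (s≤s z≤n) , sym eq
    hit (inj₂ (inj₁ (inj₁ eq))) = 2 , s≤s (s≤s (s≤s z≤n)) , sym eq
    hit (inj₂ (inj₁ (inj₂ eq))) = 3 , s≤s (s≤s (s≤s (s≤s z≤n))) , sym eq
    hit (inj₂ (inj₂ eq)) = 4 , ≤-refl , sym eq
    from-b : ∀ {y} → Hits 4 (triple Γ v a u ⟨ 3 ⟩▹ a′) y → Bowtie y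
    from-b (0 , _ , eq) = inj₁ (inj₁ (sym eq))
    from-b (1 , _ , eq) = inj₁ (inj₂ (sym eq))
    from-b (2 , _ , eq) = inj₂ (inj₁ (inj₁ (sym eq)))
    from-b (3 , _ , eq) = inj₂ (inj₁ (inj₂ (sym eq)))
    from-b (suc (suc (suc (suc _))) , s≤s (s≤s (s≤s (s≤s ()))) , _)
    closed : ∀ {x y} → Bowtie x → Edge Γ x y → Bowtie y
    closed (inj₁ low) e = [ inj₁ , inj₂ ∘ inj₂ ]′ (low-neighbours low e)
    closed (inj₂ (inj₁ high)) e = [ inj₂ ∘ inj₁ , (λ eq → inj₂ (inj₂ (trans eq (sym b≡b′)))) ]′ (high-neighbours high e)
    closed (inj₂ (inj₂ refl)) e = from-b (b-neighbours e)

  l : ℕ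
  l = d Γ b b′

  1≤l : 1 ≤ l
  1≤l = d-pos Γ b≢b′

  open Geodesic (geodesic Γ b b′) renaming (path to q)

  bridge : Strand Γ l
  bridge = record { path = q ; edge = edge ; φ = d Γ b ; φ-lipschitz = d-lip Γ b ; φ-path = level }

  to-end : ∀ i → i ≤ l → d Γ b′ (q i) ≡ l ∸ i
  to-end i i≤l = trans (d-sym Γ b′ (q i)) (trans (cong (d Γ (q i)) (sym end)) (strand-distance bridge i l i≤l ≤-refl))

  -- The two attachment vertices already use up the excess of 2.
  inner : ∀ {i} → 0 < i → i < l → deg Γ (q i) ≤ 2
  inner {i} 0<i i<l = others≤2 b≢b′ H.3≤b K.3≤b
    (λ eq → <⇒≢ 0<i (trans (sym (d-refl Γ b)) (trans (cong (d Γ b) eq) (level i (<⇒≤ i<l)))))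
    (λ eq → <⇒≢ i<l (trans (sym (level i (<⇒≤ i<l))) (cong (d Γ b) (sym eq))))

  low-level : ∀ {x} → Low x ⊎ x ≡ b → d Γ b x ≤ 1
  low-level (inj₁ (inj₁ refl)) = d-edge≤1 Γ (edge-sym Γ H.vb)
  low-level (inj₁ (inj₂ refl)) = d-edge≤1 Γ (edge-sym Γ H.ab)
  low-level (inj₂ refl) = ≤-trans (≡≤ (d-refl Γ b)) z≤n

  high-level : ∀ {x} → High x ⊎ x ≡ b′ → d Γ b′ x ≤ 1
  high-level (inj₁ (inj₁ refl)) = d-edge≤1 Γ (edge-sym Γ K.vb)
  high-level (inj₁ (inj₂ refl)) = d-edge≤1 Γ (edge-sym Γ K.ab)
  high-level (inj₂ refl) = ≤-trans (≡≤ (d-refl Γ b′)) z≤n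

  -- After a vertex of the triangle the geodesic could only go to level 0 or 1, yet its next level
  -- is at least 2.
  not-low : ∀ i → i ≤ l → ¬ Low (q i)
  not-low zero _ low = low≢high (low-deg low) H.3≤b start
  not-low (suc i) i<l low with m≤n⇒m<n∨m≡n i<l
  ... | inj₂ eq = low≢high (low-deg low) K.3≤b (trans (cong q eq) end)
  ... | inj₁ i+1<l = <⇒≱ (s≤s (s≤s z≤n)) (≤-trans (≡≥ (level (2 + i) i+1<l)) (low-level (low-neighbours low
      (edge (suc i) i+1<l))))

  not-high : ∀ i → i ≤ l → ¬ High (q i)
  not-high zero _ high = low≢high (high-deg high) H.3≤b start
  not-high (suc i) i<l high with m≤n⇒m<n∨m≡n i<l
  ... | inj₂ eq = low≢high (high-deg high) K.3≤b (trans (cong q eq) end)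
  ... | inj₁ i+1<l = <⇒≱ (m+n≤o⇒m≤o∸n 2 i+1<l) (≤-trans (≡≥ (to-end i (<⇒≤ i<l))) (high-level (high-neighbours high
      (edge-sym Γ (edge i i<l)))))

module DumbbellLayout {m} (Γ : ConnectedGraph (6 + m)) (count : edges Γ ≡ 7 + m) (deg≥2 : ∀ u → 2 ≤ deg Γ u)
  {v u} (H : Hanging Γ v) (K : Hanging Γ u) (u≢v : u ≢ v) (u≢a : u ≢ Hanging.a H) where
  open Excess Γ count deg≥2
  open Dumbbell Γ count deg≥2 H K u≢v u≢a
  private
    module H = Hanging H
    module K = Hanging K
  open H using (a; b)
  open K using () renaming (a to a′; b to b′)
  open Geodesic (geodesic Γ b b′) renaming (path to q)

  OnBridge : Fin (6 + m) → Set
  OnBridge x = Σ ℕ λ i → i ≤ l × q i ≡ x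

  Covered : Fin (6 + m) → Set
  Covered x = Low x ⊎ High x ⊎ OnBridge x

  b-on : OnBridge b
  b-on = 0 , z≤n , start

  b′-on : OnBridge b′
  b′-on = l , ≤-refl , end

  bridge-distinct : ∀ {i k} → i ≤ l → k ≤ l → i ≢ k → q i ≢ q k
  bridge-distinct i≤l k≤l i≢k eq = i≢k (trans (sym (level _ i≤l)) (trans (cong (d Γ b) eq) (level _ k≤l)))

  b-neighbours : ∀ {y} → Edge Γ b y → y ≡ v ⊎ y ≡ a ⊎ y ≡ q 1
  b-neighbours = deg≤3⇒≡ Γ (at-most-3 b≢b′ K.3≤b) H.v≢a
    (λ eq → not-low 1 1≤l (inj₁ (sym eq))) (λ eq → not-low 1 1≤l (inj₂ (sym eq)))
    (edge-sym Γ H.vb) (edge-sym Γ H.ab) (subst (λ x → Edge Γ x (q 1)) start (edge 0 1≤l))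

  b′-neighbours : ∀ {i} → suc i ≡ l → ∀ {y} → Edge Γ b′ y → y ≡ u ⊎ y ≡ a′ ⊎ y ≡ q i
  b′-neighbours {i} eq = deg≤3⇒≡ Γ (at-most-3 (b≢b′ ∘ sym) H.3≤b) K.v≢a
    (λ eq′ → not-high i (<⇒≤ i<l) (inj₁ (sym eq′))) (λ eq′ → not-high i (<⇒≤ i<l) (inj₂ (sym eq′)))
    (edge-sym Γ K.vb) (edge-sym Γ K.ab) (subst (λ x → Edge Γ x (q i)) (trans (cong q eq) end) (edge-sym Γ (edge i i<l)))
    where
    i<l : i < l
    i<l = ≡≤ eq

  on : ∀ {y} i → i ≤ l → y ≡ q i → Covered y
  on i i≤l eq = inj₂ (inj₂ (i , i≤l , sym eq))

  bridge-neighbours : ∀ i → i ≤ l → ∀ {y} → Edge Γ (q i) y → Covered y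
  bridge-neighbours zero _ {y} e =
    [ inj₁ ∘ inj₁ , [ inj₁ ∘ inj₂ , on 1 1≤l ]′ ]′ (b-neighbours (subst (λ x → Edge Γ x y) start e))
  bridge-neighbours (suc i) i<l {y} e = [ interior , last ]′ (m≤n⇒m<n∨m≡n i<l)
    where
    interior : suc i < l → Covered y
    interior i+1<l = [ on i (<⇒≤ i<l) , on (2 + i) i+1<l ]′
      (deg≤2⇒≡ Γ (inner (s≤s z≤n) i+1<l) (bridge-distinct (<⇒≤ i<l) i+1<l (<⇒≢ (m<n⇒m<1+n (n<1+n i))))
        (edge-sym Γ (edge i i<l)) (edge (suc i) i+1<l) e)
    last : suc i ≡ l → Covered y
    last eq = [ inj₂ ∘ inj₁ ∘ inj₁ , [ inj₂ ∘ inj₁ ∘ inj₂ , on i (<⇒≤ i<l) ]′ ]′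
      (b′-neighbours eq (subst (λ x → Edge Γ x y) (trans (cong q eq) end) e))

  opaque
    -- The triangles and the bridge are closed under adjacency because every degree in them is
    -- accounted for; connectedness then leaves no other vertex.
    covered : ∀ x → Covered x
    covered = closed⇒all Γ Covered closed {v} (inj₁ (inj₁ refl))
      where
      closed : ∀ {x y} → Covered x → Edge Γ x y → Covered y
      closed (inj₁ low) e = [ inj₁ , (λ { refl → inj₂ (inj₂ b-on) }) ]′ (low-neighbours low e)
      closed (inj₂ (inj₁ high)) e = [ inj₂ ∘ inj₁ , (λ { refl → inj₂ (inj₂ b′-on) }) ]′ (high-neighbours high e)
      closed (inj₂ (inj₂ (i , i≤l , refl))) e = bridge-neighbours i i≤l e

  order-≤ : 6 + m ≤ 5 + l
  order-≤ = allHit⇒≤ (5 + l) all hit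
    where
    all : ℕ → Fin (6 + m)
    all = q ⟨ 1 + l ⟩▹ v ⟨ 2 + l ⟩▹ a ⟨ 3 + l ⟩▹ u ⟨ 4 + l ⟩▹ a′
    old : ∀ {K} (p : ℕ → Fin (6 + m)) x {y} → Hits K p y → Hits (suc K) (p ⟨ K ⟩▹ x) y
    old p x (i , i<K , eq) = i , m<n⇒m<1+n i<K , trans (▹-old p x i<K) eq
    new : ∀ {K} (p : ℕ → Fin (6 + m)) x {y} → y ≡ x → Hits (suc K) (p ⟨ K ⟩▹ x) y
    new {K} p x eq = K , ≤-refl , trans (▹-new p K x) (sym eq)
    hit : ∀ y → Hits (5 + l) all y
    hit y with covered y
    ... | inj₁ (inj₁ eq) = old _ a′ (old _ u (old _ a (new q v eq)))
    ... | inj₁ (inj₂ eq) = old _ a′ (old _ u (new _ a eq))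
    ... | inj₂ (inj₁ (inj₁ eq)) = old _ a′ (new _ u eq)
    ... | inj₂ (inj₁ (inj₂ eq)) = new _ a′ eq
    ... | inj₂ (inj₂ (i , i≤l , eq)) = old _ a′ (old _ u (old _ a (old q v (i , s≤s i≤l , eq))))

  -- Position along the path v, b, ..., b′, u, with a placed beside v and a′ beside u. It certifies
  -- that this path is a geodesic and gives the distance of a and a′.
  potential : Fin (6 + m) → ℕ
  potential x with low? x | high? x
  ... | yes _ | _ = 0
  ... | no _ | yes _ = 2 + l
  ... | no _ | no _ = suc (d Γ b x)

  potential-low : ∀ {x} → Low x → potential x ≡ 0
  potential-low {x} low with low? x
  ... | yes _ = refl
  ... | no ¬low = ⊥-elim (¬low low)

  potential-high : ∀ {x} → High x → potential x ≡ 2 + l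
  potential-high {x} high with low? x | high? x
  ... | yes low | _ = ⊥-elim (low-high low high)
  ... | no _ | yes _ = refl
  ... | no _ | no ¬high = ⊥-elim (¬high high)

  potential-mid : ∀ {x} → ¬ Low x → ¬ High x → potential x ≡ suc (d Γ b x)
  potential-mid {x} ¬low ¬high with low? x | high? x
  ... | yes low | _ = ⊥-elim (¬low low)
  ... | no _ | yes high = ⊥-elim (¬high high)
  ... | no _ | no _ = refl

  potential-lipschitz : ∀ {x y} → Edge Γ x y → potential x ≤ suc (potential y)
  potential-lipschitz {x} {y} e with low? x | high? x | low? y | high? y
  ... | yes _ | _ | _ | _ = z≤n
  ... | no _ | yes high | yes low | _ with high-neighbours high e
  ...   | inj₁ high′ = ⊥-elim (low-high low high′)
  ...   | inj₂ refl = ⊥-elim (low≢high (low-deg low) K.3≤b refl)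
  potential-lipschitz {x} {y} e | no _ | yes _ | no _ | yes _ = n≤1+n _
  potential-lipschitz {x} {y} e | no _ | yes high | no _ | no ¬high′ with high-neighbours high e
  ... | inj₁ high′ = ⊥-elim (¬high′ high′)
  ... | inj₂ refl = ≤-refl
  potential-lipschitz {x} {y} e | no ¬low | no _ | yes low | _ with low-neighbours low (edge-sym Γ e)
  ... | inj₁ low′ = ⊥-elim (¬low low′)
  ... | inj₂ refl = s≤s (≡≤ (d-refl Γ b))
  potential-lipschitz {x} {y} e | no _ | no ¬high | no _ | yes high with high-neighbours high (edge-sym Γ e)
  ... | inj₁ high′ = ⊥-elim (¬high high′)
  ... | inj₂ refl = s≤s (≤-trans (n≤1+n l) (n≤1+n _))
  potential-lipschitz {x} {y} e | no _ | no _ | no _ | no _ = s≤s (d-lip Γ b e)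

  long : ℕ → Fin (6 + m)
  long zero = v
  long (suc i) = (q ⟨ suc l ⟩▹ u) i

  long-mid : ∀ i → i ≤ l → long (suc i) ≡ q i
  long-mid i i≤l = ▹-old q u (s≤s i≤l)

  long-end : long (2 + l) ≡ u
  long-end = ▹-new q (suc l) u

  strand : Strand Γ (2 + l)
  strand = record { path = long ; edge = edge′ ; φ = potential ; φ-lipschitz = potential-lipschitz ; φ-path = φ-path′ }
    where
    edge′ : ∀ i → i < 2 + l → Edge Γ (long i) (long (suc i))
    edge′ zero _ = subst (Edge Γ v) (trans (sym start) (sym (long-mid 0 z≤n))) H.vb
    edge′ (suc i) i<1+l with m≤n⇒m<n∨m≡n (s≤s⁻¹ (s≤s⁻¹ i<1+l))
    ... | inj₁ i<l = subst₂ (Edge Γ) (sym (long-mid i (<⇒≤ i<l))) (sym (long-mid (suc i) i<l)) (edge i i<l)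
    ... | inj₂ eq = subst₂ (Edge Γ) (trans (sym end) (trans (cong q (sym eq)) (sym (long-mid i (≡≤ eq)))))
        (trans (sym long-end) (cong (λ k → long (2 + k)) (sym eq))) (edge-sym Γ K.vb)
    φ-path′ : ∀ i → i ≤ 2 + l → potential (long i) ≡ i
    φ-path′ zero _ = potential-low (inj₁ refl)
    φ-path′ (suc i) i≤1+l with m≤n⇒m<n∨m≡n (s≤s⁻¹ i≤1+l)
    ... | inj₁ i<1+l = trans (cong potential (long-mid i (s≤s⁻¹ i<1+l)))
            (trans (potential-mid (not-low i (s≤s⁻¹ i<1+l)) (not-high i (s≤s⁻¹ i<1+l))) (cong suc (level i (s≤s⁻¹ i<1+l))))
    ... | inj₂ eq = trans (cong (λ k → potential (long (suc k))) eq) (trans (cong potential long-end)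
        (trans (potential-high (inj₁ refl)) (cong suc (sym eq))))

  dumbbellLayout : Layout Γ (6 + m) (forkδ (3 + m) 0 (3 + m) (3 + m))
  dumbbellLayout = subst₂ (λ n D → Layout Γ n (forkδ D 0 D D)) (cong (3 +_) D≡) D≡
    (forkLayout strand first (potential-low (inj₂ refl)) (suc l) last (potential-high (inj₂ refl)) across)
    where
    first : StrandTwin strand 0 a
    first = record { j≤D = z≤n ; at = H.va ; before = λ _ () ; after = λ _ → subst (λ x → Edge Γ x a) (trans (sym start)
        (sym (long-mid 0 z≤n))) (edge-sym Γ H.ab) }
    last : StrandTwin strand (2 + l) a′
    last = record { j≤D = ≤-refl ; at = subst (λ x → Edge Γ x a′) (sym long-end) K.va
      ; before = λ { i refl → subst (λ x → Edge Γ x a′) (trans (sym end) (sym (long-mid l ≤-refl))) (edge-sym Γ K.ab) }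
      ; after = λ h → ⊥-elim (<-irrefl refl h) }
    across : d Γ a a′ ≡ suc (suc l)
    across = ≤-antisym
      (≤-trans (d-step Γ a′ H.ab) (s≤s (≤-trans (d-triangle Γ b b′ a′)
          (≤-trans (+-monoʳ-≤ l (d-edge≤1 Γ (edge-sym Γ K.ab))) (≡≤ (+-comm l 1))))))
      (≤-trans (φ-≤′ strand (potential-low (inj₂ refl)) (potential-high (inj₂ refl))) (≡≤ (+-identityʳ _)))
    -- The layout lists 5 + l distinct vertices, and the cover shows that there are no more.
    D≡ : 2 + l ≡ 3 + m
    D≡ = ≤-antisym (s≤s⁻¹ (s≤s⁻¹ (s≤s⁻¹ (injectiveBelow⇒≤ _ _ (Layout.injective (forkLayout strand first (potential-low
        (inj₂ refl)) (suc l) last (potential-high (inj₂ refl)) across))))))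
      (s≤s⁻¹ (s≤s⁻¹ (s≤s⁻¹ order-≤)))

-- The local analysis is applied twice: at some deletable vertex v of degree 2, and then at one
-- chosen far from v. If the bound holds at neither, two hanging triangles result.
noPendant : ∀ {m} (Γ : ConnectedGraph (6 + m)) → Short Γ → edges Γ ≡ 7 + m → (∀ u → 2 ≤ deg Γ u) →
  TightBound Γ ⊎ Layout Γ (6 + m) (forkδ (3 + m) 0 (3 + m) (3 + m))
noPendant Γ short count deg≥2 = first (lowNoncut fzero)
  where
  open Excess Γ count deg≥2
  open Local Γ short count deg≥2
  second : ∀ {v} → Hanging Γ v → 3 ≤ Periphery.e (periphery Γ v) → LowNoncut v → TightBound Γ ⊎ _
  second {v} H 3≤e N = finish (local noncut u≤2)
    where
    open LowNoncut N
    module H = Hanging H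
    module P = Periphery (periphery Γ v)
    3≤f : 3 ≤ d Γ v f
    3≤f = ≤-trans 3≤e (≤-trans (≡≥ (P.level P.e ≤-refl)) (far (P.path P.e)))
    -- Were u equal to a, the farthest vertex would be a or a neighbour of a, thus within distance 1
    -- of v, although v has eccentricity at least 3.
    u≢a : u ≢ H.a
    u≢a refl with near-far
    ... | inj₁ refl = <⇒≱ 3≤f (≤-trans (d-edge≤1 Γ H.va) (s≤s z≤n))
    ... | inj₂ fa with H.a-neighbours (edge-sym Γ fa)
    ...   | inj₁ refl = <⇒≱ 3≤f (≤-trans (≡≤ (d-refl Γ f)) z≤n)
    ...   | inj₂ refl = <⇒≱ 3≤f (≤-trans (d-edge≤1 Γ H.vb) (s≤s z≤n))
    finish : TightBound Γ ⊎ (Hanging Γ u × 3 ≤ Periphery.e (periphery Γ u)) → _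
    finish (inj₁ done) = inj₁ done
    finish (inj₂ (K , _)) = inj₂ (DumbbellLayout.dumbbellLayout Γ count deg≥2 H K u≢r u≢a)
  first : LowNoncut fzero → TightBound Γ ⊎ _
  first N with local (LowNoncut.noncut N) (LowNoncut.u≤2 N)
  ... | inj₁ done = inj₁ done
  ... | inj₂ (H , 3≤e) = second H 3≤e (lowNoncut _)

module ForkLayout {m} (Γ : ConnectedGraph (2 + m)) {v w} (ev : Edge Γ v w) (one : deg Γ v ≤ 1)
  (short : Short Γ) (count : edges Γ ≡ 3 + m) (F : Pendant.Fork Γ ev one short count) where
  open Pendant Γ ev one short count using (P; 1≤e; v≢w; module Fork)
  open Periphery P
  open Fork F

  e₀ : ℕ
  e₀ = e ∸ 1

  e₀+1 : suc e₀ ≡ e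
  e₀+1 = m+[n∸m]≡n 1≤e

  -- Both extra vertices are at level e, so `path e₀` is the only vertex one level above the last.
  parent : ∀ {s} → OffPath Γ geo s → d Γ v s ≡ e → Edge Γ (path e₀) s
  parent {s} off ls = locate (d-next Γ {s} {v} (trans (d-sym Γ s v) (trans ls (sym e₀+1))))
    where
    locate : (Σ (Fin (2 + m)) λ y → Edge Γ s y × d Γ y v ≡ e₀) → Edge Γ (path e₀) s
    locate (y , sy , ly) = [ on , [ top level-x , top level-y ]′ ]′ (vertices Γ P k≡2 off-x off-y x≢y y)
      where
      on : (Σ ℕ λ i → i ≤ e × path i ≡ y) → Edge Γ (path e₀) s
      on (i , i≤e , eq) = edge-sym Γ (subst (Edge Γ s) (trans (sym eq) (cong path i≡e₀)) sy)
        where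
        i≡e₀ : i ≡ e₀
        i≡e₀ = trans (sym (level i i≤e)) (trans (cong (d Γ v) eq) (trans (d-sym Γ v y) ly))
      top : ∀ {z} → d Γ v z ≡ e → y ≡ z → Edge Γ (path e₀) s
      top lz refl = ⊥-elim (<⇒≢ (≡≤ e₀+1) (trans (sym ly) (trans (d-sym Γ y v) lz)))

  back-top : ∀ {s} → OffPath Γ geo s → d Γ v s ≡ e → back Γ path (suc e) s ≡ 1 + ind (adj Γ (path e) s)
  back-top {s} off ls = trans (two-terms e₀ e₀+1 below) (cong (_+ ind (adj Γ (path e) s)) (ind-T (parent off ls)))
    where
    f : ℕ → ℕ
    f i = ind (adj Γ (path i) s)
    below : ∀ i → i < e₀ → f i ≡ 0
    below i i<e₀ = ind-¬T λ ed → <⇒≱ (s≤s i<e₀) (≤-trans (≡≤ (trans e₀+1 (sym ls)))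
      (nbr-level-≥ Γ geo (≤-trans (<⇒≤ i<e₀) (≤-trans (n≤1+n e₀) (≡≤ e₀+1))) ed))
    two-terms : ∀ e₀ {e} → suc e₀ ≡ e → (∀ i → i < e₀ → f i ≡ 0) → sumTo (suc e) f ≡ f e₀ + f e
    two-terms e₀ refl zeros = cong (λ z → z + f e₀ + f (suc e₀)) (sumTo-zero e₀ zeros)

  -- The path has e = n - 3 edges and the parents of x and y add two. Of the n + 1 edges two are
  -- left, and they join vertices of the last level.
  two-of-three : ind (adj Γ (path e) x) + (ind (adj Γ (path e) y) + ind (adj Γ x y)) ≡ 2
  two-of-three = arith e m (ind (adj Γ (path e) x)) (ind (adj Γ (path e) y)) (ind (adj Γ x y)) (suc-injective
      (suc-injective (size-K Γ P 2 k≡2)))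
    (trans (sym count) (trans (count₂ Γ P k≡2 off-x off-y x≢y)
      (cong₂ (λ p q → e + p + (q + ind (adj Γ x y))) (back-top off-x level-x) (back-top off-y level-y))))
    where
    regroup : ∀ m α β γ → m + (1 + α) + (1 + β + γ) ≡ (2 + m) + (α + (β + γ))
    regroup m α β γ = solve (m ∷ α ∷ β ∷ γ ∷ [])
    split : ∀ m → 4 + m ≡ 2 + m + 2
    split m = solve (m ∷ [])
    arith : ∀ e m α β γ → suc e ≡ m → 3 + m ≡ e + (1 + α) + (1 + β + γ) → α + (β + γ) ≡ 2
    arith e m α β γ refl eq = sym (+-cancelˡ-≡ (2 + e) 2 (α + (β + γ)) (trans (sym (split e)) (trans eq (regroup e α β γ))))

  module _ {t s₁ s₂} (lt : d Γ v t ≡ e) (l₁ : d Γ v s₁ ≡ e) (l₂ : d Γ v s₂ ≡ e)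
    (et : Edge Γ (path e₀) t) (e₁ : Edge Γ (path e₀) s₁) (e₂ : Edge Γ (path e₀) s₂)
    (t₁ : Edge Γ t s₁) (t₂ : Edge Γ t s₂) (n₁₂ : ¬ Edge Γ s₁ s₂) (s₁≢s₂ : s₁ ≢ s₂) where

    -- The geodesic ends instead at t, the vertex of the last level adjacent to both others. These
    -- become twins of t, and t with `path e₀` are the vertices of degree 3 in the K₄⁻.
    toCentre : Strand Γ e
    toCentre = record { path = path ⟨ e ⟩▹ t ; edge = λ i i<e → edge′ i i<e (m≤n⇒m<n∨m≡n i<e) ; φ = d Γ v ; φ-lipschitz =
        d-lip Γ v ; φ-path = λ i i≤e → level′ i (m≤n⇒m<n∨m≡n i≤e) }
      where
      edge′ : ∀ i → i < e → suc i < e ⊎ suc i ≡ e → Edge Γ ((path ⟨ e ⟩▹ t) i) ((path ⟨ e ⟩▹ t) (suc i))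
      edge′ i i<e (inj₁ i+1<e) = subst₂ (Edge Γ) (sym (▹-old path t i<e)) (sym (▹-old path t i+1<e)) (edge i i<e)
      edge′ i i<e (inj₂ eq) = subst₂ (Edge Γ) (trans (cong path (suc-injective (trans e₀+1 (sym eq)))) (sym (▹-old path t i<e)))
        (trans (sym (▹-new path e t)) (cong (path ⟨ e ⟩▹ t) (sym eq))) et
      level′ : ∀ i → i < e ⊎ i ≡ e → d Γ v ((path ⟨ e ⟩▹ t) i) ≡ i
      level′ i (inj₁ i<e) = trans (cong (d Γ v) (▹-old path t i<e)) (level i (<⇒≤ i<e))
      level′ i (inj₂ refl) = trans (cong (d Γ v) (▹-new path e t)) lt

    topTwin : ∀ {s} → Edge Γ (path e₀) s → Edge Γ t s → StrandTwin toCentre e s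
    topTwin {s} es ts = record
      { j≤D = ≤-refl
      ; at = subst (λ x → Edge Γ x s) (sym (▹-new path e t)) ts
      ; before = λ i eq → subst (λ x → Edge Γ x s) (trans (cong path (suc-injective (trans e₀+1 (sym eq))))
          (sym (▹-old path t (≡≤ eq)))) es
      ; after = λ h → ⊥-elim (<-irrefl refl h) }

    centreLayout : Layout Γ (2 + m) (forkδ e 0 0 2)
    centreLayout = subst (λ n → Layout Γ n (forkδ e 0 0 2)) (size-K Γ P 2 k≡2)
      (forkLayout (reverse toCentre) (reverse-twin toCentre e+0 (topTwin e₁ t₁)) (reverse-φ toCentre e+0 l₁) 1
        (reverse-twin toCentre e+0 (topTwin e₂ t₂)) (reverse-φ toCentre e+0 l₂)
        (≤-antisym (≤-trans (d-step Γ s₂ (edge-sym Γ t₁)) (s≤s (d-edge≤1 Γ t₂))) (d-nonadj Γ s₁≢s₂ n₁₂)))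
      where
      e+0 : e + 0 ≡ e
      e+0 = +-identityʳ e

  forkLayout′ : Layout Γ (2 + m) (forkδ e 0 0 2)
  forkLayout′ = cases (edge? Γ (path e) x) (edge? Γ (path e) y) (edge? Γ x y)
    where
    lz : d Γ v (path e) ≡ e
    lz = level e ≤-refl
    ez : Edge Γ (path e₀) (path e)
    ez = subst (λ i → Edge Γ (path e₀) (path i)) e₀+1 (edge e₀ (≡≤ e₀+1))
    ex : Edge Γ (path e₀) x
    ex = parent off-x level-x
    ey : Edge Γ (path e₀) y
    ey = parent off-y level-y
    count-as : ∀ {α β γ} → ind (adj Γ (path e) x) ≡ α → ind (adj Γ (path e) y) ≡ β → ind (adj Γ x y) ≡ γ → α + (β + γ) ≡ 2
    count-as refl refl refl = two-of-three
    cases : Dec (Edge Γ (path e) x) → Dec (Edge Γ (path e) y) → Dec (Edge Γ x y) → Layout Γ (2 + m) (forkδ e 0 0 2)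
    cases (yes zx) (yes zy) (no xy) = centreLayout lz level-x level-y ez ex ey zx zy xy x≢y
    cases (yes zx) (no zy) (yes xy) = centreLayout level-x lz level-y ex ez ey (edge-sym Γ zx) xy zy (off-y e ≤-refl)
    cases (no zx) (yes zy) (yes xy) = centreLayout level-y lz level-x ey ez ex (edge-sym Γ zy) (edge-sym Γ xy) zx
        (off-x e ≤-refl)
    cases (yes zx) (yes zy) (yes xy) = case count-as (ind-T zx) (ind-T zy) (ind-T xy) of λ ()
    cases (yes zx) (no zy) (no xy) = case count-as (ind-T zx) (ind-¬T zy) (ind-¬T xy) of λ ()
    cases (no zx) (yes zy) (no xy) = case count-as (ind-¬T zx) (ind-T zy) (ind-¬T xy) of λ ()
    cases (no zx) (no zy) (yes xy) = case count-as (ind-¬T zx) (ind-¬T zy) (ind-T xy) of λ ()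
    cases (no zx) (no zy) (no xy) = case count-as (ind-¬T zx) (ind-¬T zy) (ind-¬T xy) of λ ()

-- The named graphs

-- Saturates at n, so that label sequences become total vertex sequences.
clamp : ∀ {n} → ℕ → Fin (suc n)
clamp zero = fzero
clamp {zero} (suc i) = fzero
clamp {suc n} (suc i) = fsuc (clamp i)

toℕ-clamp : ∀ {n} i → i ≤ n → toℕ (clamp {n} i) ≡ i
toℕ-clamp zero _ = refl
toℕ-clamp {suc n} (suc i) (s≤s h) = cong suc (toℕ-clamp i h)

∧-left : ∀ {a b} → T (a ∧ b) → T a
∧-left h = proj₁ (Equivalence.to T-∧ h)

∧-right : ∀ a {b} → T (a ∧ b) → T b
∧-right a h = proj₂ (Equivalence.to (T-∧ {a}) h)

∨-elim : ∀ a {b} {X : Set} → T (a ∨ b) → (T a → X) → (T b → X) → X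
∨-elim a h f g = [ f , g ]′ (Equivalence.to (T-∨ {a}) h)

-- Along an edge the labels increase and φ changes by at most one, so the path p is a geodesic on which φ is the position.
record Labelling (n D : ℕ) (E : ℕ → ℕ → Bool) : Set where
  field
    φ : ℕ → ℕ
    ascending : ∀ a b → T (E a b) → a < b
    near : ∀ a b → T (E a b) → φ a ≤ suc (φ b) × φ b ≤ suc (φ a)
    p : ℕ → ℕ
    p<n : ∀ i → i ≤ D → p i < n
    p-edge : ∀ i → i < D → T (E (p i) (p (suc i)) ∨ E (p (suc i)) (p i))
    φ-p : ∀ i → i ≤ D → φ (p i) ≡ i

module Labelled {n D E} (L : Labelling (suc n) D E) where
  open Labelling L

  G : Graph (suc n)
  G = fromEdges (suc n) E

  simple′ : IsSimple G
  simple′ = (λ u v → ∨-comm (E (toℕ u) (toℕ v)) (E (toℕ v) (toℕ u))) , loopless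
    where
    loopless : ∀ u → G u u ≡ false
    loopless u with E (toℕ u) (toℕ u) in eq
    ... | false = refl
    ... | true = ⊥-elim (<-irrefl refl (ascending (toℕ u) (toℕ u) (subst T (sym eq) tt)))

  label-edge : ∀ a b → a < suc n → b < suc n → T (E a b ∨ E b a) → T (G (clamp a) (clamp b))
  label-edge a b a≤n b≤n = subst₂ (λ x y → T (E x y ∨ E y x)) (sym (toℕ-clamp a (s≤s⁻¹ a≤n))) (sym (toℕ-clamp b (s≤s⁻¹ b≤n)))

  φ′ : Fin (suc n) → ℕ
  φ′ u = φ (toℕ u)

  φ′-clamp : ∀ {a} → a < suc n → φ′ (clamp a) ≡ φ a
  φ′-clamp a≤n = cong φ (toℕ-clamp _ (s≤s⁻¹ a≤n))

  φ′-lipschitz : ∀ {u w} → T (G u w) → φ′ u ≤ suc (φ′ w)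
  φ′-lipschitz {u} {w} h = ∨-elim (E (toℕ u) (toℕ w)) h
    (λ e → proj₁ (near (toℕ u) (toℕ w) e)) (λ e → proj₂ (near (toℕ w) (toℕ u) e))

  path′ : ℕ → Fin (suc n)
  path′ i = clamp (p i)

  path′-edge : ∀ i → i < D → T (G (path′ i) (path′ (suc i)))
  path′-edge i i<D = label-edge (p i) (p (suc i)) (p<n i (<⇒≤ i<D)) (p<n (suc i) i<D) (p-edge i i<D)

  φ′-path : ∀ i → i ≤ D → φ′ (path′ i) ≡ i
  φ′-path i i≤D = trans (φ′-clamp (p<n i i≤D)) (φ-p i i≤D)

  path′-injective : InjectiveBelow (suc D) path′
  path′-injective i j i≤D j≤D eq = trans (sym (φ′-path i (s≤s⁻¹ i≤D))) (trans (cong φ′ eq) (φ′-path j (s≤s⁻¹ j≤D)))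

  from-start : ∀ i → i ≤ D → Walk G (path′ 0) (path′ i)
  from-start zero _ = stay
  from-start (suc i) i<D = snoc (from-start i (<⇒≤ i<D)) (path′-edge i i<D)
    where
    snoc : ∀ {a b c} → Walk G a b → T (G b c) → Walk G a c
    snoc stay e = step e stay
    snoc (step e′ w) e = step e′ (snoc w e)

  Reached : Fin (suc n) → Set
  Reached u = Σ ℕ λ i → i ≤ D × (path′ i ≡ u ⊎ T (G (path′ i) u))

  reached⇒connected : (∀ u → Reached u) → Connected G
  reached⇒connected h u v = append (back-walk (walk u)) (walk v)
    where
    append : ∀ {a b c} → Walk G a b → Walk G b c → Walk G a c
    append stay w = w
    append (step e w′) w = step e (append w′ w)
    back-walk : ∀ {a b} → Walk G a b → Walk G b a
    back-walk stay = stay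
    back-walk {a} (step {w = c} e w) = append (back-walk w) (step (subst T (proj₁ simple′ a c) e) stay)
    walk : ∀ x → Walk G (path′ 0) x
    walk x with h x
    ... | i , i≤D , inj₁ refl = from-start i i≤D
    ... | i , i≤D , inj₂ e = append (from-start i i≤D) (step e stay)

  record LabelTwin (j x : ℕ) : Set where
    field
      j≤D : j ≤ D
      x<n : x < suc n
      φ-x : φ x ≡ j
      at : T (E (p j) x ∨ E x (p j))
      before : ∀ i → suc i ≡ j → T (E (p i) x ∨ E x (p i))
      after : suc j ≤ D → T (E (p (suc j)) x ∨ E x (p (suc j)))

    at′ : T (G (path′ j) (clamp x))
    at′ = label-edge (p j) x (p<n j j≤D) x<n at

    off : ∀ i → i < suc D → path′ i ≢ clamp x
    off i i≤D eq = subst T (proj₂ simple′ (clamp x)) (subst (λ y → T (G y (clamp x))) (trans (cong path′ j≡i) eq) at′)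
      where
      j≡i : j ≡ i
      j≡i = trans (sym φ-x) (trans (sym (φ′-clamp x<n)) (trans (cong φ′ (sym eq)) (φ′-path i (s≤s⁻¹ i≤D))))

  module _ (conn : Connected G) where

    Γ : ConnectedGraph (suc n)
    Γ = connectedGraph G simple′ conn

    strand′ : Strand Γ D
    strand′ = record { path = path′ ; edge = path′-edge ; φ = φ′ ; φ-lipschitz = φ′-lipschitz ; φ-path = φ′-path }

    twin′ : ∀ {j x} → LabelTwin j x → StrandTwin strand′ j (clamp x)
    twin′ {j} {x} tw = record
      { j≤D = j≤D ; at = at′
      ; before = λ i eq → label-edge (p i) x (p<n i (≤-trans (≤-trans (n≤1+n i) (≡≤ eq)) j≤D)) x<n (before i eq)
      ; after = λ h → label-edge (p (suc j)) x (p<n (suc j) h) x<n (after h) }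
      where open LabelTwin tw

    φ-twin : ∀ {j x} → (tw : LabelTwin j x) → φ′ (clamp x) ≡ j
    φ-twin tw = trans (φ′-clamp x<n) φ-x
      where open LabelTwin tw

-- A named graph with proofs of connectedness and of its distance table; its Wiener index and a
-- criterion for being isomorphic to it follow.
record Realised {n} (G : Graph n) (δ : ℕ → ℕ → ℕ) : Set where
  field
    Γ : ConnectedGraph n
    adj≡ : adj Γ ≡ G
    layout : Layout Γ n δ

  wiener : W G ≡ pairSum n δ
  wiener = trans (cong W (sym adj≡)) (trans (sym (Wiener≡W Γ)) (layout-wiener layout))

  iso : ∀ {Δ : ConnectedGraph n} → Layout Δ n δ → adj Δ ≅ G
  iso M = subst (_ ≅_) adj≡ (layout-iso M layout)

module _ {D E} (L : Labelling (2 + D) D E) where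
  open Labelled L

  realised-chain : ∀ {j x} → LabelTwin j x → Realised (fromEdges (2 + D) E) (chainδ D j)
  realised-chain {j} {x} tw = record { Γ = Γ conn ; adj≡ = refl ; layout = chainLayout (strand′ conn) (twin′ conn tw)
      (φ-twin conn tw) }
    where
    open LabelTwin tw using (at′; off) renaming (j≤D to jD)
    conn : Connected G
    conn = reached⇒connected λ u → reach u (surjectiveBelow _ (▹-injective path′-injective off) u)
      where
      reach : ∀ u → Hits (2 + D) (path′ ⟨ suc D ⟩▹ clamp x) u → Reached u
      reach u (i , i<2+D , eq) with i <? suc D
      ... | yes i≤D = i , s≤s⁻¹ i≤D , inj₁ eq
      ... | no _ = j , jD , inj₂ (subst (λ y → T (G (path′ j) y)) eq at′)

module _ {D E} (L : Labelling (3 + D) D E) where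
  open Labelled L

  realised-fork : ∀ {j x j′ y} c → LabelTwin j x → LabelTwin j′ y → clamp {2 + D} x ≢ clamp y →
    (∀ conn → d (Γ conn) (clamp x) (clamp y) ≡ suc c) → Realised (fromEdges (3 + D) E) (forkδ D j j′ (suc c))
  realised-fork {j} {x} {j′} {y} c tw tw′ x≢y dxy = record
    { Γ = Γ conn ; adj≡ = refl
    ; layout = forkLayout (strand′ conn) (twin′ conn tw) (φ-twin conn tw) c (twin′ conn tw′) (φ-twin conn tw′) (dxy conn) }
    where
    module X = LabelTwin tw
    module Y = LabelTwin tw′
    q : ℕ → Fin (3 + D)
    q = path′ ⟨ suc D ⟩▹ clamp x
    off-y : ∀ i → i < 2 + D → q i ≢ clamp y
    off-y i _ eq with i <? suc D
    ... | yes i≤D = Y.off i i≤D eq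
    ... | no _ = x≢y eq
    conn : Connected G
    conn = reached⇒connected λ u → reach u (surjectiveBelow _ (▹-injective (▹-injective path′-injective X.off) off-y) u)
      where
      reach : ∀ u → Hits (3 + D) (q ⟨ 2 + D ⟩▹ clamp y) u → Reached u
      reach u (i , _ , eq) with i <? 2 + D
      ... | no _ = j′ , Y.j≤D , inj₂ (subst (λ z → T (G (path′ j′) z)) eq Y.at′)
      ... | yes _ with i <? suc D
      ...   | yes i≤D = i , s≤s⁻¹ i≤D , inj₁ eq
      ...   | no _ = j , X.j≤D , inj₂ (subst (λ z → T (G (path′ j) z)) eq X.at′)

inl : ∀ {a b} → T a → T (a ∨ b)
inl h = Equivalence.from T-∨ (inj₁ h)

inr : ∀ a {b} → T b → T (a ∨ b)
inr a h = Equivalence.from (T-∨ {a}) (inj₂ h)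

both : ∀ {a b} → T a → T b → T (a ∧ b)
both h h′ = Equivalence.from T-∧ (h , h′)

≡ᵇ-refl : ∀ a → T (a ≡ᵇ a)
≡ᵇ-refl a = ≡⇒≡ᵇ a a refl

data K4⁻Edge : ℕ → ℕ → Set where
  e01 : K4⁻Edge 0 1
  e02 : K4⁻Edge 0 2
  e03 : K4⁻Edge 0 3
  e12 : K4⁻Edge 1 2
  e13 : K4⁻Edge 1 3

k4⁻-edge : ∀ a b → T (K4⁻E a b) → K4⁻Edge a b
k4⁻-edge 0 1 _ = e01
k4⁻-edge 0 2 _ = e02
k4⁻-edge 0 3 _ = e03
k4⁻-edge 1 2 _ = e12
k4⁻-edge 1 3 _ = e13

k4⁻-ascending : ∀ {a b} → K4⁻Edge a b → a < b
k4⁻-ascending e01 = s≤s z≤n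
k4⁻-ascending e02 = s≤s z≤n
k4⁻-ascending e03 = s≤s z≤n
k4⁻-ascending e12 = s≤s (s≤s z≤n)
k4⁻-ascending e13 = s≤s (s≤s z≤n)

-- The edge relation of B n s, with N standing for n ∸ s.
chainE : ℕ → ℕ → ℕ → ℕ → ℕ → Bool
chainE n N s a b =
     K4⁻E a b
   ∨ ((a ≡ᵇ 2) ∧ (b ≡ᵇ 4) ∧ (4 <ᵇ N))
   ∨ ((4 ≤ᵇ a) ∧ (b ≡ᵇ suc a) ∧ (b <ᵇ N))
   ∨ ((a ≡ᵇ 3) ∧ (b ≡ᵇ N) ∧ (1 ≤ᵇ s))
   ∨ ((N ≤ᵇ a) ∧ (b ≡ᵇ suc a) ∧ (b <ᵇ n))

module ChainLabelling (c s : ℕ) where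

  n N D : ℕ
  n = 4 + c + s
  N = 4 + c
  D = 2 + c + s

  E : ℕ → ℕ → Bool
  E = chainE n N s

  data Edges : ℕ → ℕ → Set where
    core : ∀ {a b} → K4⁻Edge a b → Edges a b
    leave₂ : 1 ≤ c → Edges 2 4
    along₂ : ∀ {i} → suc i < c → Edges (4 + i) (5 + i)
    leave₃ : 1 ≤ s → Edges 3 (4 + c)
    along₃ : ∀ {i} → c ≤ i → Edges (4 + i) (5 + i)

  view : ∀ a b → T (E a b) → Edges a b
  view a b h = ∨-elim (K4⁻E a b) h (core ∘ k4⁻-edge a b) λ h → ∨-elim ((a ≡ᵇ 2) ∧ (b ≡ᵇ 4) ∧ (4 <ᵇ N)) h
    (λ e → leave (≡ᵇ⇒≡ a 2 (∧-left e)) (≡ᵇ⇒≡ b 4 (∧-left (∧-right (a ≡ᵇ 2) e))) (<ᵇ⇒< 4 N (∧-right (b ≡ᵇ 4)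
        (∧-right (a ≡ᵇ 2) e))))
    λ h → ∨-elim ((4 ≤ᵇ a) ∧ (b ≡ᵇ suc a) ∧ (b <ᵇ N)) h
    (λ e → along (≤ᵇ⇒≤ 4 a (∧-left e)) (≡ᵇ⇒≡ b (suc a) (∧-left (∧-right (4 ≤ᵇ a) e))) (<ᵇ⇒< b N (∧-right (b ≡ᵇ suc a)
        (∧-right (4 ≤ᵇ a) e))))
    λ h → ∨-elim ((a ≡ᵇ 3) ∧ (b ≡ᵇ N) ∧ (1 ≤ᵇ s)) h
    (λ e → leave′ (≡ᵇ⇒≡ a 3 (∧-left e)) (≡ᵇ⇒≡ b N (∧-left (∧-right (a ≡ᵇ 3) e))) (≤ᵇ⇒≤ 1 s (∧-right (b ≡ᵇ N)
        (∧-right (a ≡ᵇ 3) e))))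
    (λ e → along′ (≤ᵇ⇒≤ N a (∧-left e)) (≡ᵇ⇒≡ b (suc a) (∧-left (∧-right (N ≤ᵇ a) e))))
    where
    leave : a ≡ 2 → b ≡ 4 → 4 < N → Edges a b
    leave refl refl (s≤s (s≤s (s≤s (s≤s h)))) = leave₂ h
    along : 4 ≤ a → b ≡ suc a → b < N → Edges a b
    along (s≤s (s≤s (s≤s (s≤s z≤n)))) refl (s≤s (s≤s (s≤s (s≤s h)))) = along₂ h
    leave′ : a ≡ 3 → b ≡ N → 1 ≤ s → Edges a b
    leave′ refl refl h = leave₃ h
    along′ : N ≤ a → b ≡ suc a → Edges a b
    along′ (s≤s (s≤s (s≤s (s≤s h)))) refl = along₃ h

  -- Position on the path that runs from label n - 1 down the tail at 3, then through 3, 0, 2 and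
  -- out along the tail at 2. Label 1 shares the position of 0 as its twin.
  φ : ℕ → ℕ
  φ 0 = 1 + s
  φ 1 = 1 + s
  φ 2 = 2 + s
  φ 3 = s
  φ (suc (suc (suc (suc i)))) = if i <ᵇ c then 3 + s + i else s ∸ suc (i ∸ c)

  φ-tail₂ : ∀ {i} → i < c → φ (4 + i) ≡ 3 + s + i
  φ-tail₂ {i} h = cong (λ b → if b then 3 + s + i else s ∸ suc (i ∸ c)) (Equivalence.to T-≡ (<⇒<ᵇ h))

  φ-tail₃ : ∀ {i} → c ≤ i → φ (4 + i) ≡ s ∸ suc (i ∸ c)
  φ-tail₃ {i} h with i <ᵇ c in eq
  ... | false = refl
  ... | true = ⊥-elim (<⇒≱ (<ᵇ⇒< i c (subst T (sym eq) tt)) h)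

  near : ∀ {a b} → Edges a b → φ a ≤ suc (φ b) × φ b ≤ suc (φ a)
  near (core e01) = n≤1+n _ , n≤1+n _
  near (core e02) = ≤-trans (n≤1+n _) (n≤1+n _) , ≤-refl
  near (core e03) = ≤-refl , ≤-trans (n≤1+n _) (n≤1+n _)
  near (core e12) = ≤-trans (n≤1+n _) (n≤1+n _) , ≤-refl
  near (core e13) = ≤-refl , ≤-trans (n≤1+n _) (n≤1+n _)
  near (leave₂ 1≤c) = subst (λ x → 2 + s ≤ suc x × x ≤ 3 + s) (sym (trans (φ-tail₂ 1≤c) (+-identityʳ (3 + s))))
    (≤-trans (n≤1+n _) (n≤1+n _) , ≤-refl)
  near (along₂ {i} h) = subst₂ (λ x y → x ≤ suc y × y ≤ suc x) (sym (φ-tail₂ (<⇒≤ h)))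
      (sym (trans (φ-tail₂ h) (+-suc (3 + s) i)))
    (≤-trans (n≤1+n _) (n≤1+n _) , ≤-refl)
  near (leave₃ 1≤s) = subst (λ x → s ≤ suc x × x ≤ suc s) (sym (trans (φ-tail₃ ≤-refl) (cong (λ x → s ∸ suc x) (n∸n≡0 c))))
    (∸-≤-suc s 0 , ≤-trans (m∸n≤m s 1) (n≤1+n s))
  near (along₃ {i} h) = subst₂ (λ x y → x ≤ suc y × y ≤ suc x) (sym (φ-tail₃ h))
      (sym (trans (φ-tail₃ (≤-trans h (n≤1+n i))) (cong (λ x → s ∸ suc x) (+-∸-assoc 1 h))))
    (∸-≤-suc s _ , ≤-trans (∸-monoʳ-≤ s (n≤1+n (suc (i ∸ c)))) (n≤1+n _))

  ascending : ∀ {a b} → Edges a b → a < b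
  ascending (core e) = k4⁻-ascending e
  ascending (leave₂ _) = s≤s (s≤s (s≤s z≤n))
  ascending (along₂ _) = ≤-refl
  ascending (leave₃ _) = s≤s (s≤s (s≤s (s≤s z≤n)))
  ascending (along₃ _) = ≤-refl

  arm : ℕ → ℕ
  arm 0 = 3
  arm 1 = 0
  arm 2 = 2
  arm (suc (suc (suc i))) = 4 + i

  p : ℕ → ℕ
  p t = if t <ᵇ s then 4 + (c + (s ∸ suc t)) else arm (t ∸ s)

  p-tail : ∀ {t} → t < s → p t ≡ 4 + (c + (s ∸ suc t))
  p-tail {t} h = cong (λ b → if b then 4 + (c + (s ∸ suc t)) else arm (t ∸ s)) (Equivalence.to T-≡ (<⇒<ᵇ h))

  p-arm : ∀ r → p (r + s) ≡ arm r
  p-arm r with r + s <ᵇ s in eq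
  ... | false = cong arm (m+n∸n≡m r s)
  ... | true = ⊥-elim (<⇒≱ (<ᵇ⇒< (r + s) s (subst T (sym eq) tt)) (m≤n+m s r))

  data Position : ℕ → Set where
    tail : ∀ {t} → t < s → Position t
    onArm : ∀ r → Position (r + s)

  position : ∀ t → Position t
  position t with t <? s
  ... | yes h = tail h
  ... | no h = subst Position (m∸n+n≡m (≮⇒≥ h)) (onArm (t ∸ s))

  p<n : ∀ t → t ≤ D → p t < n
  p<n t t≤D with position t
  ... | tail h = subst (_< n) (sym (p-tail h)) (s≤s (s≤s (s≤s (s≤s (+-monoʳ-< c (∸-monoʳ-< {s} (s≤s z≤n) h))))))
  ... | onArm r = subst (_< n) (sym (p-arm r)) (bound r (+-cancelʳ-≤ s r (2 + c) t≤D))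
    where
    bound : ∀ r → r ≤ 2 + c → arm r < n
    bound 0 _ = s≤s (s≤s (s≤s (s≤s z≤n)))
    bound 1 _ = s≤s z≤n
    bound 2 _ = s≤s (s≤s (s≤s z≤n))
    bound (suc (suc (suc i))) (s≤s (s≤s h)) = s≤s (s≤s (s≤s (s≤s (≤-trans h (m≤m+n c s)))))

  φ-p : ∀ t → t ≤ D → φ (p t) ≡ t
  φ-p t t≤D with position t
  ... | tail h = trans (cong φ (p-tail h)) (trans (φ-tail₃ (m≤m+n c (s ∸ suc t))) (trans (cong (λ x → s ∸ suc x)
      (m+n∸m≡n c (s ∸ suc t))) (flip s t h)))
    where
    flip : ∀ s t → t < s → s ∸ suc (s ∸ suc t) ≡ t
    flip (suc s) t (s≤s h) = m∸[m∸n]≡n h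
  ... | onArm r = trans (cong φ (p-arm r)) (value r (+-cancelʳ-≤ s r (2 + c) t≤D))
    where
    value : ∀ r → r ≤ 2 + c → φ (arm r) ≡ r + s
    value 0 _ = refl
    value 1 _ = refl
    value 2 _ = refl
    value (suc (suc (suc i))) (s≤s (s≤s h)) = trans (φ-tail₂ h) (cong (3 +_) (+-comm s i))

  Joined : ℕ → ℕ → Set
  Joined a b = T (E a b ∨ E b a)

  joined-leave₂ : 1 ≤ c → Joined 2 4
  joined-leave₂ h = inl (inl (<⇒<ᵇ (s≤s (s≤s (s≤s (s≤s h))))))

  joined-along₂ : ∀ i → suc i < c → Joined (4 + i) (5 + i)
  joined-along₂ i h = inl (inr (K4⁻E (4 + i) (5 + i)) (inl (both (≡ᵇ-refl i) (<⇒<ᵇ (s≤s (s≤s (s≤s (s≤s h))))))))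

  joined-leave₃ : 1 ≤ s → Joined 3 (4 + c)
  joined-leave₃ h = inl (inl (both (≡ᵇ-refl c) (≤⇒≤ᵇ h)))

  joined-along₃ : ∀ i → c ≤ i → 5 + i < n → Joined (4 + i) (5 + i)
  joined-along₃ i h h′ = inl (inr (K4⁻E (4 + i) (5 + i)) (inr ((i ≡ᵇ i) ∧ (5 + i <ᵇ N))
    (both (≤⇒≤ᵇ (+-monoʳ-≤ 4 h)) (both (≡ᵇ-refl i) (<⇒<ᵇ h′)))))

  joined-sym : ∀ a b → Joined a b → Joined b a
  joined-sym a b h = ∨-elim (E a b) h (inr (E b a)) inl

  p-edge : ∀ t → t < D → Joined (p t) (p (suc t))
  p-edge t t<D with position t
  ... | onArm r = subst₂ Joined (sym (p-arm r)) (sym (p-arm (suc r))) (step′ r (+-cancelʳ-≤ s (suc r) (2 + c) t<D))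
    where
    step′ : ∀ r → suc r ≤ 2 + c → Joined (arm r) (arm (suc r))
    step′ 0 _ = inr (E 3 0) tt
    step′ 1 _ = tt
    step′ 2 (s≤s (s≤s h)) = joined-leave₂ h
    step′ (suc (suc (suc i))) (s≤s (s≤s h)) = joined-along₂ i h
  ... | tail h with m≤n⇒m<n∨m≡n h
  ...   | inj₂ refl = subst₂ Joined (sym (trans (p-tail h) (cong (λ x → 4 + x) (trans (cong (c +_) (n∸n≡0 (suc t)))
      (+-identityʳ c))))) (sym (p-arm 0))
            (joined-sym 3 (4 + c) (joined-leave₃ (s≤s z≤n)))
  ...   | inj₁ h′ = subst₂ Joined (sym (trans (p-tail h) (cong (4 +_) (trans (cong (c +_) (+-∸-assoc 1 h′))
      (+-suc c (s ∸ suc (suc t))))))) (sym (p-tail h′))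
            (joined-sym (4 + x) (5 + x) (joined-along₃ x (m≤m+n c _)
                (s≤s (s≤s (s≤s (s≤s (≤-trans (≡≤ (cong suc (trans (sym (+-suc c _)) (cong (c +_)
                (sym (+-∸-assoc 1 h′)))))) (+-monoʳ-< c (∸-monoʳ-< {s} (s≤s z≤n) h)))))))))
    where
    x : ℕ
    x = c + (s ∸ suc (suc t))

  labelling : Labelling n D E
  labelling = record { φ = φ ; ascending = λ a b h → ascending (view a b h) ; near = λ a b h → near (view a b h)
    ; p = p ; p<n = p<n ; p-edge = p-edge ; φ-p = φ-p }

  twin : Labelled.LabelTwin labelling (suc s) 1
  twin = record { j≤D = s≤s (m≤n+m s (suc c)) ; x<n = s≤s (s≤s z≤n) ; φ-x = refl
    ; at = subst (λ y → Joined y 1) (sym (p-arm 1)) tt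
    ; before = λ { i refl → subst (λ y → Joined y 1) (sym (p-arm 0)) (inr (E 3 1) tt) }
    ; after = λ _ → subst (λ y → Joined y 1) (sym (p-arm 2)) (inr (E 2 1) tt) }

  realised : Realised (fromEdges n E) (chainδ D (suc s))
  realised = realised-chain labelling twin

realised-B : ∀ c s → Realised (B (4 + c + s) s) (chainδ (2 + c + s) (suc s))
realised-B c s = subst (λ N → Realised (fromEdges (4 + c + s) (chainE (4 + c + s) N s)) (chainδ (2 + c + s) (suc s)))
  (sym (m+n∸n≡m (4 + c) s)) (ChainLabelling.realised c s)

module B1Labelling (m : ℕ) where

  n D : ℕ
  n = 6 + m
  D = 3 + m

  E : ℕ → ℕ → Bool
  E a b = K4⁻E a b
    ∨ ((a ≡ᵇ 0) ∧ (b ≡ᵇ 4) ∧ (4 <ᵇ n))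
    ∨ ((4 ≤ᵇ a) ∧ (b ≡ᵇ suc a) ∧ (b <ᵇ n))

  data Edges : ℕ → ℕ → Set where
    core : ∀ {a b} → K4⁻Edge a b → Edges a b
    leave : Edges 0 4
    along : ∀ {i} → Edges (4 + i) (5 + i)

  view : ∀ a b → T (E a b) → Edges a b
  view a b h = ∨-elim (K4⁻E a b) h (core ∘ k4⁻-edge a b) λ h → ∨-elim ((a ≡ᵇ 0) ∧ (b ≡ᵇ 4) ∧ (4 <ᵇ n)) h
    (λ e → leave′ (≡ᵇ⇒≡ a 0 (∧-left e)) (≡ᵇ⇒≡ b 4 (∧-left (∧-right (a ≡ᵇ 0) e))))
    (λ e → along′ (≤ᵇ⇒≤ 4 a (∧-left e)) (≡ᵇ⇒≡ b (suc a) (∧-left (∧-right (4 ≤ᵇ a) e))))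
    where
    leave′ : a ≡ 0 → b ≡ 4 → Edges a b
    leave′ refl refl = leave
    along′ : 4 ≤ a → b ≡ suc a → Edges a b
    along′ (s≤s (s≤s (s≤s (s≤s z≤n)))) refl = along

  -- Position on the path 1, 0, 4, 5, ..., n - 1; labels 2 and 3 are twins of its end 1.
  φ : ℕ → ℕ
  φ 0 = 1
  φ 1 = 0
  φ 2 = 0
  φ 3 = 0
  φ (suc (suc (suc (suc i)))) = 2 + i

  near : ∀ {a b} → Edges a b → φ a ≤ suc (φ b) × φ b ≤ suc (φ a)
  near (core e01) = ≤-refl , z≤n
  near (core e02) = ≤-refl , z≤n
  near (core e03) = ≤-refl , z≤n
  near (core e12) = z≤n , z≤n
  near (core e13) = z≤n , z≤n
  near leave = s≤s z≤n , ≤-refl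
  near along = ≤-trans (n≤1+n _) (n≤1+n _) , ≤-refl

  ascending : ∀ {a b} → Edges a b → a < b
  ascending (core e) = k4⁻-ascending e
  ascending leave = s≤s z≤n
  ascending along = ≤-refl

  p : ℕ → ℕ
  p 0 = 1
  p 1 = 0
  p (suc (suc i)) = 4 + i

  labelling : Labelling n D E
  labelling = record { φ = φ ; ascending = λ a b h → ascending (view a b h) ; near = λ a b h → near (view a b h)
    ; p = p ; p<n = p<n ; p-edge = p-edge ; φ-p = φ-p }
    where
    p<n : ∀ i → i ≤ D → p i < n
    p<n 0 _ = s≤s (s≤s z≤n)
    p<n 1 _ = s≤s z≤n
    p<n (suc (suc i)) h = +-monoʳ-≤ 3 h
    p-edge : ∀ i → i < D → T (E (p i) (p (suc i)) ∨ E (p (suc i)) (p i))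
    p-edge 0 _ = tt
    p-edge 1 _ = tt
    p-edge (suc (suc i)) h = inl (inr (K4⁻E (4 + i) (5 + i)) (both (≡ᵇ-refl i) (<⇒<ᵇ (+-monoʳ-≤ 3 h))))
    φ-p : ∀ i → i ≤ D → φ (p i) ≡ i
    φ-p 0 _ = refl
    φ-p 1 _ = refl
    φ-p (suc (suc i)) _ = refl

  open Labelled labelling

  twin₂ : LabelTwin 0 2
  twin₂ = record { j≤D = z≤n ; x<n = s≤s (s≤s (s≤s z≤n)) ; φ-x = refl ; at = tt ; before = λ _ () ; after = λ _ → tt }

  twin₃ : LabelTwin 0 3
  twin₃ = record { j≤D = z≤n ; x<n = s≤s (s≤s (s≤s (s≤s z≤n))) ; φ-x = refl ; at = tt ; before = λ _ () ; after = λ _ → tt }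

  realised : Realised (B1 n) (forkδ D 0 0 2)
  realised = realised-fork labelling 1 twin₂ twin₃ (λ ()) λ conn →
    ≤-antisym (≤-trans (d-step (Γ conn) {clamp 2} {clamp 0} (clamp 3) tt) (s≤s (d-edge≤1 (Γ conn) {clamp 0} {clamp 3} tt)))
      (d-nonadj (Γ conn) {clamp 2} {clamp 3} (λ ()) (λ h → h))

module B33Labelling (m : ℕ) where

  n D : ℕ
  n = 6 + m
  D = 3 + m

  E : ℕ → ℕ → Bool
  E a b =
       ((a ≡ᵇ 0) ∧ ((b ≡ᵇ 1) ∨ (b ≡ᵇ 2)))
     ∨ ((a ≡ᵇ 1) ∧ (b ≡ᵇ 2))
     ∨ ((a ≡ᵇ 3) ∧ ((b ≡ᵇ 4) ∨ (b ≡ᵇ 5)))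
     ∨ ((a ≡ᵇ 4) ∧ (b ≡ᵇ 5))
     ∨ ((n ≡ᵇ 6) ∧ (a ≡ᵇ 0) ∧ (b ≡ᵇ 3))
     ∨ ((7 ≤ᵇ n) ∧ (a ≡ᵇ 0) ∧ (b ≡ᵇ 6))
     ∨ ((6 ≤ᵇ a) ∧ (b ≡ᵇ suc a) ∧ (b <ᵇ n))
     ∨ ((7 ≤ᵇ n) ∧ (a ≡ᵇ 3) ∧ (b ≡ᵇ n ∸ 1))

  data Edges : ℕ → ℕ → Set where
    e01 : Edges 0 1
    e02 : Edges 0 2
    e12 : Edges 1 2
    e34 : Edges 3 4
    e35 : Edges 3 5
    e45 : Edges 4 5
    e03 : m ≡ 0 → Edges 0 3
    e06 : 1 ≤ m → Edges 0 6
    along : ∀ {i} → suc i < m → Edges (6 + i) (7 + i)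
    e3n : 1 ≤ m → Edges 3 (5 + m)

  view : ∀ a b → T (E a b) → Edges a b
  view a b h = ∨-elim ((a ≡ᵇ 0) ∧ ((b ≡ᵇ 1) ∨ (b ≡ᵇ 2))) h
    (λ e → ∨-elim (b ≡ᵇ 1) (∧-right (a ≡ᵇ 0) e) (λ f → v01 (≡ᵇ⇒≡ a 0 (∧-left e)) (≡ᵇ⇒≡ b 1 f)) (λ f →
        v02 (≡ᵇ⇒≡ a 0 (∧-left e)) (≡ᵇ⇒≡ b 2 f)))
    λ h → ∨-elim ((a ≡ᵇ 1) ∧ (b ≡ᵇ 2)) h
    (λ e → v12 (≡ᵇ⇒≡ a 1 (∧-left e)) (≡ᵇ⇒≡ b 2 (∧-right (a ≡ᵇ 1) e)))
    λ h → ∨-elim ((a ≡ᵇ 3) ∧ ((b ≡ᵇ 4) ∨ (b ≡ᵇ 5))) h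
    (λ e → ∨-elim (b ≡ᵇ 4) (∧-right (a ≡ᵇ 3) e) (λ f → v34 (≡ᵇ⇒≡ a 3 (∧-left e)) (≡ᵇ⇒≡ b 4 f)) (λ f →
        v35 (≡ᵇ⇒≡ a 3 (∧-left e)) (≡ᵇ⇒≡ b 5 f)))
    λ h → ∨-elim ((a ≡ᵇ 4) ∧ (b ≡ᵇ 5)) h
    (λ e → v45 (≡ᵇ⇒≡ a 4 (∧-left e)) (≡ᵇ⇒≡ b 5 (∧-right (a ≡ᵇ 4) e)))
    λ h → ∨-elim ((n ≡ᵇ 6) ∧ (a ≡ᵇ 0) ∧ (b ≡ᵇ 3)) h
    (λ e → v03 (≡ᵇ⇒≡ m 0 (∧-left e)) (≡ᵇ⇒≡ a 0 (∧-left (∧-right (n ≡ᵇ 6) e))) (≡ᵇ⇒≡ b 3 (∧-right (a ≡ᵇ 0)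
        (∧-right (n ≡ᵇ 6) e))))
    λ h → ∨-elim ((7 ≤ᵇ n) ∧ (a ≡ᵇ 0) ∧ (b ≡ᵇ 6)) h
    (λ e → v06 (≤ᵇ⇒≤ 7 n (∧-left e)) (≡ᵇ⇒≡ a 0 (∧-left (∧-right (7 ≤ᵇ n) e))) (≡ᵇ⇒≡ b 6 (∧-right (a ≡ᵇ 0)
        (∧-right (7 ≤ᵇ n) e))))
    λ h → ∨-elim ((6 ≤ᵇ a) ∧ (b ≡ᵇ suc a) ∧ (b <ᵇ n)) h
    (λ e → along′ (≤ᵇ⇒≤ 6 a (∧-left e)) (≡ᵇ⇒≡ b (suc a) (∧-left (∧-right (6 ≤ᵇ a) e))) (<ᵇ⇒< b n (∧-right (b ≡ᵇ suc a)
        (∧-right (6 ≤ᵇ a) e))))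
    (λ e → v3n (≤ᵇ⇒≤ 7 n (∧-left e)) (≡ᵇ⇒≡ a 3 (∧-left (∧-right (7 ≤ᵇ n) e))) (≡ᵇ⇒≡ b (n ∸ 1) (∧-right (a ≡ᵇ 3)
        (∧-right (7 ≤ᵇ n) e))))
    where
    v01 : a ≡ 0 → b ≡ 1 → Edges a b
    v01 refl refl = e01
    v02 : a ≡ 0 → b ≡ 2 → Edges a b
    v02 refl refl = e02
    v12 : a ≡ 1 → b ≡ 2 → Edges a b
    v12 refl refl = e12
    v34 : a ≡ 3 → b ≡ 4 → Edges a b
    v34 refl refl = e34
    v35 : a ≡ 3 → b ≡ 5 → Edges a b
    v35 refl refl = e35
    v45 : a ≡ 4 → b ≡ 5 → Edges a b
    v45 refl refl = e45
    v03 : m ≡ 0 → a ≡ 0 → b ≡ 3 → Edges a b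
    v03 m≡0 refl refl = e03 m≡0
    v06 : 7 ≤ n → a ≡ 0 → b ≡ 6 → Edges a b
    v06 h refl refl = e06 (+-cancelˡ-≤ 6 1 m h)
    along′ : 6 ≤ a → b ≡ suc a → b < n → Edges a b
    along′ (s≤s (s≤s (s≤s (s≤s (s≤s (s≤s z≤n)))))) refl h = along (+-cancelˡ-≤ 6 _ m h)
    v3n : 7 ≤ n → a ≡ 3 → b ≡ 5 + m → Edges a b
    v3n h refl refl = e3n (+-cancelˡ-≤ 6 1 m h)

  -- Position on the path 1, 0, 6, ..., n - 1, 3, 4; labels 2 and 5 are twins of its two ends. For n
  -- = 6 it is 1, 0, 3, 4.
  φ : ℕ → ℕ
  φ 0 = 1
  φ 1 = 0
  φ 2 = 0
  φ 3 = 2 + m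
  φ 4 = 3 + m
  φ 5 = 3 + m
  φ (suc (suc (suc (suc (suc (suc i)))))) = 2 + i

  near : ∀ {a b} → Edges a b → φ a ≤ suc (φ b) × φ b ≤ suc (φ a)
  near e01 = ≤-refl , z≤n
  near e02 = ≤-refl , z≤n
  near e12 = z≤n , z≤n
  near e34 = ≤-trans (n≤1+n _) (n≤1+n _) , ≤-refl
  near e35 = ≤-trans (n≤1+n _) (n≤1+n _) , ≤-refl
  near e45 = n≤1+n _ , n≤1+n _
  near (e03 m≡0) = s≤s z≤n , ≤-trans (≡≤ (cong (2 +_) m≡0)) ≤-refl
  near (e06 _) = s≤s z≤n , ≤-refl
  near (along _) = ≤-trans (n≤1+n _) (n≤1+n _) , ≤-refl
  near (e3n 1≤m) = last 1≤m
    where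
    last : ∀ {m} → 1 ≤ m → 2 + m ≤ suc (φ (5 + m)) × φ (5 + m) ≤ suc (2 + m)
    last {suc m} _ = ≤-refl , ≤-trans (n≤1+n _) (n≤1+n _)

  ascending : ∀ {a b} → Edges a b → a < b
  ascending e01 = s≤s z≤n
  ascending e02 = s≤s z≤n
  ascending e12 = s≤s (s≤s z≤n)
  ascending e34 = ≤-refl
  ascending e35 = n≤1+n _
  ascending e45 = ≤-refl
  ascending (e03 _) = s≤s z≤n
  ascending (e06 _) = s≤s z≤n
  ascending (along _) = ≤-refl
  ascending (e3n _) = s≤s (s≤s (s≤s (s≤s z≤n)))

  p : ℕ → ℕ
  p 0 = 1
  p 1 = 0
  p (suc (suc i)) with <-cmp i m
  ... | tri< _ _ _ = 6 + i
  ... | tri≈ _ _ _ = 3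
  ... | tri> _ _ _ = 4

  p-inner : ∀ {i} → i < m → p (2 + i) ≡ 6 + i
  p-inner {i} h with <-cmp i m
  ... | tri< _ _ _ = refl
  ... | tri≈ ¬h _ _ = ⊥-elim (¬h h)
  ... | tri> ¬h _ _ = ⊥-elim (¬h h)

  p-3 : p (2 + m) ≡ 3
  p-3 with <-cmp m m
  ... | tri< _ ne _ = ⊥-elim (ne refl)
  ... | tri≈ _ _ _ = refl
  ... | tri> _ ne _ = ⊥-elim (ne refl)

  p-4 : p (3 + m) ≡ 4
  p-4 with <-cmp (suc m) m
  ... | tri< _ _ ¬gt = ⊥-elim (¬gt ≤-refl)
  ... | tri≈ _ _ ¬gt = ⊥-elim (¬gt ≤-refl)
  ... | tri> _ _ _ = refl

  Joined : ℕ → ℕ → Set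
  Joined a b = T (E a b ∨ E b a)

  joined : ∀ {a b} → Edges a b → Joined a b
  joined e01 = tt
  joined e02 = tt
  joined e12 = tt
  joined e34 = tt
  joined e35 = tt
  joined e45 = tt
  joined (e03 m≡0) = inl (inl (both (≡⇒≡ᵇ m 0 m≡0) tt))
  joined (e06 1≤m) = inl (inr ((n ≡ᵇ 6) ∧ false) (inl (both (≤⇒≤ᵇ (+-monoʳ-≤ 6 1≤m)) tt)))
  joined (along {i} h) = inl (inr ((n ≡ᵇ 6) ∧ false) (inr ((7 ≤ᵇ n) ∧ false) (inl (both (≡ᵇ-refl i) (<⇒<ᵇ (+-monoʳ-≤ 6 h))))))
  joined (e3n 1≤m) = inl (inr (m ≡ᵇ 0) (inr ((n ≡ᵇ 6) ∧ false) (inr ((7 ≤ᵇ n) ∧ false) (both (≤⇒≤ᵇ (+-monoʳ-≤ 6 1≤m))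
      (≡ᵇ-refl m)))))

  joined-sym : ∀ a b → Joined a b → Joined b a
  joined-sym a b h = ∨-elim (E a b) h (inr (E b a)) inl

  data Position : ℕ → Set where
    at-1 : Position 0
    at-0 : Position 1
    inner : ∀ {i} → i < m → Position (2 + i)
    at-3 : Position (2 + m)
    at-4 : Position (3 + m)

  position : ∀ i → i ≤ D → Position i
  position 0 _ = at-1
  position 1 _ = at-0
  position (suc (suc i)) (s≤s (s≤s h)) with m≤n⇒m<n∨m≡n h
  ... | inj₂ refl = at-4
  ... | inj₁ i<1+m with m≤n⇒m<n∨m≡n (s≤s⁻¹ i<1+m)
  ...   | inj₁ i<m = inner i<m
  ...   | inj₂ refl = at-3

  labelling : Labelling n D E
  labelling = record { φ = φ ; ascending = λ a b h → ascending (view a b h) ; near = λ a b h → near (view a b h)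
    ; p = p ; p<n = p<n ; p-edge = p-edge ; φ-p = φ-p }
    where
    p<n : ∀ i → i ≤ D → p i < n
    p<n i i≤D with position i i≤D
    ... | at-1 = s≤s (s≤s z≤n)
    ... | at-0 = s≤s z≤n
    ... | inner h = subst (_< n) (sym (p-inner h)) (+-monoʳ-< 6 h)
    ... | at-3 = subst (_< n) (sym p-3) (s≤s (s≤s (s≤s (s≤s z≤n))))
    ... | at-4 = subst (_< n) (sym p-4) (s≤s (s≤s (s≤s (s≤s (s≤s z≤n)))))
    φ-p : ∀ i → i ≤ D → φ (p i) ≡ i
    φ-p i i≤D with position i i≤D
    ... | at-1 = refl
    ... | at-0 = refl
    ... | inner h = cong φ (p-inner h)
    ... | at-3 = cong φ p-3
    ... | at-4 = cong φ p-4
    p-edge : ∀ i → i < D → Joined (p i) (p (suc i))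
    p-edge i i<D with position i (<⇒≤ i<D)
    ... | at-1 = joined-sym 0 1 (joined e01)
    ... | at-0 = from-0 (m≤n⇒m<n∨m≡n (z≤n {m}))
      where
      from-0 : 0 < m ⊎ 0 ≡ m → Joined 0 (p 2)
      from-0 (inj₁ 1≤m) = subst (Joined 0) (sym (p-inner 1≤m)) (joined (e06 1≤m))
      from-0 (inj₂ 0≡m) = subst (Joined 0) (sym (trans (cong (λ k → p (2 + k)) 0≡m) p-3)) (joined (e03 (sym 0≡m)))
    ... | inner {i′} h = onward (m≤n⇒m<n∨m≡n h)
      where
      onward : suc i′ < m ⊎ suc i′ ≡ m → Joined (p (2 + i′)) (p (3 + i′))
      onward (inj₁ h′) = subst₂ Joined (sym (p-inner h)) (sym (p-inner h′)) (joined (along h′))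
      onward (inj₂ eq) = subst₂ Joined (trans (cong (5 +_) (sym eq)) (sym (p-inner h)))
          (sym (trans (cong (λ k → p (2 + k)) eq) p-3))
        (joined-sym 3 (5 + m) (joined (e3n (≤-trans (s≤s z≤n) h))))
    ... | at-3 = subst₂ Joined (sym p-3) (sym p-4) (joined e34)
    ... | at-4 = ⊥-elim (<-irrefl refl i<D)

  open Labelled labelling

  twin₂ : LabelTwin 0 2
  twin₂ = record { j≤D = z≤n ; x<n = s≤s (s≤s (s≤s z≤n)) ; φ-x = refl ; at = tt ; before = λ _ () ; after = λ _ → tt }

  twin₅ : LabelTwin D 5
  twin₅ = record { j≤D = ≤-refl ; x<n = s≤s (s≤s (s≤s (s≤s (s≤s (s≤s z≤n))))) ; φ-x = refl
    ; at = subst (λ y → Joined y 5) (sym p-4) (joined e45)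
    ; before = λ { i refl → subst (λ y → Joined y 5) (sym p-3) (joined e35) }
    ; after = λ h → ⊥-elim (<-irrefl refl h) }

  realised : Realised (B33 n) (forkδ D 0 D D)
  realised = realised-fork labelling (2 + m) twin₂ twin₅ (λ ()) across
    where
    across : ∀ conn → d (Γ conn) (clamp 2) (clamp 5) ≡ 3 + m
    across conn = ≤-antisym
      (≤-trans (d-step (Γ conn) {clamp 2} {clamp 0} (clamp 5) (joined-sym 0 2 (joined e02))) (s≤s
        (≤-trans (≡≤ (twin-φ S (twin′ conn twin₅) (φ-twin conn twin₅) 1 (s≤s z≤n))) (≡≤ (peak-below 1 1 (1 + m))))))
      (≤-trans (φ-≤′ S {clamp 2} {clamp 5} refl refl) (≡≤ (+-identityʳ _)))
      where
      S = strand′ conn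

realised-B′ : ∀ {n} c s → n ≡ 4 + c + s → Realised (B n s) (chainδ (suc s + suc c) (suc s))
realised-B′ c s refl = subst (λ D → Realised (B (4 + c + s) s) (chainδ D (suc s)))
    (cong suc (trans (cong suc (+-comm c s)) (sym (+-suc s c)))) (realised-B c s)

wiener-B : ∀ {n} c s → n ≡ 4 + c + s → W (B n s) ≡ pathWiener (suc (suc s + suc c)) + (tri (suc s) + 1 + tri (suc c))
wiener-B {n} c s eq = trans (Realised.wiener (realised-B′ c s eq))
  (trans (cong (λ k → pairSum k (chainδ (suc s + suc c) (suc s))) (trans eq (regroup c s))) (pairSum-chain (suc s) (suc c)))
  where
  regroup : ∀ c s → 4 + c + s ≡ 2 + (suc s + suc c)
  regroup c s = solve (c ∷ s ∷ [])

-- Comparison of the Wiener indices and the final classification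

module Values (m : ℕ) where

  X t : ℕ
  X = pathWiener (4 + m)
  t = tri (3 + m)

  wiener-B1 : W (B1 (6 + m)) ≡ X + (1 + t) + (t + 1 + 2)
  wiener-B1 = trans (Realised.wiener (B1Labelling.realised m)) (pairSum-fork (3 + m) 0 2 (trans (sumTo-peak 1 0 (3 + m))
      (+-comm 1 t)))

  wiener-B33 : W (B33 (6 + m)) ≡ X + (1 + t) + (t + 1 + (3 + m))
  wiener-B33 = trans (Realised.wiener (B33Labelling.realised m)) (pairSum-fork (3 + m) (3 + m) (3 + m)
    (trans (cong (λ k → sumTo (suc k) (peak 1 (3 + m))) (sym (+-identityʳ (3 + m)))) (trans (sumTo-peak 1 (3 + m) 0)
        (+-identityʳ (t + 1)))))

  wiener-B0 : W (B (6 + m) 0) ≡ X + (4 + m + t) + (1 + 1 + t)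
  wiener-B0 = wiener-B {6 + m} (2 + m) 0 (sym (+-identityʳ (6 + m)))

  wiener-Bs1 : W (B (6 + m) 1) ≡ X + (4 + m + t) + (3 + 1 + tri (2 + m))
  wiener-Bs1 = wiener-B {6 + m} (1 + m) 1 (cong (5 +_) (+-comm 1 m))

  B33<B0 : W (B33 (6 + m)) < W (B (6 + m) 0)
  B33<B0 = subst₂ _<_ (sym wiener-B33) (sym wiener-B0) (≡≤ (identity X t m))
    where
    identity : ∀ X t m → suc (X + (1 + t) + (t + 1 + (3 + m))) ≡ X + (4 + m + t) + (1 + 1 + t)
    identity X t m = solve (X ∷ t ∷ m ∷ [])

  B1<Bs1 : W (B1 (6 + m)) < W (B (6 + m) 1)
  B1<Bs1 = subst₂ _<_ (sym wiener-B1) (sym wiener-Bs1) (≡≤ (identity X (tri (2 + m)) m))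
    where
    identity : ∀ X s m → suc (X + (1 + (3 + m + s)) + (3 + m + s + 1 + 2)) ≡ X + (4 + m + (3 + m + s)) + (3 + 1 + s)
    identity X s m = solve (X ∷ s ∷ m ∷ [])

  -- The difference is n - 6: equality at n = 6, strict inequality from n = 7 on.
  Bs1+m≡B33 : W (B (6 + m) 1) + m ≡ W (B33 (6 + m))
  Bs1+m≡B33 = trans (cong (_+ m) wiener-Bs1) (trans (identity X (tri (2 + m)) m) (sym wiener-B33))
    where
    identity : ∀ X s m → X + (4 + m + (3 + m + s)) + (3 + 1 + s) + m ≡ X + (1 + (3 + m + s)) + (3 + m + s + 1 + (3 + m))
    identity X s m = solve (X ∷ s ∷ m ∷ [])

  tight⇒< : ∀ {w} → w + 3 * (6 + m) ≤ pathWiener (6 + m) + 8 → w < W (B1 (6 + m))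
  tight⇒< {w} h = subst (w <_) (sym wiener-B1) (+-cancelʳ-≤ (3 * (6 + m)) (suc w) _ (≤-trans (s≤s h) (≡≤ (identity X t m))))
    where
    identity : ∀ X t m → suc (X + (4 + m + t) + (5 + m + (4 + m + t)) + 8) ≡ X + (1 + t) + (t + 1 + 2) + 3 * (6 + m)
    identity X t m = solve (X ∷ t ∷ m ∷ [])

  -- With arms 3 + a and 3 + b, f exceeds 3n - 8 by (a + b - 1) + a·b. Only a = b = 0 falls below,
  -- and that is B(8,2).
  central-chain : ∀ {w} a b → 6 + m ≡ 2 + ((3 + a) + (3 + b)) → 1 ≤ a + b →
    w ≡ pathWiener (suc ((3 + a) + (3 + b))) + (tri (3 + a) + 1 + tri (3 + b)) → w + 3 * (6 + m) ≤ pathWiener (6 + m) + 8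
  central-chain a b order 1≤a+b refl = subst (λ n → Y + z + 3 * n ≤ pathWiener n + 8) (sym order)
    (≤-trans (≡≤ (+-assoc Y z _)) (≤-trans (+-monoʳ-≤ Y excess) (≡≥ (+-assoc Y (tri (suc (p + q))) 8))))
    where
    p q Y z : ℕ
    p = 3 + a
    q = 3 + b
    Y = pathWiener (suc (p + q))
    z = tri p + 1 + tri q
    identity : ∀ a b u w → u + 1 + w + 3 * (2 + ((3 + a) + (3 + b))) + (a + b) + b * a ≡ suc ((3 + a) + (3 + b)) +
        (u + (3 + b) * (3 + a) + w) + 8 + 1
    identity a b u w = solve (a ∷ b ∷ u ∷ w ∷ [])
    abstracted : ∀ u w → u + 1 + w + 3 * (2 + (p + q)) ≤ suc (p + q) + (u + q * p + w) + 8
    abstracted u w = lin {u + 1 + w + 3 * (2 + (p + q))} (b * a) 1≤a+b (identity a b u w)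
    excess : z + 3 * (2 + (p + q)) ≤ tri (suc (p + q)) + 8
    excess = ≤-trans (abstracted (tri p) (tri q)) (≡≥ (cong (λ x → suc (p + q) + x + 8) (tri-+ p q)))

wiener-B82 : W (B 8 2) ≡ W (B1 8)
wiener-B82 = trans (wiener-B {8} 2 2 refl) (sym (Values.wiener-B1 2))

chain-iso : ∀ {n} {Γ : ConnectedGraph n} j j′ s c → j ≡ suc s → j′ ≡ suc c → n ≡ 2 + (j + j′) →
    Layout Γ n (chainδ (j + j′) j) → adj Γ ≅ B n s
chain-iso j j′ s c refl refl order L = Realised.iso (realised-B′ c s (trans order (regroup c s))) L
  where
  regroup : ∀ c s → 2 + (suc s + suc c) ≡ 4 + c + s
  regroup c s = solve (c ∷ s ∷ [])

module Classification {m} (Γ : ConnectedGraph (6 + m)) (count : edges Γ ≡ 7 + m)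
  (≇B0 : ¬ adj Γ ≅ B (6 + m) 0) (≇Bs1 : ¬ adj Γ ≅ B (6 + m) 1) (≇B1 : ¬ adj Γ ≅ B1 (6 + m)) (≇B33 : ¬ adj Γ ≅ B33 (6 + m)) where
  open Values m

  Exceptional : Set
  Exceptional = 6 + m ≡ 8 × adj Γ ≅ B (6 + m) 2

  -- An arm of length 1 or 2, at either end, identifies B(n,0) or B(n,1); otherwise both arms have
  -- length at least 3.
  long-case : ChainShape Γ → TightBound Γ ⊎ Exceptional
  long-case C = go j j′ 1≤j 1≤j′ order layout layout′
    where
    open ChainShape C
    go : ∀ j j′ → 1 ≤ j → 1 ≤ j′ → 6 + m ≡ 2 + (j + j′) → Layout Γ (6 + m) (chainδ (j + j′) j) →
        Layout Γ (6 + m) (chainδ (j + j′) j′) → TightBound Γ ⊎ Exceptional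
    go 1 (suc c) _ _ order L _ = ⊥-elim (≇B0 (chain-iso 1 (suc c) 0 c refl refl order L))
    go 2 (suc c) _ _ order L _ = ⊥-elim (≇Bs1 (chain-iso 2 (suc c) 1 c refl refl order L))
    go (suc c) 1 _ _ order _ L = ⊥-elim (≇B0 (chain-iso 1 (suc c) 0 c refl refl
      (trans order (cong (2 +_) (+-comm (suc c) 1))) (subst (λ D → Layout Γ (6 + m) (chainδ D 1)) (+-comm (suc c) 1) L)))
    go (suc c) 2 _ _ order _ L = ⊥-elim (≇Bs1 (chain-iso 2 (suc c) 1 c refl refl
      (trans order (cong (2 +_) (+-comm (suc c) 2))) (subst (λ D → Layout Γ (6 + m) (chainδ D 2)) (+-comm (suc c) 2) L)))
    go (suc (suc (suc a))) (suc (suc (suc b))) _ _ order L _ = [ (λ 1≤a+b → inj₁ (central-chain a b order 1≤a+b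
        (trans (layout-wiener L)
        (trans (cong (λ k → pairSum k (chainδ ((3 + a) + (3 + b)) (3 + a))) order) (pairSum-chain (3 + a) (3 + b))))))
      , (λ 0≡a+b → centre (m+n≡0⇒m≡0 a (sym 0≡a+b)) (m+n≡0⇒n≡0 a (sym 0≡a+b))) ]′ (m≤n⇒m<n∨m≡n (z≤n {a + b}))
      where
      centre : a ≡ 0 → b ≡ 0 → TightBound Γ ⊎ Exceptional
      centre refl refl = inj₂ (order , chain-iso 3 3 2 2 refl refl order L)

  short-case : Short Γ → TightBound Γ
  short-case short with any? (λ v → deg Γ v ≤? 1)
  ... | no none = [ id , (λ L → ⊥-elim (≇B33 (Realised.iso (B33Labelling.realised m) L))) ]′
          (noPendant Γ short count (λ u → ≰⇒> (λ le → none (u , le))))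
  ... | yes (v , one) = [ fork , id ]′ (pendant-bound⁺ Γ ev one short count)
    where
    ev : Edge Γ v _
    ev = proj₁ (proj₂ (neighbour-toward Γ {v} {punchIn v fzero} (punchInᵢ≢i v fzero ∘ sym)))
    fork : Pendant.Fork Γ ev one short count → TightBound Γ
    fork F = ⊥-elim (≇B1 (Realised.iso (B1Labelling.realised m)
      (subst (λ e → Layout Γ (6 + m) (forkδ e 0 0 2)) e≡3+m (ForkLayout.forkLayout′ Γ ev one short count F))))
      where
      open Pendant Γ ev one short count using (P; module Fork)
      e≡3+m : Periphery.e P ≡ 3 + m
      e≡3+m = +-cancelˡ-≡ 3 _ (3 + m) (size-K Γ P 2 (Fork.k≡2 F))

  classify : W (adj Γ) < W (B1 (6 + m)) ⊎ Exceptional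
  classify = [ inj₁ ∘ strict ∘ short-case , (λ (_ , _ , long) → [ inj₁ ∘ strict , inj₂ ]′ (long-case (chainShape Γ
      (≡≥ count) long))) ]′ (short? Γ)
    where
    strict : TightBound Γ → W (adj Γ) < W (B1 (6 + m))
    strict tight = subst (_< W (B1 (6 + m))) (Wiener≡W Γ) (tight⇒< tight)

theorem2p2 : (n : ℕ) → 6 ≤ n → (G : Graph n) → Bicyclic G
    → ¬ (G ≅ B n 0) → ¬ (G ≅ B n 1) → ¬ (G ≅ B1 n) → ¬ (G ≅ B33 n)
    → (n ≡ 6 → (W G < W (B1 n)) × (W (B1 n) < W (B n 1)) × (W (B n 1) ≡ W (B33 n)) × (W (B33 n) < W (B n 0)))
    × (n ≡ 8 → ¬ (G ≅ B n 2) → (W G < W (B n 2)) × (W (B n 2) ≡ W (B1 n)) × (W (B1 n) < W (B n 1)) × (W (B n 1) < W (B33 n)) × (W (B33 n) < W (B n 0)))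
    × (7 ≤ n → n ≢ 8 → (W G < W (B1 n)) × (W (B1 n) < W (B n 1)) × (W (B n 1) < W (B33 n)) × (W (B33 n) < W (B n 0)))
theorem2p2 _ (s≤s (s≤s (s≤s (s≤s (s≤s (s≤s (z≤n {m}))))))) G (simple , connected , count) ≇B0 ≇Bs1 ≇B1 ≇B33 =
  let open Values m
      Γ = connectedGraph G simple connected
      classified = Classification.classify Γ (trans (edges≡edgeCount Γ) (trans count (+-comm (6 + m) 1))) ≇B0 ≇Bs1 ≇B1 ≇B33
      Bs1<B33 : 7 ≤ 6 + m → W (B (6 + m) 1) < W (B33 (6 + m))
      Bs1<B33 7≤ = ≤-trans (≤-trans (≡≤ (+-comm 1 _)) (+-monoʳ-≤ (W (B (6 + m) 1)) (+-cancelˡ-≤ 6 1 m 7≤))) (≡≤ Bs1+m≡B33)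
      m≡0 : 6 + m ≡ 6 → m ≡ 0
      m≡0 eq = +-cancelˡ-≡ 6 m 0 eq
  -- The exceptional graph has order 8, so it matters in the second case only; n = 6 makes the
  -- offset m between B(n,1) and B33 vanish.
  in (λ n≡6 → [ id , (λ exc → ⊥-elim (case trans (sym n≡6) (proj₁ exc) of λ ())) ]′ classified
            , B1<Bs1 , trans (sym (trans (cong (W (B (6 + m) 1) +_) (m≡0 n≡6)) (+-identityʳ _))) Bs1+m≡B33 , B33<B0)
   , (λ n≡8 ≇Bs2 → let B2≡B1 = subst (λ k → W (B k 2) ≡ W (B1 k)) (sym n≡8) wiener-B82 in
            ≤-trans ([ id , (λ exc → ⊥-elim (≇Bs2 (proj₂ exc))) ]′ classified) (≡≥ B2≡B1)
            , B2≡B1 , B1<Bs1 , Bs1<B33 (≤-trans (n≤1+n 7) (≡≥ n≡8)) , B33<B0)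
   , (λ 7≤n n≢8 → [ id , (λ exc → ⊥-elim (n≢8 (proj₁ exc))) ]′ classified , B1<Bs1 , Bs1<B33 7≤n , B33<B0)
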